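{- For a finite structure $M$ of order $n$ whose vocabulary has maximum relation arity $k$, $$D_1(M)\le\max\left\{\left(1-\frac1{2k}\right)n+k^2-k+2,\ \sigma(M)+k\right\},$$ where $D_1(M)$ is the minimum quantifier rank of a first-order formula with alternation number at most $1$ that defines $M$.
   Context: A vocabulary $L$ is a finite list of relation symbols with positive integer arities; maximum relation arity = largest arity. An $L$-structure $M$ has a finite universe $V(M)$ and relations $R^M:V(M)^l\to\{0,1\}$ for each $l$-ary symbol $R$; its order is $|V(M)|$. For $a,b\in V(M)$, $a\sim b$ means the transposition of $a$ and $b$ is an automorphism of $M$; this is an equivalence relation, and $\sigma(M)$ is the maximum size of a $\sim$-equivalence class. First-order formulas are over $L\cup\{=\}$ with $\neg,\wedge,\vee$. For a formula $\Phi$, $\mathrm{nest}(\Phi)$ is defined by: $\{\text{empty word}\}$ for atomic; swap $\exists,\forall$ for $\neg\Phi$; union for $\wedge,\vee$; prefix $\exists$/$\forall$ for $\exists x\Phi$/$\forall x\Phi$. Quantifier rank = maximum word length in $\mathrm{nest}(\Phi)$; alternation number = maximum number of consecutive-letter occurrences of $\exists\forall$ or $\forall\exists$ in a word of $\mathrm{nest}(\Phi)$. A closed formula $\Phi$ defines $M$ if it is true on $M$ and false on every $L$-structure not isomorphic to $M$. -}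

module Defs where

open import Data.Nat using (ℕ; zero; suc; _⊔_; _≤_)
open import Data.Bool using (Bool; true; false)
import Data.Bool as Bool
open import Data.Fin using (Fin)
open import Data.Fin.Properties using (all?)
open import Data.Fin.Permutation.Components using (transpose)
open import Data.List using (List; []; _∷_; length; lookup; foldr; _++_; allFin; filter)
import Data.List as List
open import Data.Vec using (Vec; []; _∷_)
import Data.Vec as Vec
open import Data.Product using (Σ; _×_; _,_)
open import Data.Sum using (_⊎_)
open import Relation.Nullary using (¬_; Dec; yes; no)
open import Relation.Nullary.Decidable using (map′)
open import Relation.Binary.PropositionalEquality using (_≡_)
open import Function.Bundles using (_↔_; Inverse)

Vocab : Set
Vocab = List ℕ

Sym : Vocab → Set
Sym L = Fin (length L)

arity : (L : Vocab) → Sym L → ℕ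
arity L i = lookup L i

maxArity : Vocab → ℕ
maxArity L = foldr _⊔_ 0 L

record Structure (L : Vocab) (n : ℕ) : Set where
  field
    rel : (i : Sym L) → Vec (Fin n) (arity L i) → Bool
open Structure public

record Iso {L : Vocab} {m n : ℕ} (N : Structure L m) (M : Structure L n) : Set where
  field
    bij      : Fin m ↔ Fin n
    preserve : ∀ (i : Sym L) (t : Vec (Fin m) (arity L i)) →
               rel M i (Vec.map (Inverse.to bij) t) ≡ rel N i t

Sim : ∀ {L n} → Structure L n → Fin n → Fin n → Set
Sim {L} M a b = ∀ (i : Sym L) (t : Vec _ (arity L i)) →
                rel M i (Vec.map (transpose a b) t) ≡ rel M i t

allVec? : ∀ {n} (l : ℕ) {P : Vec (Fin n) l → Set} →
          (∀ v → Dec (P v)) → Dec (∀ v → P v)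
allVec? zero {P} P? with P? []
... | yes p = yes λ { [] → p }
... | no ¬p = no λ f → ¬p (f [])
allVec? {n} (suc l) {P} P? with all? {n} (λ a → allVec? l {λ v → P (a ∷ v)} (λ v → P? (a ∷ v)))
... | yes f = yes λ { (a ∷ v) → f a v }
... | no ¬f = no λ g → ¬f (λ a v → g (a ∷ v))

sim? : ∀ {L n} (M : Structure L n) (a b : Fin n) → Dec (Sim M a b)
sim? {L} M a b = all? (λ i → allVec? (arity L i) (λ t →
  rel M i (Vec.map (transpose a b) t) Bool.≟ rel M i t))

classSize : ∀ {L n} → Structure L n → Fin n → ℕ
classSize {n = n} M a = length (filter (sim? M a) (allFin n))

-- σ(M): maximum size of a ∼-equivalence class (0 for the empty structure)
σ : ∀ {L n} → Structure L n → ℕ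
σ {n = n} M = foldr _⊔_ 0 (List.map (classSize M) (allFin n))

-- First-order formulas over L ∪ {=}, with variables in scope Fin v
-- (de Bruijn style: ∃'/∀' bind a new variable 0)

data Formula (L : Vocab) (v : ℕ) : Set where
  rel' : (i : Sym L) → Vec (Fin v) (arity L i) → Formula L v
  eq'  : Fin v → Fin v → Formula L v
  ¬'   : Formula L v → Formula L v
  _∧'_ : Formula L v → Formula L v → Formula L v
  _∨'_ : Formula L v → Formula L v → Formula L v
  ∃'   : Formula L (suc v) → Formula L v
  ∀'   : Formula L (suc v) → Formula L v

Sat : ∀ {L n v} → Structure L n → Formula L v → Vec (Fin n) v → Set
Sat M (rel' i xs) env = rel M i (Vec.map (Vec.lookup env) xs) ≡ true
Sat M (eq' x y)   env = Vec.lookup env x ≡ Vec.lookup env y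
Sat M (¬' φ)      env = ¬ Sat M φ env
Sat M (φ ∧' ψ)    env = Sat M φ env × Sat M ψ env
Sat M (φ ∨' ψ)    env = Sat M φ env ⊎ Sat M ψ env
Sat {n = n} M (∃' φ) env = Σ (Fin n) λ a → Sat M φ (a ∷ env)
Sat {n = n} M (∀' φ) env = (a : Fin n) → Sat M φ (a ∷ env)

Defines : ∀ {L n} → Formula L 0 → Structure L n → Set
Defines {L} Φ M = Sat M Φ [] ×
  (∀ (m : ℕ) (N : Structure L m) → Sat N Φ [] → Iso N M)

data Q : Set where
  E A : Q

swapQ : Q → Q
swapQ E = A
swapQ A = E

nest : ∀ {L v} → Formula L v → List (List Q)
nest (rel' _ _) = [] ∷ []
nest (eq' _ _)  = [] ∷ []
nest (¬' φ)     = List.map (List.map swapQ) (nest φ)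
nest (φ ∧' ψ)   = nest φ ++ nest ψ
nest (φ ∨' ψ)   = nest φ ++ nest ψ
nest (∃' φ)     = List.map (E ∷_) (nest φ)
nest (∀' φ)     = List.map (A ∷_) (nest φ)

alternations : List Q → ℕ
alternations (E ∷ A ∷ w) = suc (alternations (A ∷ w))
alternations (A ∷ E ∷ w) = suc (alternations (E ∷ w))
alternations (E ∷ E ∷ w) = alternations (E ∷ w)
alternations (A ∷ A ∷ w) = alternations (A ∷ w)
alternations _           = 0

qr : ∀ {L v} → Formula L v → ℕ
qr φ = foldr _⊔_ 0 (List.map length (nest φ))

alt : ∀ {L v} → Formula L v → ℕ
alt φ = foldr _⊔_ 0 (List.map alternations (nest φ))

{-# OPTIONS --safe #-}
module Submission where

-- Write k = q + 1 for the maximal arity.  The defining sentence says that Duplicator survives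
-- t = max(⌊(1 - 1/2k)n⌋ + k² - k + 2, σ(M) + k) rounds of the Ehrenfeucht game on M and the given
-- structure when Spoiler changes sides at most once; it remains to see that this forces isomorphism.
--
-- A set W of elements of M is named by playing it.  Build K ⊆ M in k - 1 layers.  In layer j, sets S of
-- at most k - 1 - j new elements are added to K and W as long as this raises the number of atomic types
-- over K realised outside K; then all types with at most k realisations are added to K, all but one
-- of the realisations of each being added to W.  The unnamed elements of K are then determined by
-- their types over the previous layers, which Spoiler can exploit with k - 1 rounds per layer, and
-- two elements outside K with the same type over K are similar: a tuple distinguishing them would
-- have to contain an element of every layer's small types, besides one outside K.
--
-- With y small types and c types remaining, |W| + k - 1 ≤ (k - 1)(2y + c).  If y + c ≥ n/2k, name
-- everything except one element of each type.  Otherwise only the size of the types outside K remains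
-- to be fixed, which costs |W| + s + k² - k + 1 rounds for a type with s realisations.  This exceeds the bound
-- for at most one type, and the ∼-class of that type is then strictly larger than all others, so that
-- its size is found by playing a whole ∼-class and checking similarity with k - 1 further rounds.

open import Defs
import Data.Bool as Bool
open import Data.Bool using (Bool; true; false)
open import Data.Empty using (⊥)
open import Data.Fin using (Fin; zero; suc; fromℕ<)
open import Data.Fin.Permutation.Components using (transpose)
open import Data.Fin.Properties using (_≟_; any?; all?; suc-injective; injective⇒≤)
open import Data.List using (List; []; _∷_; length; map; filter; _++_; allFin; concatMap; foldr; take; tabulate; deduplicate)
open import Data.List.Membership.Propositional using (_∈_; _∉_; find; lose)
open import Data.List.Membership.Propositional.Properties using (∈-filter⁺; ∈-filter⁻; ∈-allFin; ∈-map⁺; ∈-map⁻; ∈-++⁺ˡ; ∈-++⁺ʳ; ∈-++⁻; ∈-concatMap⁺; ∈-concatMap⁻; ∈-tabulate⁺; ∈-tabulate⁻; ∈-deduplicate⁺; ∈-deduplicate⁻)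
open import Data.List.Properties using (filter-all; filter-notAll; length-filter; length-map; length-++; length-tabulate; length-take; ∷-injectiveˡ; ∷-injectiveʳ)
open import Data.List.Relation.Binary.Subset.Propositional using (_⊆_)
open import Data.List.Relation.Unary.All as All using (All; []; _∷_)
import Data.List.Relation.Unary.All.Properties as Allₚ
open import Data.List.Relation.Unary.AllPairs as AllPairs using (AllPairs; []; _∷_)
import Data.List.Relation.Unary.AllPairs.Properties as AllPairsₚ
open import Data.List.Relation.Unary.Any as Any using (here; there)
import Data.List.Relation.Unary.Unique.DecPropositional.Properties as UniqueDecₚ
open import Data.List.Relation.Unary.Unique.Propositional using (Unique)
import Data.List.Relation.Unary.Unique.Propositional.Properties as Uniqueₚ
open import Data.Nat using (ℕ; zero; suc; _+_; _*_; _∸_; _/_; _≤_; _<_; _⊔_; z≤n; s≤s; NonZero)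
open import Data.Nat.DivMod using (m/n*n≤m; m*n/n≡m; /-monoˡ-≤)
import Data.Nat.Properties as ℕₚ
open import Data.Nat.Solver using (module +-*-Solver)
open import Data.Product using (Σ; ∃; _×_; _,_; proj₁; proj₂)
open import Data.Sum using (_⊎_; inj₁; inj₂; [_,_]′)
open import Data.Unit using (⊤; tt)
open import Data.Vec using (Vec; []; _∷_)
import Data.Vec as Vec
import Data.Vec.Properties as Vecₚ
open import Function using (_∘_; id; case_of_)
open import Function.Bundles using (mk↔ₛ′)
open import Relation.Binary.PropositionalEquality
open import Relation.Nullary using (¬_; Dec; yes; no; does; contradiction; _⊎-dec_)
open import Relation.Nullary.Decidable using (dec-true; dec-false; ¬?; decidable-stable; map′; _×-dec_; _→-dec_)

-- The obstacle is the single change of sides. Once `W` is named in `M`, Spoiler may go on in `M` or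
-- use his only change and go on in `N`, but no test can return to the other side. Claims about
-- Duplicator's answers are therefore proved for both one-sided games. Where answers have to be
-- compared across sides, a separate play is started from the position in which only `W` is named.
-- The fraction 1/2k balances two costs. Put v = y + c. Naming all but v elements costs n - v, which
-- is within the bound if v ≥ n/2k. Below that threshold, |W| ≤ 2(k - 1)v ≤ (1 - 1/k)n. If two types
-- of sizes s and s' both had |W| + s and |W| + s' above (1 - 1/2k)n, adding up and using |W| + s +
-- s' ≤ n would give 2(1 - 1/2k)n < |W| + n. The bound on |W| makes this just impossible, because (1
-- - 1/k) + 1 = 2(1 - 1/2k).

module _ {n : ℕ} where
  open import Data.List.Membership.DecPropositional (_≟_ {n}) public using (_∈?_)

-- Finite lists, transpositions and similarity

unique-⊆⇒length≤ : ∀ {n} {xs ys : List (Fin n)} → Unique xs → xs ⊆ ys → length xs ≤ length ys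
unique-⊆⇒length≤ {xs = []} _ _ = z≤n
unique-⊆⇒length≤ {xs = x ∷ xs} {ys} (x∉ ∷ u) sub =
  ℕₚ.≤-trans (s≤s (unique-⊆⇒length≤ u λ z∈ → ∈-filter⁺ (¬? ∘ (x ≟_)) (sub (there z∈)) (All.lookup x∉ z∈)))
    (filter-notAll (¬? ∘ (x ≟_)) ys (Any.map (λ e ¬e → ¬e e) (sub (here refl))))

pick-fresh : ∀ {n} (ys zs : List (Fin n)) → Unique ys → length zs < length ys → ∃ λ y → y ∈ ys × y ∉ zs
pick-fresh ys zs u lt with Any.any? (λ y → ¬? (y ∈? zs)) ys
... | yes p = let (y , y∈ , y∉) = find p in y , y∈ , y∉
... | no ¬p = contradiction (unique-⊆⇒length≤ u sub) (ℕₚ.<⇒≱ lt)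
  where
  sub : ys ⊆ zs
  sub {y} y∈ = decidable-stable (y ∈? zs) λ y∉ → ¬p (lose y∈ y∉)

unique-length≤n : ∀ {n} {xs : List (Fin n)} → Unique xs → length xs ≤ n
unique-length≤n {n} {xs} u = subst (length xs ≤_) (length-tabulate id)
  (unique-⊆⇒length≤ u λ {x} _ → ∈-allFin x)

filter-allFin : ∀ {n} {P : Fin n → Set} (P? : ∀ x → Dec (P x)) → Unique (filter P? (allFin n))
filter-allFin P? = Uniqueₚ.filter⁺ P? (Uniqueₚ.allFin⁺ _)

transpose-left : ∀ {n} (a b : Fin n) → transpose a b a ≡ b
transpose-left a b rewrite dec-true (a ≟ a) refl = refl

transpose-right : ∀ {n} (a b : Fin n) → transpose a b b ≡ a
transpose-right a b with b ≟ a
... | yes refl = refl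
... | no _ rewrite dec-true (b ≟ b) refl = refl

transpose-other : ∀ {n} {a b c : Fin n} → c ≢ a → c ≢ b → transpose a b c ≡ c
transpose-other {a = a} {b} {c} c≢a c≢b
  rewrite dec-false (c ≟ a) c≢a | dec-false (c ≟ b) c≢b = refl

data TransposeView {n} (a b c : Fin n) : Set where
  left  : c ≡ a → transpose a b c ≡ b → TransposeView a b c
  right : c ≡ b → transpose a b c ≡ a → TransposeView a b c
  other : c ≢ a → c ≢ b → transpose a b c ≡ c → TransposeView a b c

transposeView : ∀ {n} (a b c : Fin n) → TransposeView a b c
transposeView a b c with c ≟ a
... | yes refl = left refl (transpose-left a b)
... | no c≢a with c ≟ b
...   | yes refl = right refl (transpose-right a b)
...   | no c≢b = other c≢a c≢b (transpose-other c≢a c≢b)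

transpose-injective : ∀ {n} (a b : Fin n) {c d} → transpose a b c ≡ transpose a b d → c ≡ d
transpose-injective a b {c} {d} e = trans (sym (self c)) (trans (cong (transpose a b) e) (self d))
  where
  self : ∀ c → transpose a b (transpose a b c) ≡ c
  self c with transposeView a b c
  ... | left refl e = trans (cong (transpose a b) e) (transpose-right a b)
  ... | right refl e = trans (cong (transpose a b) e) (transpose-left a b)
  ... | other _ _ e = trans (cong (transpose a b) e) e

module _ {L : Vocab} where

  -- Tuples as functions of their positions: a permutation of the universe acts by composition, and
  -- the equality pattern of a tuple becomes an implication between positions.
  relᶠ : ∀ {n} (M : Structure L n) (i : Sym L) → (Fin (arity L i) → Fin n) → Bool
  relᶠ M i f = rel M i (Vec.tabulate f)

  relᶠ-cong : ∀ {n} (M : Structure L n) i {f g} → (∀ e → f e ≡ g e) → relᶠ M i f ≡ relᶠ M i g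
  relᶠ-cong M i eq = cong (rel M i) (Vecₚ.tabulate-cong eq)

  rel-lookup : ∀ {n} (M : Structure L n) i t → rel M i t ≡ relᶠ M i (Vec.lookup t)
  rel-lookup M i t = cong (rel M i) (sym (Vecₚ.tabulate∘lookup t))

  rel-map-lookup : ∀ {m n} (M : Structure L n) i (f : Fin m → Fin n) t →
                   rel M i (Vec.map f t) ≡ relᶠ M i (f ∘ Vec.lookup t)
  rel-map-lookup M i f t = cong (rel M i)
    (trans (cong (Vec.map f) (sym (Vecₚ.tabulate∘lookup t))) (sym (Vecₚ.tabulate-∘ f (Vec.lookup t))))

  Simᶠ : ∀ {n} → Structure L n → Fin n → Fin n → Set
  Simᶠ M a b = ∀ i f → relᶠ M i (transpose a b ∘ f) ≡ relᶠ M i f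

  Sim⇒Simᶠ : ∀ {n} {M : Structure L n} {a b} → Sim M a b → Simᶠ M a b
  Sim⇒Simᶠ {M = M} {a} {b} s i f =
    trans (cong (rel M i) (Vecₚ.tabulate-∘ (transpose a b) f)) (s i (Vec.tabulate f))

  Simᶠ⇒Sim : ∀ {n} {M : Structure L n} {a b} → Simᶠ M a b → Sim M a b
  Simᶠ⇒Sim {M = M} {a} {b} s i t =
    trans (rel-map-lookup M i (transpose a b) t) (trans (s i (Vec.lookup t)) (sym (rel-lookup M i t)))

  Sim-refl : ∀ {n} {M : Structure L n} {a} → Sim M a a
  Sim-refl {M = M} {a} = Simᶠ⇒Sim {M = M} λ i f → relᶠ-cong M i λ e → fix (f e)
    where
    fix : ∀ c → transpose a a c ≡ c
    fix c with transposeView a a c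
    ... | left refl e = e
    ... | right refl e = e
    ... | other _ _ e = e

  Sim-sym : ∀ {n} {M : Structure L n} {a b} → Sim M a b → Sim M b a
  Sim-sym {M = M} {a} {b} s = Simᶠ⇒Sim {M = M} λ i f →
    trans (relᶠ-cong M i λ e → flip-tr (f e)) (Sim⇒Simᶠ {M = M} s i f)
    where
    flip-tr : ∀ c → transpose b a c ≡ transpose a b c
    flip-tr c with transposeView a b c
    ... | left refl e = trans (transpose-right b a) (sym e)
    ... | right refl e = trans (transpose-left b a) (sym e)
    ... | other x y e = trans (transpose-other y x) (sym e)

  -- (a c) = (a b)(b c)(a b) for distinct a, b, c
  Sim-trans : ∀ {n} {M : Structure L n} {a b c} → Sim M a b → Sim M b c → Sim M a c
  Sim-trans {M = M} {a} {b} {c} s s′ with a ≟ b | b ≟ c | a ≟ c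
  ... | yes refl | _ | _ = s′
  ... | no _ | yes refl | _ = s
  ... | no _ | no _ | yes refl = Sim-refl {M = M}
  ... | no a≢b | no b≢c | no a≢c = Simᶠ⇒Sim {M = M} λ i f →
    trans (relᶠ-cong M i λ e → conj (f e))
      (trans (Sim⇒Simᶠ {M = M} s i (transpose b c ∘ transpose a b ∘ f))
        (trans (Sim⇒Simᶠ {M = M} s′ i (transpose a b ∘ f)) (Sim⇒Simᶠ {M = M} s i f)))
    where
    conj : ∀ x → transpose a c x ≡ transpose a b (transpose b c (transpose a b x))
    conj x with transposeView a b x
    ... | left refl e = trans (transpose-left a c) (sym (trans (cong (transpose a b ∘ transpose b c) e)
            (trans (cong (transpose a b) (transpose-left b c)) (transpose-other (≢-sym a≢c) (≢-sym b≢c)))))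
    ... | right refl e = trans (transpose-other (≢-sym a≢b) b≢c) (sym (trans (cong (transpose a b ∘ transpose b c) e)
            (trans (cong (transpose a b) (transpose-other a≢b a≢c)) (transpose-left a b))))
    ... | other x≢a x≢b e with x ≟ c
    ...   | yes refl = trans (transpose-right a c) (sym (trans (cong (transpose a b ∘ transpose b c) e)
            (trans (cong (transpose a b) (transpose-right b c)) (transpose-right a b))))
    ...   | no x≢c = trans (transpose-other x≢a x≢c) (sym (trans (cong (transpose a b ∘ transpose b c) e)
            (trans (cong (transpose a b) (transpose-other x≢b x≢c)) e)))

arity≤maxArity : ∀ (L : Vocab) i → arity L i ≤ maxArity L
arity≤maxArity (l ∷ L) zero = ℕₚ.m≤m⊔n l _
arity≤maxArity (l ∷ L) (suc i) = ℕₚ.≤-trans (arity≤maxArity L i) (ℕₚ.m≤n⊔m l _)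

arity≥1 : ∀ {L : Vocab} → All (1 ≤_) L → ∀ i → 1 ≤ arity L i
arity≥1 (p ∷ ps) zero = p
arity≥1 (p ∷ ps) (suc i) = arity≥1 ps i

-- Games with at most one change of sides, and the sentences describing them

module Game {L : Vocab} {n m : ℕ} (M : Structure L n) (N : Structure L m) where

  record Atomic (ps : List (Fin n × Fin m)) : Set where
    field
      agree : ∀ i (f : Fin (arity L i) → Fin n) (g : Fin (arity L i) → Fin m) →
              (∀ e → (f e , g e) ∈ ps) → relᶠ M i f ≡ relᶠ N i g
      eq→   : ∀ {x y x′ y′} → (x , y) ∈ ps → (x′ , y′) ∈ ps → x ≡ x′ → y ≡ y′
      eq←   : ∀ {x y x′ y′} → (x , y) ∈ ps → (x′ , y′) ∈ ps → y ≡ y′ → x ≡ x′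
  open Atomic public

  -- Duplicator survives r rounds in which Spoiler plays only in M (E) or only in N (A).
  G : Q → ℕ → List (Fin n × Fin m) → Set
  G _ zero    ps = Atomic ps
  G E (suc r) ps = Atomic ps × (∀ x → ∃ λ y → G E r ((x , y) ∷ ps))
  G A (suc r) ps = Atomic ps × (∀ y → ∃ λ x → G A r ((x , y) ∷ ps))

  -- The same when Spoiler starts on the given side and may change sides once.
  H : Q → ℕ → List (Fin n × Fin m) → Set
  H _ zero    ps = Atomic ps
  H E (suc r) ps = G A (suc r) ps × (∀ x → ∃ λ y → H E r ((x , y) ∷ ps))
  H A (suc r) ps = G E (suc r) ps × (∀ y → ∃ λ x → H A r ((x , y) ∷ ps))

  G⇒Atomic : ∀ d r {ps} → G d r ps → Atomic ps
  G⇒Atomic d zero g = g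
  G⇒Atomic E (suc r) g = proj₁ g
  G⇒Atomic A (suc r) g = proj₁ g

  G-mono : ∀ d {r s ps} → r ≤ s → G d s ps → G d r ps
  G-mono d z≤n g = G⇒Atomic d _ g
  G-mono E (s≤s le) (a , g) = a , λ x → let (y , h) = g x in y , G-mono E le h
  G-mono A (s≤s le) (a , g) = a , λ y → let (x , h) = g y in x , G-mono A le h

  H⇒G : ∀ d r {ps} → H d r ps → G d r ps
  H⇒G d zero h = h
  H⇒G E (suc r) (a , h) = G⇒Atomic A (suc r) a , λ x → let (y , h′) = h x in y , H⇒G E r h′
  H⇒G A (suc r) (a , h) = G⇒Atomic E (suc r) a , λ y → let (x , h′) = h y in x , H⇒G A r h′

  H⇒G-swap : ∀ d r {ps} → H d r ps → G (swapQ d) r ps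
  H⇒G-swap d zero h = h
  H⇒G-swap E (suc r) (a , h) = a
  H⇒G-swap A (suc r) (a , h) = a

  Played : (List (Fin n × Fin m) → Set) → List (Fin n × Fin m) → List (Fin n × Fin m) → Set
  Played F ps qs = ∃ λ ps′ → qs ⊆ ps′ × ps ⊆ ps′ × F ps′

  -- `F` is meant to be `G E` or `H E`. The final position is known only through inclusions, because
  -- the order in which pairs were played never matters.
  playˡ : (F : ℕ → List (Fin n × Fin m) → Set) →
          (∀ {r ps} → F (suc r) ps → ∀ x → ∃ λ y → F r ((x , y) ∷ ps)) →
          ∀ xs {r ps} → F (length xs + r) ps → ∃ λ qs → map proj₁ qs ≡ xs × Played (F r) ps qs
  playˡ F move [] {ps = ps} h = [] , refl , ps , (λ ()) , id , h
  playˡ F move (x ∷ xs) h with move h x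
  ... | y , h′ with playˡ F move xs h′
  ...   | qs , refl , ps′ , qs⊆ , ps⊆ , h″ = (x , y) ∷ qs , refl , ps′ ,
          (λ { (here refl) → ps⊆ (here refl) ; (there p) → qs⊆ p }) , ps⊆ ∘ there , h″

  playʳ : (F : ℕ → List (Fin n × Fin m) → Set) →
          (∀ {r ps} → F (suc r) ps → ∀ y → ∃ λ x → F r ((x , y) ∷ ps)) →
          ∀ ys {r ps} → F (length ys + r) ps → ∃ λ qs → map proj₂ qs ≡ ys × Played (F r) ps qs
  playʳ F move [] {ps = ps} h = [] , refl , ps , (λ ()) , id , h
  playʳ F move (y ∷ ys) h with move h y
  ... | x , h′ with playʳ F move ys h′
  ...   | qs , refl , ps′ , qs⊆ , ps⊆ , h″ = (x , y) ∷ qs , refl , ps′ ,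
          (λ { (here refl) → ps⊆ (here refl) ; (there p) → qs⊆ p }) , ps⊆ ∘ there , h″

  Atomic-uniqueʳ : ∀ {ps} qs → Atomic ps → qs ⊆ ps → Unique (map proj₁ qs) → Unique (map proj₂ qs)
  Atomic-uniqueʳ [] a sub _ = []
  Atomic-uniqueʳ ((x , y) ∷ qs) a sub (x∉ ∷ u) =
    Allₚ.map⁺ (All.tabulate λ q∈ y≡ → All.lookup (Allₚ.map⁻ x∉) q∈ (eq← a (sub (here refl)) (sub (there q∈)) y≡))
      ∷ Atomic-uniqueʳ qs a (sub ∘ there) u

  Atomic-uniqueˡ : ∀ {ps} qs → Atomic ps → qs ⊆ ps → Unique (map proj₂ qs) → Unique (map proj₁ qs)
  Atomic-uniqueˡ [] a sub _ = []
  Atomic-uniqueˡ ((x , y) ∷ qs) a sub (y∉ ∷ u) =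
    Allₚ.map⁺ (All.tabulate λ q∈ x≡ → All.lookup (Allₚ.map⁻ y∉) q∈ (eq→ a (sub (here refl)) (sub (there q∈)) x≡))
      ∷ Atomic-uniqueˡ qs a (sub ∘ there) u

-- Duplicator copies Spoiler's moves. With this play, results about two structures can be applied to
-- `M` against itself.
G-diagonal : ∀ {L n} (M : Structure L n) → let open Game M M in
             ∀ d r ps → (∀ {x y} → (x , y) ∈ ps → x ≡ y) → G d r ps
G-diagonal {n = n} M = go
  where
  open Game M M
  atomic : ∀ ps → (∀ {x y} → (x , y) ∈ ps → x ≡ y) → Atomic ps
  atomic ps diag = record
    { agree = λ i f g ∈ps → relᶠ-cong M i λ e → diag (∈ps e)
    ; eq→   = λ p q e → trans (sym (diag p)) (trans e (diag q))
    ; eq←   = λ p q e → trans (diag p) (trans e (sym (diag q)))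
    }
  cons : ∀ {ps z} → (∀ {x y} → (x , y) ∈ ps → x ≡ y) → ∀ {x y} → (x , y) ∈ (z , z) ∷ ps → x ≡ y
  cons diag (here refl) = refl
  cons diag (there p) = diag p
  go : ∀ d r ps → (∀ {x y} → (x , y) ∈ ps → x ≡ y) → G d r ps
  go d zero ps diag = atomic ps diag
  go E (suc r) ps diag = atomic ps diag , λ x → x , go E r _ (cons diag)
  go A (suc r) ps diag = atomic ps diag , λ x → x , go A r _ (cons diag)

-- Sentences expressing that Duplicator survives

module Hintikka {L : Vocab} {n : ℕ} (M : Structure L n) where

  ⋀ : ∀ {v} {X : Set} → Formula L v → List X → (X → Formula L v) → Formula L v
  ⋀ base xs φ = foldr (λ x ψ → φ x ∧' ψ) base xs

  -- The language has no truth constants. The formula `eq' zero zero` and its negation stand in for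
  -- them, so the formulas below, except for the final sentence, keep at least one variable in
  -- scope.
  ⋁ : ∀ {v} {X : Set} → List X → (X → Formula L (suc v)) → Formula L (suc v)
  ⋁ xs φ = foldr (λ x ψ → φ x ∨' ψ) (¬' (eq' zero zero)) xs

  literal : ∀ {v} → Bool → Formula L v → Formula L v
  literal true  φ = φ
  literal false φ = ¬' φ

  vecs : ∀ v l → List (Vec (Fin v) l)
  vecs v zero    = [] ∷ []
  vecs v (suc l) = concatMap (λ x → map (x ∷_) (vecs v l)) (allFin v)

  ∈-vecs : ∀ {v l} (t : Vec (Fin v) l) → t ∈ vecs v l
  ∈-vecs [] = here refl
  ∈-vecs (x ∷ t) = ∈-concatMap⁺ _ (lose (∈-allFin x) (∈-map⁺ _ (∈-vecs t)))

  relLiteral : ∀ {v} → Vec (Fin n) (suc v) → (i : Sym L) → Vec (Fin (suc v)) (arity L i) → Formula L (suc v)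
  relLiteral a i xs = literal (rel M i (Vec.map (Vec.lookup a) xs)) (rel' i xs)

  eqLiteral : ∀ {v} → Vec (Fin n) (suc v) → Fin (suc v) → Fin (suc v) → Formula L (suc v)
  eqLiteral a x y = literal (does (Vec.lookup a x ≟ Vec.lookup a y)) (eq' x y)

  trueᶠ : ∀ {v} → Formula L (suc v)
  trueᶠ = eq' zero zero

  diagram : ∀ {v} → Vec (Fin n) (suc v) → Formula L (suc v)
  diagram {v} a =
    ⋀ trueᶠ (allFin _) (λ i → ⋀ trueᶠ (vecs (suc v) (arity L i)) (relLiteral a i)) ∧'
    ⋀ trueᶠ (allFin _) (λ x → ⋀ trueᶠ (allFin _) (eqLiteral a x))

  G-formula : Q → ℕ → ∀ {v} → Vec (Fin n) (suc v) → Formula L (suc v)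
  G-formula _ zero    a = diagram a
  G-formula E (suc r) a = ⋀ (diagram a) (allFin n) λ x → ∃' (G-formula E r (x ∷ a))
  G-formula A (suc r) a = diagram a ∧' ∀' (⋁ (allFin n) λ x → G-formula A r (x ∷ a))

  H-formula : Q → ℕ → ∀ {v} → Vec (Fin n) (suc v) → Formula L (suc v)
  H-formula _ zero    a = diagram a
  H-formula E (suc r) a = ⋀ (G-formula A (suc r) a) (allFin n) λ x → ∃' (H-formula E r (x ∷ a))
  H-formula A (suc r) a = G-formula E (suc r) a ∧' ∀' (⋁ (allFin n) λ x → H-formula A r (x ∷ a))

  -- The universal half serves as the base of the conjunction, since `trueᶠ` requires a variable.
  -- The outer quantifiers are a round of their own, so `H-sentence r` describes r + 1 rounds begun
  -- on either side.
  H-sentence : ℕ → Formula L 0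
  H-sentence r = ⋀ (∀' (⋁ (allFin n) λ x → H-formula A r (x ∷ []))) (allFin n) λ x → ∃' (H-formula E r (x ∷ []))

  module _ {m : ℕ} (N : Structure L m) where

    ⋀-elim : ∀ {v X} {base : Formula L v} (xs : List X) {φ} {b} → Sat N (⋀ base xs φ) b →
             Sat N base b × (∀ {x} → x ∈ xs → Sat N (φ x) b)
    ⋀-elim [] s = s , λ ()
    ⋀-elim (x ∷ xs) (s , s′) with ⋀-elim xs s′
    ... | sb , sx = sb , λ { (here refl) → s ; (there p) → sx p }

    ⋀-intro : ∀ {v X} {base : Formula L v} (xs : List X) {φ} {b} → Sat N base b →
              (∀ x → Sat N (φ x) b) → Sat N (⋀ base xs φ) b
    ⋀-intro [] s f = s
    ⋀-intro (x ∷ xs) s f = f x , ⋀-intro xs s f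

    ⋁-elim : ∀ {v X} (xs : List X) {φ : X → Formula L (suc v)} {b} → Sat N (⋁ xs φ) b → ∃ λ x → Sat N (φ x) b
    ⋁-elim [] s = contradiction refl s
    ⋁-elim (x ∷ xs) (inj₁ s) = x , s
    ⋁-elim (x ∷ xs) (inj₂ s) = ⋁-elim xs s

    ⋁-intro : ∀ {v X} {xs : List X} {φ : X → Formula L (suc v)} {b x} → x ∈ xs → Sat N (φ x) b → Sat N (⋁ xs φ) b
    ⋁-intro (here refl) s = inj₁ s
    ⋁-intro (there p) s = inj₂ (⋁-intro p s)

    open Game M N

    pairs : ∀ {v} → Vec (Fin n) v → Vec (Fin m) v → List (Fin n × Fin m)
    pairs a b = Vec.toList (Vec.zip a b)

    ∈-pairs : ∀ {v} (a : Vec (Fin n) v) (b : Vec (Fin m) v) {x y} → (x , y) ∈ pairs a b →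
              ∃ λ j → Vec.lookup a j ≡ x × Vec.lookup b j ≡ y
    ∈-pairs [] [] ()
    ∈-pairs (_ ∷ _) (_ ∷ _) (here refl) = zero , refl , refl
    ∈-pairs (_ ∷ a) (_ ∷ b) (there p) with ∈-pairs a b p
    ... | j , e , e′ = suc j , e , e′

    literal-rel : ∀ {v i} {xs : Vec (Fin v) (arity L i)} {b : Vec (Fin m) v} c →
                  Sat N (literal c (rel' i xs)) b → c ≡ rel N i (Vec.map (Vec.lookup b) xs)
    literal-rel true s = sym s
    literal-rel {i = i} {xs} {b} false s with rel N i (Vec.map (Vec.lookup b) xs)
    ... | true = contradiction refl s
    ... | false = refl

    diagram⇒Atomic : ∀ {v} (a : Vec (Fin n) (suc v)) b → Sat N (diagram a) b → Atomic (pairs a b)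
    diagram⇒Atomic {v} a b (s , s′) = record
      { agree = λ i f g ∈ps →
          let xs = Vec.tabulate (λ e → proj₁ (∈-pairs a b (∈ps e)))
              look : ∀ e → Vec.lookup xs e ≡ proj₁ (∈-pairs a b (∈ps e))
              look = Vecₚ.lookup∘tabulate (λ e → proj₁ (∈-pairs a b (∈ps e)))
          in begin
            relᶠ M i f
              ≡⟨ relᶠ-cong M i (λ e → trans (sym (proj₁ (proj₂ (∈-pairs a b (∈ps e))))) (cong (Vec.lookup a) (sym (look e)))) ⟩
            relᶠ M i (Vec.lookup a ∘ Vec.lookup xs)  ≡⟨ rel-map-lookup M i (Vec.lookup a) xs ⟨
            rel M i (Vec.map (Vec.lookup a) xs)
              ≡⟨ literal-rel {i = i} {xs} {b} _ (proj₂ (⋀-elim (vecs (suc v) (arity L i)) (proj₂ (⋀-elim (allFin _) s) (∈-allFin i))) (∈-vecs xs)) ⟩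
            rel N i (Vec.map (Vec.lookup b) xs)  ≡⟨ rel-map-lookup N i (Vec.lookup b) xs ⟩
            relᶠ N i (Vec.lookup b ∘ Vec.lookup xs)
              ≡⟨ relᶠ-cong N i (λ e → trans (cong (Vec.lookup b) (look e)) (proj₂ (proj₂ (∈-pairs a b (∈ps e))))) ⟩
            relᶠ N i g ∎
      ; eq→ = λ p q → forth (∈-pairs a b p) (∈-pairs a b q)
      ; eq← = λ p q → back (∈-pairs a b p) (∈-pairs a b q)
      }
      where
      open ≡-Reasoning
      lit : ∀ x y → Sat N (eqLiteral a x y) b
      lit x y = proj₂ (⋀-elim (allFin _) (proj₂ (⋀-elim (allFin _) s′) (∈-allFin x))) (∈-allFin y)
      forth : ∀ {x y x′ y′} → (∃ λ j → Vec.lookup a j ≡ x × Vec.lookup b j ≡ y) →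
              (∃ λ j → Vec.lookup a j ≡ x′ × Vec.lookup b j ≡ y′) → x ≡ x′ → y ≡ y′
      forth (j , refl , refl) (j′ , refl , refl) e with Vec.lookup a j ≟ Vec.lookup a j′ | lit j j′
      ... | yes _ | l = l
      ... | no ne | l = contradiction e ne
      back : ∀ {x y x′ y′} → (∃ λ j → Vec.lookup a j ≡ x × Vec.lookup b j ≡ y) →
              (∃ λ j → Vec.lookup a j ≡ x′ × Vec.lookup b j ≡ y′) → y ≡ y′ → x ≡ x′
      back (j , refl , refl) (j′ , refl , refl) e with Vec.lookup a j ≟ Vec.lookup a j′ | lit j j′
      ... | yes e′ | _ = e′
      ... | no ne | l = contradiction e l

    G-formula⇒G : ∀ d r {v} (a : Vec (Fin n) (suc v)) b → Sat N (G-formula d r a) b → G d r (pairs a b)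
    G-formula⇒G d zero a b s = diagram⇒Atomic a b s
    G-formula⇒G E (suc r) a b s with ⋀-elim (allFin n) s
    ... | s₀ , s₁ = diagram⇒Atomic a b s₀ ,
          λ x → let (y , s₂) = s₁ (∈-allFin x) in y , G-formula⇒G E r (x ∷ a) (y ∷ b) s₂
    G-formula⇒G A (suc r) a b (s₀ , s₁) = diagram⇒Atomic a b s₀ ,
          λ y → let (x , s₂) = ⋁-elim (allFin n) (s₁ y) in x , G-formula⇒G A r (x ∷ a) (y ∷ b) s₂

    H-formula⇒H : ∀ d r {v} (a : Vec (Fin n) (suc v)) b → Sat N (H-formula d r a) b → H d r (pairs a b)
    H-formula⇒H d zero a b s = diagram⇒Atomic a b s
    H-formula⇒H E (suc r) a b s with ⋀-elim (allFin n) s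
    ... | s₀ , s₁ = G-formula⇒G A (suc r) a b s₀ ,
          λ x → let (y , s₂) = s₁ (∈-allFin x) in y , H-formula⇒H E r (x ∷ a) (y ∷ b) s₂
    H-formula⇒H A (suc r) a b (s₀ , s₁) = G-formula⇒G E (suc r) a b s₀ ,
          λ y → let (x , s₂) = ⋁-elim (allFin n) (s₁ y) in x , H-formula⇒H A r (x ∷ a) (y ∷ b) s₂

    H-sentence⇒H : All (1 ≤_) L → ∀ r → Sat N (H-sentence r) [] → ∀ d → H d (suc r) []
    H-sentence⇒H pos r s with ⋀-elim (allFin n) s
    ... | s₀ , s₁ = λ where
        E → (atomic , λ y → let (x , h) = moveʳ y in x , H⇒G A r h) , moveˡ
        A → (atomic , λ x → let (y , h) = moveˡ x in y , H⇒G E r h) , moveʳ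
      where
      moveˡ : ∀ x → ∃ λ y → H E r ((x , y) ∷ [])
      moveˡ x = let (y , s₂) = s₁ (∈-allFin x) in y , H-formula⇒H E r (x ∷ []) (y ∷ []) s₂
      moveʳ : ∀ y → ∃ λ x → H A r ((x , y) ∷ [])
      moveʳ y = let (x , s₂) = ⋁-elim (allFin n) (s₀ y) in x , H-formula⇒H A r (x ∷ []) (y ∷ []) s₂
      -- On the empty position only nullary symbols could disagree, and positive arities exclude
      -- them.
      atomic : Atomic []
      atomic = record
        { agree = λ i f g ∈ps → contradiction (∈ps (fromℕ< (arity≥1 {L} pos i))) λ ()
        ; eq→ = λ () ; eq← = λ () }

  diagram-self : ∀ {v} (a : Vec (Fin n) (suc v)) → Sat M (diagram a) a
  diagram-self {v} a =
    ⋀-intro M (allFin _) refl (λ i → ⋀-intro M (vecs (suc v) (arity L i)) refl λ xs → relLit i xs) ,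
    ⋀-intro M (allFin _) refl (λ x → ⋀-intro M (allFin _) refl λ y → eqLit x y)
    where
    relLit : ∀ i xs → Sat M (relLiteral a i xs) a
    relLit i xs with rel M i (Vec.map (Vec.lookup a) xs) in e
    ... | true = e
    ... | false = λ e′ → case trans (sym e) e′ of λ ()
    eqLit : ∀ x y → Sat M (eqLiteral a x y) a
    eqLit x y with Vec.lookup a x ≟ Vec.lookup a y
    ... | yes e = e
    ... | no ne = ne

  G-formula-self : ∀ d r {v} (a : Vec (Fin n) (suc v)) → Sat M (G-formula d r a) a
  G-formula-self d zero a = diagram-self a
  G-formula-self E (suc r) a = ⋀-intro M (allFin n) (diagram-self a) λ x → x , G-formula-self E r (x ∷ a)
  G-formula-self A (suc r) a = diagram-self a , λ x → ⋁-intro M (∈-allFin x) (G-formula-self A r (x ∷ a))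

  H-formula-self : ∀ d r {v} (a : Vec (Fin n) (suc v)) → Sat M (H-formula d r a) a
  H-formula-self d zero a = diagram-self a
  H-formula-self E (suc r) a = ⋀-intro M (allFin n) (G-formula-self A (suc r) a) λ x → x , H-formula-self E r (x ∷ a)
  H-formula-self A (suc r) a = G-formula-self E (suc r) a , λ x → ⋁-intro M (∈-allFin x) (H-formula-self A r (x ∷ a))

  H-sentence-self : ∀ r → Sat M (H-sentence r) []
  H-sentence-self r = ⋀-intro M (allFin n)
    (λ x → ⋁-intro M (∈-allFin x) (H-formula-self A r (x ∷ []))) λ x → x , H-formula-self E r (x ∷ [])

  data Pure (d : Q) : ℕ → List Q → Set where
    []  : ∀ {r} → Pure d r []
    _∷_ : ∀ {e r w} → e ≡ d → Pure d r w → Pure d (suc r) (e ∷ w)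

  -- The constructor `pure` applies from the start because `H d` contains the one-sided game on the
  -- other side at every stage. Words may be shorter than the number of rounds, since diagrams end
  -- branches at every depth.
  data Once (d : Q) : ℕ → List Q → Set where
    pure : ∀ {r w} → Pure (swapQ d) r w → Once d r w
    _∷_  : ∀ {e r w} → e ≡ d → Once d r w → Once d (suc r) (e ∷ w)

  Pure-length : ∀ {d r w} → Pure d r w → length w ≤ r
  Pure-length [] = z≤n
  Pure-length (_ ∷ p) = s≤s (Pure-length p)

  Once-length : ∀ {d r w} → Once d r w → length w ≤ r
  Once-length (pure p) = Pure-length p
  Once-length (_ ∷ p) = s≤s (Once-length p)

  Pure-alternations : ∀ {d r w} → Pure d r w → alternations w ≡ 0
  Pure-alternations [] = refl
  Pure-alternations {E} (refl ∷ []) = refl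
  Pure-alternations {A} (refl ∷ []) = refl
  Pure-alternations {E} (refl ∷ (refl ∷ p)) = Pure-alternations (refl ∷ p)
  Pure-alternations {A} (refl ∷ (refl ∷ p)) = Pure-alternations (refl ∷ p)

  Once-alternations : ∀ {d r w} → Once d r w → alternations w ≤ 1
  Once-alternations (pure p) = ℕₚ.≤-trans (ℕₚ.≤-reflexive (Pure-alternations p)) z≤n
  Once-alternations {E} (refl ∷ pure []) = z≤n
  Once-alternations {A} (refl ∷ pure []) = z≤n
  Once-alternations {E} (refl ∷ pure (refl ∷ p)) = s≤s (ℕₚ.≤-reflexive (Pure-alternations (refl ∷ p)))
  Once-alternations {A} (refl ∷ pure (refl ∷ p)) = s≤s (ℕₚ.≤-reflexive (Pure-alternations (refl ∷ p)))
  Once-alternations {E} (refl ∷ (refl ∷ p)) = Once-alternations (refl ∷ p)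
  Once-alternations {A} (refl ∷ (refl ∷ p)) = Once-alternations (refl ∷ p)

  nest-⋀ : ∀ {v X} {P : List Q → Set} {base : Formula L v} (xs : List X) {φ} →
           All P (nest base) → (∀ x → All P (nest (φ x))) → All P (nest (⋀ base xs φ))
  nest-⋀ [] b f = b
  nest-⋀ (x ∷ xs) b f = Allₚ.++⁺ (f x) (nest-⋀ xs b f)

  nest-⋁ : ∀ {v X} {P : List Q → Set} (xs : List X) {φ : X → Formula L (suc v)} →
           P [] → (∀ x → All P (nest (φ x))) → All P (nest (⋁ xs φ))
  nest-⋁ [] b f = b ∷ []
  nest-⋁ (x ∷ xs) b f = Allₚ.++⁺ (f x) (nest-⋁ xs b f)

  nest-diagram : ∀ {P : List Q → Set} {v} (a : Vec (Fin n) (suc v)) → P [] → All P (nest (diagram a))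
  nest-diagram {P} {v} a p = Allₚ.++⁺
    (nest-⋀ (allFin _) (p ∷ []) λ i → nest-⋀ (vecs (suc v) (arity L i)) (p ∷ []) λ xs → nest-rel (rel M i (Vec.map (Vec.lookup a) xs)))
    (nest-⋀ (allFin _) (p ∷ []) λ x → nest-⋀ (allFin _) (p ∷ []) λ y → nest-eq (does (Vec.lookup a x ≟ Vec.lookup a y)))
    where
    nest-rel : ∀ c {i} {xs : Vec (Fin (suc v)) (arity L i)} → All P (nest (literal c (rel' i xs)))
    nest-rel true = p ∷ []
    nest-rel false = p ∷ []
    nest-eq : ∀ c {x y : Fin (suc v)} → All P (nest {L} (literal c (eq' x y)))
    nest-eq true = p ∷ []
    nest-eq false = p ∷ []

  nest-G : ∀ d r {v} (a : Vec (Fin n) (suc v)) → All (Pure d r) (nest (G-formula d r a))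
  nest-G d zero a = nest-diagram a []
  nest-G E (suc r) a = nest-⋀ (allFin n) (nest-diagram a []) λ x → Allₚ.map⁺ (All.map (refl ∷_) (nest-G E r (x ∷ a)))
  nest-G A (suc r) a = Allₚ.++⁺ (nest-diagram a [])
    (Allₚ.map⁺ (All.map (refl ∷_) (nest-⋁ (allFin n) [] λ x → nest-G A r (x ∷ a))))

  nest-H : ∀ d r {v} (a : Vec (Fin n) (suc v)) → All (Once d r) (nest (H-formula d r a))
  nest-H d zero a = nest-diagram a (pure [])
  nest-H E (suc r) a = nest-⋀ (allFin n) (All.map pure (nest-G A (suc r) a)) λ x → Allₚ.map⁺ (All.map (refl ∷_) (nest-H E r (x ∷ a)))
  nest-H A (suc r) a = Allₚ.++⁺ (All.map pure (nest-G E (suc r) a))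
    (Allₚ.map⁺ (All.map (refl ∷_) (nest-⋁ (allFin n) (pure []) λ x → nest-H A r (x ∷ a))))

  nest-sentence : ∀ r → All (λ w → length w ≤ suc r × alternations w ≤ 1) (nest (H-sentence r))
  nest-sentence r = nest-⋀ (allFin n)
    (Allₚ.map⁺ (All.map (λ o → bounds (refl ∷ o)) (nest-⋁ (allFin n) (pure []) λ x → nest-H A r (x ∷ []))))
    λ x → Allₚ.map⁺ (All.map (λ o → bounds (refl ∷ o)) (nest-H E r (x ∷ [])))
    where
    bounds : ∀ {d w} → Once d (suc r) w → length w ≤ suc r × alternations w ≤ 1
    bounds o = Once-length o , Once-alternations o

  max-map≤ : ∀ {X : Set} {f : X → ℕ} {b} {xs} → All (λ x → f x ≤ b) xs → foldr _⊔_ 0 (map f xs) ≤ b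
  max-map≤ [] = z≤n
  max-map≤ (p ∷ ps) = ℕₚ.⊔-lub p (max-map≤ ps)

  qr-sentence : ∀ r → qr (H-sentence r) ≤ suc r
  qr-sentence r = max-map≤ (All.map proj₁ (nest-sentence r))

  alt-sentence : ∀ r → alt (H-sentence r) ≤ 1
  alt-sentence r = max-map≤ (All.map proj₂ (nest-sentence r))

-- Atomic types and towers of layers

ins : ∀ {n} {X : Set} → X → (Fin n → X) → Fin (suc n) → X
ins x f zero    = x
ins x f (suc u) = f u

Over : ∀ {n} → List (Fin n) → Fin (suc n) → Set
Over K zero    = ⊤
Over K (suc u) = u ∈ K

over? : ∀ {n} (K : List (Fin n)) c → Dec (Over K c)
over? K zero    = yes tt
over? K (suc u) = u ∈? K

Over-mono : ∀ {n} {K K′ : List (Fin n)} → K ⊆ K′ → ∀ c → Over K c → Over K′ c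
Over-mono sub zero    _ = tt
Over-mono sub (suc u) p = sub p

module Types {L : Vocab} {n : ℕ} (M : Structure L n) where

  -- a and b have the same atomic type over K; the entry `zero` of a pattern stands for the element a (or b).
  TE : List (Fin n) → Fin n → Fin n → Set
  TE K a b = ∀ i (p : Fin (arity L i) → Fin (suc n)) → (∀ e → Over K (p e)) →
             relᶠ M i (ins a id ∘ p) ≡ relᶠ M i (ins b id ∘ p)

  te? : ∀ K a b → Dec (TE K a b)
  te? K a b = map′ to from (all? λ i → allVec? (arity L i) λ v →
                all? (λ e → over? K (Vec.lookup v e)) →-dec
                (relᶠ M i (ins a id ∘ Vec.lookup v) Bool.≟ relᶠ M i (ins b id ∘ Vec.lookup v)))
    where
    to : (∀ i v → (∀ e → Over K (Vec.lookup v e)) →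
          relᶠ M i (ins a id ∘ Vec.lookup v) ≡ relᶠ M i (ins b id ∘ Vec.lookup v)) → TE K a b
    to h i p over = begin
      relᶠ M i (ins a id ∘ p)  ≡⟨ relᶠ-cong M i (λ e → cong (ins a id) (look e)) ⟨
      relᶠ M i (ins a id ∘ Vec.lookup v)  ≡⟨ h i v (λ e → subst (Over K) (sym (look e)) (over e)) ⟩
      relᶠ M i (ins b id ∘ Vec.lookup v)  ≡⟨ relᶠ-cong M i (λ e → cong (ins b id) (look e)) ⟩
      relᶠ M i (ins b id ∘ p)  ∎
      where
      open ≡-Reasoning
      v = Vec.tabulate p
      look : ∀ e → Vec.lookup v e ≡ p e
      look = Vecₚ.lookup∘tabulate p
    from : TE K a b → ∀ i v → (∀ e → Over K (Vec.lookup v e)) →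
           relᶠ M i (ins a id ∘ Vec.lookup v) ≡ relᶠ M i (ins b id ∘ Vec.lookup v)
    from h i v = h i (Vec.lookup v)

  TE-refl : ∀ {K a} → TE K a a
  TE-refl i p _ = refl

  TE-sym : ∀ {K a b} → TE K a b → TE K b a
  TE-sym t i p o = sym (t i p o)

  TE-trans : ∀ {K a b c} → TE K a b → TE K b c → TE K a c
  TE-trans t t′ i p o = trans (t i p o) (t′ i p o)

  TE-mono : ∀ {K K′ a b} → K ⊆ K′ → TE K′ a b → TE K a b
  TE-mono sub t i p o = t i p λ e → Over-mono sub (p e) (o e)

  Sim⇒TE : ∀ {K a b} → a ∉ K → b ∉ K → Sim M a b → TE K a b
  Sim⇒TE {K} {a} {b} a∉ b∉ s i p o =
    trans (sym (Sim⇒Simᶠ {M = M} s i (ins a id ∘ p))) (relᶠ-cong M i λ e → move (p e) (o e))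
    where
    move : ∀ c → Over K c → transpose a b (ins a id c) ≡ ins b id c
    move zero _ = transpose-left a b
    move (suc u) u∈ = transpose-other (λ { refl → a∉ u∈ }) (λ { refl → b∉ u∈ })

  module _ (q : ℕ) where

    -- K: elements recognised so far; K⁺: K with newly named elements; K′: K⁺ with the rare types over K⁺.
    -- In `swaps` the list D bounds the number of distinct entries of f outside K.
    record Layer (W : List (Fin n)) (j : ℕ) (K K⁺ K′ : List (Fin n)) : Set where
      field
        K⊆K⁺   : K ⊆ K⁺
        K⁺⊆K′  : K⁺ ⊆ K′
        named  : ∀ {u} → u ∈ K⁺ → u ∈ K ⊎ u ∈ W
        single : ∀ {r u} → r ∈ K′ → r ∉ K⁺ → r ∉ W → u ∉ K⁺ → u ∉ W → TE K⁺ u r → u ≡ r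
        swaps  : ∀ {a b} → a ∉ K′ → b ∉ K′ → TE K⁺ a b → ∀ i f D → length D + j ≤ suc q →
                 (∀ {d} → d ∈ D → d ∉ K′) → (∀ e → f e ∈ K ⊎ f e ∈ D) →
                 relᶠ M i (transpose a b ∘ f) ≡ relᶠ M i f

    data Tower (W : List (Fin n)) : ℕ → List (Fin n) → Set where
      base  : Tower W 0 []
      layer : ∀ {j K K⁺ K′} → Tower W j K → Layer W j K K⁺ K′ → Tower W (suc j) K′

    Tower-mono : ∀ {W W′ j K} → W ⊆ W′ → Tower W j K → Tower W′ j K
    Tower-mono sub base = base
    Tower-mono sub (layer t l) = layer (Tower-mono sub t) record
      { K⊆K⁺ = K⊆K⁺ ; K⁺⊆K′ = K⁺⊆K′
      ; named = λ u∈ → [ inj₁ , inj₂ ∘ sub ]′ (named u∈)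
      ; single = λ r∈ r∉ r∉W u∉ u∉W → single r∈ r∉ (r∉W ∘ sub) u∉ (u∉W ∘ sub)
      ; swaps = swaps }
      where open Layer l

    module _ {W j K K⁺ K′} (l : Layer W j K K⁺ K′) where
      open Layer l

      -- Correct the entries of f one by one, each by a transposition that does not disturb the entries already correct.
      rearrange : ∀ {i} (es : List (Fin (arity L i))) (f f′ : Fin (arity L i) → Fin n) D →
        (∀ e → e ∈ es ⊎ f e ≡ f′ e) →
        (∀ {e e′} → f e ≡ f e′ → f′ e ≡ f′ e′) → (∀ {e e′} → f′ e ≡ f′ e′ → f e ≡ f e′) →
        (∀ e → f e ≡ f′ e ⊎ (f e ∉ K′ × f′ e ∉ K′ × TE K⁺ (f e) (f′ e))) →
        length D + j ≤ suc q → (∀ {d} → d ∈ D → d ∉ K′) → (∀ e → f e ∈ K ⊎ f e ∈ D) →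
        relᶠ M i f ≡ relᶠ M i f′
      rearrange {i} [] f f′ D done _ _ _ _ _ _ = relᶠ-cong M i λ e → [ (λ ()) , id ]′ (done e)
      rearrange {i} (e ∷ es) f f′ D done to from eqv len D∉ cov with f e ≟ f′ e
      ... | yes eq = rearrange es f f′ D done′ to from eqv len D∉ cov
        where
        done′ : ∀ e′ → e′ ∈ es ⊎ f e′ ≡ f′ e′
        done′ e′ with done e′
        ... | inj₁ (here refl) = inj₂ eq
        ... | inj₁ (there p) = inj₁ p
        ... | inj₂ x = inj₂ x
      ... | no neq with eqv e
      ...   | inj₁ eq = contradiction eq neq
      ...   | inj₂ (a∉ , b∉ , te) = trans (sym (swaps a∉ b∉ te i f D len D∉ cov))
              (rearrange es (τ ∘ f) f′ (map τ D) done′ (to ∘ transpose-injective a b) (cong τ ∘ from) eqv′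
                (subst (λ z → z + j ≤ suc q) (sym (length-map τ D)) len) D∉′ cov′)
        where
        a = f e
        b = f′ e
        τ = transpose a b
        done′ : ∀ e′ → e′ ∈ es ⊎ τ (f e′) ≡ f′ e′
        done′ e′ with done e′
        ... | inj₁ (here refl) = inj₂ (transpose-left a b)
        ... | inj₁ (there p) = inj₁ p
        ... | inj₂ x = inj₂ (trans (transpose-other
                (λ y → neq (trans (sym y) (trans x (to y))))
                (λ y → neq (trans (sym (from (trans (sym x) y))) y))) x)
        eqv′ : ∀ e′ → τ (f e′) ≡ f′ e′ ⊎ (τ (f e′) ∉ K′ × f′ e′ ∉ K′ × TE K⁺ (τ (f e′)) (f′ e′))
        eqv′ e′ with transposeView a b (f e′)
        ... | left x y = inj₁ (trans y (sym (to x)))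
        ... | other _ _ z rewrite z = eqv e′
        ... | right x y rewrite y with eqv e′
        ...   | inj₁ z = inj₂ (a∉ , subst (_∉ K′) (trans (sym x) z) b∉ , subst (TE K⁺ a) (trans (sym x) z) te)
        ...   | inj₂ (_ , c∉ , te′) = inj₂ (a∉ , c∉ , TE-trans te (subst (λ w → TE K⁺ w (f′ e′)) x te′))
        move∉ : ∀ {d} → d ∉ K′ → τ d ∉ K′
        move∉ {d} d∉ with transposeView a b d
        ... | left x y = subst (_∉ K′) (sym y) b∉
        ... | right x y = subst (_∉ K′) (sym y) a∉
        ... | other _ _ y = subst (_∉ K′) (sym y) d∉
        D∉′ : ∀ {d} → d ∈ map τ D → d ∉ K′
        D∉′ d∈ with ∈-map⁻ τ d∈
        ... | d , d∈D , refl = move∉ (D∉ d∈D)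
        cov′ : ∀ e′ → τ (f e′) ∈ K ⊎ τ (f e′) ∈ map τ D
        cov′ e′ with cov e′
        ... | inj₂ x = inj₂ (∈-map⁺ τ x)
        ... | inj₁ x = inj₁ (subst (_∈ K) (sym (transpose-other
                (λ z → a∉ (K⁺⊆K′ (K⊆K⁺ (subst (_∈ K) z x)))) (λ z → b∉ (K⁺⊆K′ (K⊆K⁺ (subst (_∈ K) z x)))))) x)

-- What Duplicator is forced to answer

module Side {L : Vocab} {n m : ℕ} (M : Structure L n) (N : Structure L m) (q : ℕ)
  (arity≤ : ∀ i → arity L i ≤ suc q) (arity≥ : ∀ i → 1 ≤ arity L i)
  (W : List (Fin n)) (pos₀ : List (Fin n × Fin m)) (R : ℕ)
  (bound : q * q + q + 1 ≤ R)
  (W-played : ∀ {w} → w ∈ W → ∃ λ y → (w , y) ∈ pos₀)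
  (game : ∀ d → Game.G M N d (suc R) pos₀)
  where

  open Game M N
  open Types M

  -- Each `β x` is the answer in a play of its own from `pos₀`, with `R` rounds to spare. Nothing
  -- yet relates the answers of different plays; `Forced` will do so for the recognised elements.
  β : Fin n → Fin m
  β x = proj₁ (proj₂ (game E) x)

  β-game : ∀ x → G E R ((x , β x) ∷ pos₀)
  β-game x = proj₂ (proj₂ (game E) x)

  β-W : ∀ {w} → w ∈ W → (w , β w) ∈ pos₀
  β-W {w} w∈ with W-played w∈
  ... | y , p = subst (λ z → (w , z) ∈ pos₀) (eq→ (G⇒Atomic E R (β-game w)) (there p) (here refl) refl) p

  -- With ρ rounds left, Duplicator has to answer every element of K by β and vice versa.
  Forced : List (Fin n) → ℕ → Set
  Forced K ρ = ∀ d {ps} → pos₀ ⊆ ps → G d ρ ps → ∀ {x y} → (x , y) ∈ ps → ∀ {r} → r ∈ K ⊎ r ∈ W →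
               (x ≡ r → y ≡ β r) × (y ≡ β r → x ≡ r)

  -- The analogue of `TE` across the two structures: elements of `K` are read in `N` through `β`.
  XE : List (Fin n) → Fin n → Fin m → Set
  XE K x y = ∀ i (p : Fin (arity L i) → Fin (suc n)) → (∀ e → Over K (p e)) →
             relᶠ M i (ins x id ∘ p) ≡ relᶠ N i (ins y β ∘ p)

  XE-mono : ∀ {K K′ x y} → K ⊆ K′ → XE K′ x y → XE K x y
  XE-mono sub t i p o = t i p λ e → Over-mono sub (p e) (o e)

  XE⇒TE : ∀ {K x x′ y} → XE K x y → XE K x′ y → TE K x x′
  XE⇒TE t t′ i p o = trans (t i p o) (sym (t′ i p o))

  module _ {K ρ} (forced : Forced K ρ) where

    -- Spoiler need not change sides to get `(u , β u)` played: in `M` he chooses `u`, in `N` he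
    -- chooses `β u`, and `forced` fixes the other component either way.
    forcePlay : ∀ us → (∀ {u} → u ∈ us → u ∈ K ⊎ u ∈ W) → ∀ d {ps} → pos₀ ⊆ ps → G d (length us + ρ) ps →
                ∃ λ ps′ → ps ⊆ ps′ × G d ρ ps′ × (∀ {u} → u ∈ us → (u , β u) ∈ ps′)
    forcePlay us us⊆ E ext g with playˡ (G E) proj₂ us g
    ... | qs , refl , ps′ , qs⊆ , ps⊆ , g′ = ps′ , ps⊆ , g′ , λ u∈ →
          let ((x , y) , p , e) = ∈-map⁻ proj₁ u∈
              e′ = proj₁ (forced E (ps⊆ ∘ ext) g′ (qs⊆ p) (us⊆ u∈)) (sym e)
          in qs⊆ (subst (_∈ qs) (cong₂ _,_ (sym e) e′) p)
    forcePlay us us⊆ A {ps} ext g with playʳ (G A) proj₂ (map β us) (subst (λ z → G A (z + ρ) ps) (sym (length-map β us)) g)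
    ... | qs , eq , ps′ , qs⊆ , ps⊆ , g′ = ps′ , ps⊆ , g′ , λ u∈ →
          let ((x , y) , p , e) = ∈-map⁻ proj₂ (subst (_ ∈_) (sym eq) (∈-map⁺ β u∈))
              e′ = proj₂ (forced A (ps⊆ ∘ ext) g′ (qs⊆ p) (us⊆ u∈)) (sym e)
          in qs⊆ (subst (_∈ qs) (cong₂ _,_ e′ (sym e)) p)

    named-agree : suc q + ρ ≤ suc R → ∀ i f → (∀ e → f e ∈ K ⊎ f e ∈ W) → relᶠ M i f ≡ relᶠ N i (β ∘ f)
    named-agree le i f f∈
      with forcePlay (tabulate f)
             (λ u∈ → let (e , eq) = ∈-tabulate⁻ u∈ in subst (λ u → u ∈ K ⊎ u ∈ W) (sym eq) (f∈ e))
             E id (G-mono E (ℕₚ.≤-trans (ℕₚ.+-monoˡ-≤ ρ (subst (_≤ suc q) (sym (length-tabulate f)) (arity≤ i))) le) (game E))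
    ... | ps′ , _ , g′ , β∈ = agree (G⇒Atomic E ρ g′) i f (β ∘ f) λ e → β∈ (∈-tabulate⁺ e)

    -- If the pattern contains the hole, at most `q` of its positions are elements of `K⁺`, and
    -- these can still be played next to `(x , y)`. Without the hole neither `x` nor `y` matters,
    -- and `named-agree` settles the pattern in a separate play with room for `suc q` moves.
    same-type : suc q + ρ ≤ suc R → ∀ {K⁺} → (∀ {u} → u ∈ K⁺ → u ∈ K ⊎ u ∈ W) →
                ∀ d {ps} → pos₀ ⊆ ps → G d (q + ρ) ps → ∀ {x y} → (x , y) ∈ ps → XE K⁺ x y
    same-type le {K⁺} sub d {ps} ext g {x} {y} xy∈ i p over with any? (λ e → p e ≟ zero)
    ... | no ¬hole = trans (named-agree le i (ins x id ∘ p) λ e → inside (p e) (over e) (λ z → ¬hole (e , z)))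
                       (relᶠ-cong N i λ e → same (p e) (λ z → ¬hole (e , z)))
      where
      inside : ∀ c → Over K⁺ c → c ≢ zero → ins x id c ∈ K ⊎ ins x id c ∈ W
      inside zero _ ne = contradiction refl ne
      inside (suc u) u∈ _ = sub u∈
      same : ∀ c → c ≢ zero → β (ins x id c) ≡ ins y β c
      same zero ne = contradiction refl ne
      same (suc u) _ = refl
    ... | yes (e₀ , hole) = result
      where
      cs = filter (λ c → ¬? (c ≟ zero)) (tabulate p)
      us = map (ins x id) cs
      len : length us ≤ q
      len = ℕₚ.≤-pred (ℕₚ.≤-trans
        (ℕₚ.≤-trans (s≤s (ℕₚ.≤-reflexive (length-map (ins x id) cs)))
          (filter-notAll (λ c → ¬? (c ≟ zero)) (tabulate p)
            (lose (∈-tabulate⁺ {f = p} e₀) (λ ne → ne hole))))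
        (subst (_≤ suc q) (sym (length-tabulate p)) (arity≤ i)))
      us⊆ : ∀ {u} → u ∈ us → u ∈ K ⊎ u ∈ W
      us⊆ u∈ with ∈-map⁻ (ins x id) u∈
      ... | c , c∈ , refl with ∈-filter⁻ (λ c → ¬? (c ≟ zero)) {xs = tabulate p} c∈
      ...   | c∈t , ne with ∈-tabulate⁻ {f = p} c∈t
      ...     | e , refl with p e | over e
      ...       | zero | _ = contradiction refl ne
      ...       | suc u | o = sub o
      played = forcePlay us us⊆ d ext (G-mono d (ℕₚ.+-monoˡ-≤ ρ len) g)
      result : relᶠ M i (ins x id ∘ p) ≡ relᶠ N i (ins y β ∘ p)
      result with played
      ... | ps′ , ps⊆ , g′ , β∈ = agree (G⇒Atomic d ρ g′) i _ _ λ e → entry e (p e) refl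
        where
        entry : ∀ e c → p e ≡ c → (ins x id c , ins y β c) ∈ ps′
        entry e zero _ = ps⊆ xy∈
        entry e (suc u) eq = β∈ (∈-map⁺ (ins x id) (∈-filter⁺ (λ c → ¬? (c ≟ zero)) (subst (_∈ tabulate p) eq (∈-tabulate⁺ e)) λ ()))

  -- The `q` extra rounds ensure that paired elements have the same type over `K⁺`. In `M`, `single`
  -- then identifies an unnamed element of `K′` by its type among the unnamed elements. The
  -- corresponding uniqueness of `β r` in `N` has to be deduced.
  forced-layer : ∀ {j K K⁺ K′ ρ} → Layer q W j K K⁺ K′ → 1 + q + ρ ≤ R → Forced K ρ → Forced K′ (q + ρ)
  forced-layer {K = K} {K⁺} {K′} {ρ} l le forced d {ps} ext g {x} {y} xy∈ {r} r∈ with (r ∈? K⁺) | (r ∈? W)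
  ... | yes r∈K⁺ | _ = forced d ext (G-mono d (ℕₚ.m≤n+m ρ q) g) xy∈ (Layer.named l r∈K⁺)
  ... | no _ | yes r∈W = forced d ext (G-mono d (ℕₚ.m≤n+m ρ q) g) xy∈ (inj₂ r∈W)
  ... | no r∉K⁺ | no r∉W = to , from
    where
    open Layer l
    r∈K′ : r ∈ K′
    r∈K′ = [ id , (λ r∈W → contradiction r∈W r∉W) ]′ r∈
    le′ : suc q + ρ ≤ suc R
    le′ = ℕₚ.m≤n⇒m≤1+n le
    Known : Fin n → Set
    Known u = u ∈ K ⊎ u ∈ W
    type : ∀ d {ps} → pos₀ ⊆ ps → G d (q + ρ) ps → ∀ {x y} → (x , y) ∈ ps → XE K⁺ x y
    type = same-type forced le′ named
    βr-game : G E (q + ρ) ((r , β r) ∷ pos₀)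
    βr-game = G-mono E (ℕₚ.≤-trans (ℕₚ.n≤1+n _) le) (β-game r)
    βr-type : XE K⁺ r (β r)
    βr-type = type E there βr-game (here refl)
    r-unknown : ∀ {u} → Known u → r ≢ u
    r-unknown (inj₁ u∈K) refl = r∉K⁺ (K⊆K⁺ u∈K)
    r-unknown (inj₂ u∈W) refl = r∉W u∈W
    βr-unknown : ∀ {u} → Known u → β r ≢ β u
    βr-unknown k e = r-unknown k (proj₂ (forced E there (G-mono E (ℕₚ.m≤n+m ρ q) βr-game) (here refl) k) e)
    is-r : ∀ d {ps} → pos₀ ⊆ ps → G d (q + ρ) ps → ∀ {x y} → (x , y) ∈ ps →
           XE K⁺ r y → (∀ {u} → Known u → y ≢ β u) → x ≡ r
    is-r d ext g {x} xy∈ t y≢ = single r∈K′ r∉K⁺ r∉W (x-unknown ∘ named) (x-unknown ∘ inj₂) (XE⇒TE (type d ext g xy∈) t)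
      where
      x-unknown : ¬ Known x
      x-unknown k = y≢ k (proj₁ (forced d ext (G-mono d (ℕₚ.m≤n+m ρ q) g) xy∈ k) refl)
    from : y ≡ β r → x ≡ r
    from refl = is-r d ext g xy∈ βr-type βr-unknown
    to : x ≡ r → y ≡ β r
    -- In a new play from `pos₀` Spoiler chooses `y` and `β r` in `N`. Both have the type of `r` and
    -- differ from `β u` for every known `u`, so both must be answered by `r` and hence coincide.
    -- These are the two rounds beyond `q + ρ`.
    to refl with proj₂ (G-mono A {2 + (q + ρ)} (s≤s le) (game A)) y
    ... | x₁ , g₁ with proj₂ g₁ (β r)
    ...   | x₂ , g₂ = eq→ (G⇒Atomic A _ g₂) (there (here refl)) (here refl)
              (trans (is-r A (there ∘ there) g₂ (there (here refl)) (type d ext g xy∈) y-unknown)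
                     (sym (is-r A (there ∘ there) g₂ (here refl) βr-type βr-unknown)))
      where
      y-unknown : ∀ {u} → Known u → y ≢ β u
      y-unknown k e = r-unknown k (proj₂ (forced d ext (G-mono d (ℕₚ.m≤n+m ρ q) g) xy∈ k) e)

  -- Named elements cost nothing, as they stand in `pos₀` already; each layer adds `q` rounds.
  forced : ∀ {j K} → Tower q W j K → j ≤ q → Forced K (j * q)
  forced base _ d ext g xy∈ (inj₂ r∈W) = eq→ g xy∈ (ext (β-W r∈W)) , eq← g xy∈ (ext (β-W r∈W))
  forced (layer {j} t l) j<q = forced-layer l
    (ℕₚ.≤-trans (ℕₚ.≤-trans (ℕₚ.+-monoʳ-≤ 1 (ℕₚ.*-monoˡ-≤ q j<q))
      (ℕₚ.≤-trans (ℕₚ.≤-reflexive (ℕₚ.+-comm 1 (q * q))) (ℕₚ.+-monoˡ-≤ 1 (ℕₚ.m≤m+n (q * q) q)))) bound)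
    (forced t (ℕₚ.<⇒≤ j<q))

  module Matching {K} (tower : Tower q W q K) where

    Known : Fin n → Set
    Known r = r ∈ K ⊎ r ∈ W

    Match : Fin n → Fin m → Set
    Match x y = XE K x y × (∀ {r} → Known r → (x ≡ r → y ≡ β r) × (y ≡ β r → x ≡ r))

    -- Budget of the play in `agree-layer`: `l` outside entries, up to `q` entries recognised by the
    -- first `j` layers, and the `j * q` rounds on which `Forced` relies there.
    rounds : ∀ j → suc j ≤ q → ∀ l → l + j ≤ suc q → l + (q + j * q) ≤ suc R
    rounds j (s≤s {n = q′} j≤) l le = ℕₚ.≤-trans
      (begin
        l + (suc q′ + j * suc q′)  ≡⟨ solve 3 (λ l j q′ → l :+ (con 1 :+ q′ :+ j :* (con 1 :+ q′)) := (l :+ j) :+ (con 1 :+ q′ :+ j :* q′)) refl l j q′ ⟩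
        (l + j) + (suc q′ + j * q′)  ≤⟨ ℕₚ.+-mono-≤ le (ℕₚ.+-monoʳ-≤ (suc q′) (ℕₚ.*-monoˡ-≤ q′ j≤)) ⟩
        suc (suc q′) + (suc q′ + q′ * q′)  ≤⟨ ℕₚ.m≤m+n _ (1 + q′) ⟩
        suc (suc q′) + (suc q′ + q′ * q′) + (1 + q′)  ≡⟨ solve 1 (λ q′ → con 2 :+ q′ :+ (con 1 :+ q′ :+ q′ :* q′) :+ (con 1 :+ q′) := con 1 :+ ((con 1 :+ q′) :* (con 1 :+ q′) :+ (con 1 :+ q′) :+ con 1)) refl q′ ⟩
        suc (suc q′ * suc q′ + suc q′ + 1)  ∎)
      (s≤s bound)
      where
      open ℕₚ.≤-Reasoning
      open +-*-Solver

    -- Statement of a downward induction over the layers, with a budget of `q + 1 - j` entries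
    -- outside the set. At `j = q` at most one such entry remains and its type over `K` decides; at
    -- `j = 0` every tuple is within the budget.
    Agree : ℕ → List (Fin n) → Set
    Agree j K = ∀ i f g → (∀ e → Match (f e) (g e)) →
      (∀ {e e′} → f e ≡ f e′ → g e ≡ g e′) → (∀ {e e′} → g e ≡ g e′ → f e ≡ f e′) →
      ∀ D → length D + j ≤ suc q → (∀ e → f e ∈ K ⊎ f e ∈ D) → relᶠ M i f ≡ relᶠ N i g

    agree-top : Agree q K
    agree-top i f g match to from D len cov with any? (λ e → ¬? (f e ∈? K))
    ... | yes (e₀ , e₀∉) = around e₀ λ e ∉K → same-outside D len (cov e) (cov e₀) ∉K
      where
      same-outside : ∀ {x} D → length D + q ≤ suc q → x ∈ K ⊎ x ∈ D → f e₀ ∈ K ⊎ f e₀ ∈ D → x ∉ K → x ≡ f e₀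
      same-outside D len (inj₁ p) _ ∉K = contradiction p ∉K
      same-outside D len (inj₂ p) (inj₁ p₀) ∉K = contradiction p₀ e₀∉
      same-outside (d ∷ []) len (inj₂ (here refl)) (inj₂ (here refl)) ∉K = refl
      same-outside (d ∷ d′ ∷ D) len (inj₂ _) (inj₂ _) ∉K =
        contradiction (ℕₚ.≤-pred len) (ℕₚ.<⇒≱ (s≤s (ℕₚ.m≤n+m q (length D))))
      around : ∀ e₀ → (∀ e → f e ∉ K → f e ≡ f e₀) → relᶠ M i f ≡ relᶠ N i g
      around e₀ outside = trans (relᶠ-cong M i λ e → sym (atM e)) (trans (proj₁ (match e₀) i p over) (relᶠ-cong N i atN))
        where
        p : Fin (arity L i) → Fin (suc n)
        p e with f e ∈? K
        ... | yes _ = suc (f e)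
        ... | no _ = zero
        over : ∀ e → Over K (p e)
        over e with f e ∈? K
        ... | yes q = q
        ... | no _ = tt
        atM : ∀ e → ins (f e₀) id (p e) ≡ f e
        atM e with f e ∈? K
        ... | yes _ = refl
        ... | no ∉K = sym (outside e ∉K)
        atN : ∀ e → ins (g e₀) β (p e) ≡ g e
        atN e with f e ∈? K
        ... | yes q = sym (proj₁ (proj₂ (match e) (inj₁ q)) refl)
        ... | no ∉K = sym (to (outside e ∉K))
    ... | no all∈ = trans (proj₁ (match e₀) i (suc ∘ f) inK) (relᶠ-cong N i atN)
      where
      e₀ : Fin (arity L i)
      e₀ = fromℕ< (arity≥ i)
      inK : ∀ e → f e ∈ K
      inK e = decidable-stable (f e ∈? K) λ ∉K → all∈ (e , ∉K)
      atN : ∀ e → β (f e) ≡ g e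
      atN e = sym (proj₁ (proj₂ (match e) (inj₁ (inK e))) refl)

    representatives : ∀ {l} (f : Fin l → Fin n) (g : Fin l → Fin m) → (∀ {e e′} → f e ≡ f e′ → g e ≡ g e′) →
      ∀ D → ∃ λ ys → length ys ≤ length D × (∀ e → f e ∈ D → g e ∈ ys)
    representatives f g to [] = [] , z≤n , λ _ ()
    representatives f g to (d ∷ D) with representatives f g to D | any? (λ e → f e ≟ d)
    ... | ys , le , c | yes (e₀ , refl) = g e₀ ∷ ys , s≤s le , λ where
          e (here eq) → here (to eq)
          e (there p) → there (c e p)
    ... | ys , le , c | no none = ys , ℕₚ.m≤n⇒m≤1+n le , λ where
          e (here eq) → contradiction (e , eq) none
          e (there p) → c e p

    -- An entry in `K′` but not in `K₁` is absorbed by the larger set, which makes up for the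
    -- smaller budget. If there is none, the entries outside `K₁` are outside `K′`. A play in `N`
    -- then yields a tuple `f′` of `M` that agrees with `g`, and `rearrange` compares `f` with `f′`,
    -- whose corresponding entries have equal types over `K⁺`.
    agree-layer : ∀ {j K₁ K⁺ K′} → Tower q W j K₁ → Layer q W j K₁ K⁺ K′ → suc j ≤ q → K′ ⊆ K →
                  Agree (suc j) K′ → Agree j K₁
    agree-layer {j} {K₁} {K⁺} {K′} t l j<q K′⊆K hyp i f g match to from D len cov
      with any? (λ e → (f e ∈? K′) ×-dec ¬? (f e ∈? K₁)) | any? (λ e → ¬? (f e ∈? K₁))
    ... | yes (e₀ , ∈K′ , ∉K₁) | _ = hyp i f g match to from (filter (λ d → ¬? (d ≟ f e₀)) D)
          (ℕₚ.≤-trans (ℕₚ.≤-reflexive (ℕₚ.+-suc _ j))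
            (ℕₚ.≤-trans (ℕₚ.+-monoˡ-≤ j (filter-notAll (λ d → ¬? (d ≟ f e₀)) D (lose e₀∈D (λ ne → ne refl)))) len))
          λ e → cov′ e (cov e)
      where
      open Layer l
      e₀∈D : f e₀ ∈ D
      e₀∈D = [ (λ p → contradiction p ∉K₁) , id ]′ (cov e₀)
      cov′ : ∀ e → f e ∈ K₁ ⊎ f e ∈ D → f e ∈ K′ ⊎ f e ∈ filter (λ d → ¬? (d ≟ f e₀)) D
      cov′ e (inj₁ p) = inj₁ (K⁺⊆K′ (K⊆K⁺ p))
      cov′ e (inj₂ p) with f e ≟ f e₀
      ... | yes eq = inj₁ (subst (_∈ K′) (sym eq) ∈K′)
      ... | no ne = inj₂ (∈-filter⁺ (λ d → ¬? (d ≟ f e₀)) p ne)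
    ... | no _ | no all∈ = hyp i f g match to from [] (ℕₚ.m≤n⇒m≤1+n j<q)
          λ e → inj₁ (Layer.K⁺⊆K′ l (Layer.K⊆K⁺ l (decidable-stable (f e ∈? K₁) λ ∉K → all∈ (e , ∉K))))
    ... | no none | yes (e₀ , e₀∉) = trans
          (rearrange q l (allFin _) f f′ D₁ (λ e → inj₁ (∈-allFin e))
            (λ eq → fromPs (to eq)) (λ eq → from (toPs eq)) eqv (ℕₚ.≤-trans (ℕₚ.+-monoˡ-≤ j (length-filter _ D)) len)
            (λ d∈ → proj₂ (∈-filter⁻ (λ d → ¬? (d ∈? K′)) {xs = D} d∈)) cov₁)
          (agree atomic₂ i f′ g ∈ps₂)
      where
      open Layer l
      outside : ∀ e → f e ∉ K₁ → f e ∉ K′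
      outside e ∉K₁ ∈K′ = none (e , ∈K′ , ∉K₁)
      D₁ = filter (λ d → ¬? (d ∈? K′)) D
      cov₁ : ∀ e → f e ∈ K₁ ⊎ f e ∈ D₁
      cov₁ e with f e ∈? K₁
      ... | yes p = inj₁ p
      ... | no ∉K₁ = inj₂ (∈-filter⁺ (λ d → ¬? (d ∈? K′)) ([ (λ p → contradiction p ∉K₁) , id ]′ (cov e)) (outside e ∉K₁))
      F : Forced K₁ (j * q)
      F = forced t (ℕₚ.<⇒≤ j<q)
      -- Spoiler plays the values of `g` belonging to `D₁`; because `g` repeats entries wherever `f`
      -- does, there are at most `length D₁` of them.
      reps = representatives f g to D₁
      ys = proj₁ reps
      played = playʳ (G A) proj₂ ys (G-mono A (rounds j j<q (length ys)
                 (ℕₚ.≤-trans (ℕₚ.+-monoˡ-≤ j (ℕₚ.≤-trans (proj₁ (proj₂ reps)) (length-filter _ D))) len)) (game A))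
      qs = proj₁ played
      ps₁ = proj₁ (proj₂ (proj₂ played))
      qs⊆ : qs ⊆ ps₁
      qs⊆ = proj₁ (proj₂ (proj₂ (proj₂ played)))
      ext₁ : pos₀ ⊆ ps₁
      ext₁ = proj₁ (proj₂ (proj₂ (proj₂ (proj₂ played))))
      g₁ : G A (q + j * q) ps₁
      g₁ = proj₂ (proj₂ (proj₂ (proj₂ (proj₂ played))))
      us = filter (_∈? K₁) (tabulate f)
      us≤ : length us ≤ q
      us≤ = ℕₚ.≤-pred (ℕₚ.≤-trans (filter-notAll (_∈? K₁) (tabulate f) (lose (∈-tabulate⁺ {f = f} e₀) e₀∉))
              (subst (_≤ suc q) (sym (length-tabulate f)) (arity≤ i)))
      force = forcePlay F us (λ u∈ → inj₁ (proj₂ (∈-filter⁻ (_∈? K₁) {xs = tabulate f} u∈))) A ext₁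
                (G-mono A (ℕₚ.+-monoˡ-≤ (j * q) us≤) g₁)
      ps₂ = proj₁ force
      ps₁⊆ : ps₁ ⊆ ps₂
      ps₁⊆ = proj₁ (proj₂ force)
      atomic₂ : Atomic ps₂
      atomic₂ = G⇒Atomic A (j * q) (proj₁ (proj₂ (proj₂ force)))
      answer : ∀ e → f e ∉ K₁ → ∃ λ x → (x , g e) ∈ ps₁
      answer e ∉K₁ with ∈-map⁻ proj₂ (subst (g e ∈_) (sym (proj₁ (proj₂ played)))
        (proj₂ (proj₂ reps) e ([ (λ p → contradiction p ∉K₁) , id ]′ (cov₁ e))))
      ... | (x , _) , p , refl = x , qs⊆ p
      f′ : Fin (arity L i) → Fin n
      f′ e with f e ∈? K₁
      ... | yes _ = f e
      ... | no ∉K₁ = proj₁ (answer e ∉K₁)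
      ∈ps₂ : ∀ e → (f′ e , g e) ∈ ps₂
      ∈ps₂ e with f e ∈? K₁
      ... | yes p = subst (λ z → (f e , z) ∈ ps₂)
                      (sym (proj₁ (proj₂ (match e) (inj₁ (K′⊆K (K⁺⊆K′ (K⊆K⁺ p))))) refl))
                      (proj₂ (proj₂ (proj₂ force)) (∈-filter⁺ (_∈? K₁) (∈-tabulate⁺ e) p))
      ... | no ∉K₁ = ps₁⊆ (proj₂ (answer e ∉K₁))
      fromPs : ∀ {e e′} → g e ≡ g e′ → f′ e ≡ f′ e′
      fromPs {e} {e′} = eq← atomic₂ (∈ps₂ e) (∈ps₂ e′)
      toPs : ∀ {e e′} → f′ e ≡ f′ e′ → g e ≡ g e′
      toPs {e} {e′} = eq→ atomic₂ (∈ps₂ e) (∈ps₂ e′)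
      eqv : ∀ e → f e ≡ f′ e ⊎ (f e ∉ K′ × f′ e ∉ K′ × TE K⁺ (f e) (f′ e))
      eqv e with f e ∈? K₁
      ... | yes _ = inj₁ refl
      ... | no ∉K₁ with answer e ∉K₁
      ...   | x , x∈ with f e ≟ x
      ...     | yes eq = inj₁ eq
      ...     | no ne = inj₂ (outside e ∉K₁ , x∉ , te)
        where
        te : TE K⁺ (f e) x
        te = XE⇒TE (XE-mono (K′⊆K ∘ K⁺⊆K′) (proj₁ (match e)))
               (same-type F (ℕₚ.≤-trans (ℕₚ.≤-trans (s≤s (ℕₚ.*-monoˡ-≤ q j<q))
                  (s≤s (ℕₚ.≤-trans (ℕₚ.m≤m+n (q * q) (q + 1)) (ℕₚ.≤-reflexive (sym (ℕₚ.+-assoc (q * q) q 1)))))) (s≤s bound)) named A ext₁ g₁ x∈)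
        lowF = λ {r} → F A ext₁ (G-mono A (ℕₚ.m≤n+m (j * q) q) g₁) x∈ {r}
        not-known : ∀ {r} → r ∈ K₁ ⊎ r ∈ W → r ∈ K ⊎ r ∈ W → x ≢ r
        not-known k k′ eq = ne (trans (proj₂ (proj₂ (match e) k′) (proj₁ (lowF k) eq)) (sym eq))
        fe∉W : f e ∉ W
        fe∉W w = ne (sym (proj₂ (lowF (inj₂ w)) (proj₁ (proj₂ (match e) (inj₂ w)) refl)))
        -- An answer in `K′` would be recognised, directly if it is in `K₁` or named and by `single`
        -- otherwise, and would equal `f e`.
        x∉ : x ∉ K′
        x∉ x∈K′ with x ∈? K₁ | x ∈? W | x ∈? K⁺
        ... | yes k | _ | _ = not-known (inj₁ k) (inj₁ (K′⊆K x∈K′)) refl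
        ... | no _ | yes w | _ = not-known (inj₂ w) (inj₂ w) refl
        ... | no a | no b | yes k⁺ = [ a , b ]′ (named k⁺)
        ... | no _ | no x∉W | no x∉K⁺ = ne (single x∈K′ x∉K⁺ x∉W (outside e ∉K₁ ∘ K⁺⊆K′) fe∉W te)

    descend : ∀ {j K₁} → Tower q W j K₁ → j ≤ q → K₁ ⊆ K → Agree j K₁ → Agree 0 []
    descend base _ _ a = a
    descend (layer t l) j<q sub a = descend t (ℕₚ.<⇒≤ j<q) (sub ∘ Layer.K⁺⊆K′ l ∘ Layer.K⊆K⁺ l) (agree-layer t l j<q sub a)

    matched-agree : ∀ i f g → (∀ e → Match (f e) (g e)) →
      (∀ {e e′} → f e ≡ f e′ → g e ≡ g e′) → (∀ {e e′} → g e ≡ g e′ → f e ≡ f e′) → relᶠ M i f ≡ relᶠ N i g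
    matched-agree i f g match to from = descend tower ℕₚ.≤-refl id agree-top i f g match to from
      (tabulate f) (subst (_≤ suc q) (trans (sym (length-tabulate f)) (sym (ℕₚ.+-identityʳ _))) (arity≤ i))
      λ e → inj₂ (∈-tabulate⁺ e)

    played-match : ∀ d {ps} → pos₀ ⊆ ps → G d (q + q * q) ps → ∀ {x y} → (x , y) ∈ ps → Match x y
    played-match d ext g xy∈ =
      same-type (forced tower ℕₚ.≤-refl)
        (s≤s (ℕₚ.≤-trans (ℕₚ.≤-trans (ℕₚ.≤-reflexive (ℕₚ.+-comm q (q * q))) (ℕₚ.m≤m+n _ 1)) bound)) inj₁ d ext g xy∈ ,
      forced tower ℕₚ.≤-refl d ext (G-mono d (ℕₚ.m≤n+m (q * q) q) g) xy∈

-- Counting the realisations of types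

module Extension {a b : ℕ} (_~_ : Fin a → Fin b → Set) where

  Distinct : List (Fin a × Fin b) → Set
  Distinct = AllPairs (λ p q → proj₁ p ≢ proj₁ q × proj₂ p ≢ proj₂ q)

  Good : List (Fin a × Fin b) → Set
  Good ps = Distinct ps × (∀ {x y} → (x , y) ∈ ps → x ~ y)

  Distinct-functional : ∀ {ps} → Distinct ps → ∀ {x y x′ y′} → (x , y) ∈ ps → (x′ , y′) ∈ ps →
                        (x ≡ x′ → y ≡ y′) × (y ≡ y′ → x ≡ x′)
  Distinct-functional (d ∷ ds) (here refl) (here refl) = (λ _ → refl) , (λ _ → refl)
  Distinct-functional (d ∷ ds) (here refl) (there p) =
    (λ e → contradiction e (proj₁ (All.lookup d p))) , (λ e → contradiction e (proj₂ (All.lookup d p)))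
  Distinct-functional (d ∷ ds) (there p) (here refl) =
    (λ e → contradiction (sym e) (proj₁ (All.lookup d p))) , (λ e → contradiction (sym e) (proj₂ (All.lookup d p)))
  Distinct-functional (d ∷ ds) (there p) (there p′) = Distinct-functional ds p p′

  -- What a greedy extension needs at `x`. The bound `h` lets a class that is merely large qualify
  -- without its size being known.
  Fresh : ℕ → Fin a → Set
  Fresh h x = ∀ ps → Good ps → length ps < h → (∀ y → (x , y) ∉ ps) → ∃ λ y → x ~ y × (∀ x′ → (x′ , y) ∉ ps)

  extend : ∀ h xs ps → Good ps → (∀ {x} → x ∈ xs → Fresh h x) → length ps + length xs ≤ h →
           ∃ λ ps′ → ps ⊆ ps′ × Good ps′ × (∀ {x} → x ∈ xs → ∃ λ y → (x , y) ∈ ps′) ×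
             (∀ {x y} → (x , y) ∈ ps′ → (x , y) ∈ ps ⊎ x ∈ xs)
  extend h [] ps good fresh le = ps , id , good , (λ ()) , inj₁
  extend h (x ∷ xs) ps good fresh le with Any.any? (λ p → proj₁ p ≟ x) ps
  ... | yes p with find p
  ...   | (_ , y) , y∈ , refl with extend h xs ps good (fresh ∘ there) (ℕₚ.≤-trans (ℕₚ.+-monoʳ-≤ (length ps) (ℕₚ.n≤1+n _)) le)
  ...     | ps′ , sub , good′ , cov , from = ps′ , sub , good′ ,
            (λ { (here refl) → y , sub y∈ ; (there q) → cov q }) , λ q → [ inj₁ , inj₂ ∘ there ]′ (from q)
  extend h (x ∷ xs) ps good@(dist , ok) fresh le | no ¬p
    with fresh (here refl) ps good (ℕₚ.≤-trans (ℕₚ.≤-trans (ℕₚ.≤-reflexive (ℕₚ.+-comm 1 (length ps))) (ℕₚ.+-monoʳ-≤ (length ps) (s≤s z≤n))) le)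
           (λ y y∈ → ¬p (lose y∈ refl))
  ... | y , x~y , new
    with extend h xs ((x , y) ∷ ps)
           (All.tabulate (λ {q} q∈ → (λ { refl → ¬p (lose q∈ refl) }) , (λ { refl → new _ q∈ })) ∷ dist ,
            λ { (here refl) → x~y ; (there q) → ok q })
           (fresh ∘ there) (ℕₚ.≤-trans (ℕₚ.≤-reflexive (sym (ℕₚ.+-suc (length ps) (length xs)))) le)
  ... | ps′ , sub , good′ , cov , from = ps′ , sub ∘ there , good′ ,
        (λ { (here refl) → y , sub (here refl) ; (there q) → cov q }) ,
        λ q → [ (λ { (here refl) → inj₂ (here refl) ; (there r) → inj₁ r }) , inj₂ ∘ there ]′ (from q)

  fresh-large : ∀ {h x} ys → Unique ys → (∀ {y} → y ∈ ys → x ~ y) → h ≤ length ys → Fresh h x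
  fresh-large ys u ok le ps good lt _ with pick-fresh ys (map proj₂ ps) u (ℕₚ.<-≤-trans (subst (_< _) (sym (length-map proj₂ ps)) lt) le)
  ... | y , y∈ , y∉ = y , ok y∈ , λ x′ p → y∉ (∈-map⁺ proj₂ p)

  -- Whatever is matched to a partner of `x` lies in `cs`, and so does the unmatched `x`. Hence
  -- fewer than `length cs` partners are in use, however long the matching is.
  fresh-balanced : (∀ x y → Dec (x ~ y)) → ∀ {h x} ys (cs : List (Fin a)) → Unique ys → (∀ {y} → y ∈ ys → x ~ y) →
    x ∈ cs → (∀ {x′ y} → x ~ y → x′ ~ y → x′ ∈ cs) → length cs ≤ length ys → Fresh h x
  fresh-balanced dec {x = x} ys cs u ok x∈ same le ps (dist , good) _ x-new = proj₁ fresh , ok (proj₁ (proj₂ fresh)) ,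
    λ x′ p → proj₂ (proj₂ fresh) (∈-map⁺ proj₂ (∈-filter⁺ used? p (ok (proj₁ (proj₂ fresh)))))
    where
    used? = λ (p : Fin a × Fin b) → dec x (proj₂ p)
    used = filter used? ps
    firsts-unique : Unique (x ∷ map proj₁ used)
    firsts-unique = Allₚ.map⁺ (All.tabulate λ { {_ , y} p refl → x-new y (proj₁ (∈-filter⁻ used? {xs = ps} p)) })
      ∷ AllPairsₚ.map⁺ (AllPairs.map proj₁ (AllPairsₚ.filter⁺ used? dist))
    firsts⊆ : x ∷ map proj₁ used ⊆ cs
    firsts⊆ (here refl) = x∈
    firsts⊆ (there p) with ∈-map⁻ proj₁ p
    ... | (x′ , y) , q , refl with ∈-filter⁻ used? {xs = ps} q
    ...   | q∈ , x~y = same x~y (good q∈)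
    fresh = pick-fresh ys (map proj₂ used) u (ℕₚ.<-≤-trans
      (subst (_< length cs) (trans (length-map proj₁ used) (sym (length-map proj₂ used))) (unique-⊆⇒length≤ firsts-unique firsts⊆)) le)

-- Transfer of similarity between two structures

module SimTransfer {L : Vocab} {a b : ℕ} (P : Structure L a) (Q : Structure L b) (T : Fin a → Fin b → Set)
  (to : ∀ {x y x′ y′} → T x y → T x′ y′ → x ≡ x′ → y ≡ y′)
  (from : ∀ {x y x′ y′} → T x y → T x′ y′ → y ≡ y′ → x ≡ x′)
  (agrees : ∀ i f g → (∀ e → T (f e) (g e)) → relᶠ P i f ≡ relᶠ Q i g)
  where

  transpose-related : ∀ {x y x′ y′ u v} → T x y → T x′ y′ → T u v → T (transpose x x′ u) (transpose y y′ v)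
  transpose-related {x} {y} {x′} {y′} {u} {v} t t′ s with transposeView x x′ u
  ... | left refl e = subst₂ T (sym e) (sym (trans (cong (transpose y y′) (to s t refl)) (transpose-left y y′))) t′
  ... | right refl e = subst₂ T (sym e) (sym (trans (cong (transpose y y′) (to s t′ refl)) (transpose-right y y′))) t
  ... | other n n′ e = subst₂ T (sym e) (sym (transpose-other (n ∘ from s t) (n′ ∘ from s t′))) s

  transfer : ∀ {x y x′ y′} → T x y → T x′ y′ → Sim Q y y′ → ∀ i f → (∀ e → ∃ (T (f e))) →
             relᶠ P i (transpose x x′ ∘ f) ≡ relᶠ P i f
  transfer {x} {y} {x′} {y′} t t′ s i f cov = begin
    relᶠ P i (transpose x x′ ∘ f)  ≡⟨ agrees i _ _ (λ e → transpose-related t t′ (proj₂ (cov e))) ⟩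
    relᶠ Q i (transpose y y′ ∘ g)  ≡⟨ Sim⇒Simᶠ {M = Q} s i g ⟩
    relᶠ Q i g                     ≡⟨ agrees i f g (λ e → proj₂ (cov e)) ⟨
    relᶠ P i f                     ∎
    where
    open ≡-Reasoning
    g = λ e → proj₁ (cov e)

module _ {L : Vocab} {a b : ℕ} (P : Structure L a) (Q : Structure L b) (k : ℕ) (arity≤ : ∀ i → arity L i ≤ k)
  (_~_ : Fin a → Fin b → Set)
  (agrees : ∀ i f g → (∀ e → f e ~ g e) → (∀ {e e′} → f e ≡ f e′ → g e ≡ g e′) → (∀ {e e′} → g e ≡ g e′ → f e ≡ f e′) →
            relᶠ P i f ≡ relᶠ Q i g)
  where
  open Extension _~_

  -- The two transposed elements and at most `k` entries of a tuple call for a matching of `2 + k`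
  -- pairs. Freshness provides it, so no round of a game is spent here.
  sim-transfer : (∀ x → Fresh (2 + k) x) → ∀ {x y x′ y′} → x ~ y → x′ ~ y′ → x ≢ x′ → y ≢ y′ → Sim Q y y′ → Sim P x x′
  sim-transfer fresh {x} {y} {x′} {y′} xy xy′ x≢ y≢ s = Simᶠ⇒Sim {M = P} λ i f →
    let (ps , sub , (dist , ok) , cov , _) = extend (2 + k) (tabulate f) ((x , y) ∷ (x′ , y′) ∷ [])
            ((((x≢ , y≢) ∷ []) ∷ [] ∷ []) , λ { (here refl) → xy ; (there (here refl)) → xy′ })
            (λ {u} _ → fresh u) (s≤s (s≤s (subst (_≤ k) (sym (length-tabulate f)) (arity≤ i))))
        open SimTransfer P Q (λ u v → (u , v) ∈ ps) (λ p p′ → proj₁ (Distinct-functional dist p p′))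
               (λ p p′ → proj₂ (Distinct-functional dist p p′))
               (λ i f g p → agrees i f g (ok ∘ p) (λ {e} {e′} → proj₁ (Distinct-functional dist (p e) (p e′)))
                                                 (λ {e} {e′} → proj₂ (Distinct-functional dist (p e) (p e′))))
    in transfer (sub (here refl)) (sub (there (here refl))) s i f λ e → cov (∈-tabulate⁺ e)

module SimGame {L : Vocab} {n m : ℕ} (M : Structure L n) (N : Structure L m) (q : ℕ) (arity≤ : ∀ i → arity L i ≤ suc q) where
  open Game M N

  -- A tuple avoiding both transposed elements is fixed, so at most q further elements have to be played.
  others : ∀ {l c} → l ≤ suc q → (x x′ : Fin c) (f : Fin l → Fin c) →
    (∀ e → transpose x x′ (f e) ≡ f e) ⊎
    ∃ λ us → length us ≤ q × (∀ e → f e ≡ x ⊎ f e ≡ x′ ⊎ f e ∈ us)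
  others {l} le x x′ f with any? (λ e → ¬? (other? (f e)))
    where
    other? : ∀ u → Dec (u ≢ x × u ≢ x′)
    other? u = ¬? (u ≟ x) ×-dec ¬? (u ≟ x′)
  ... | no none = inj₁ λ e → let (a , b) = decidable-stable (¬? (f e ≟ x) ×-dec ¬? (f e ≟ x′)) (λ ne → none (e , ne)) in transpose-other a b
  ... | yes (e₀ , ne₀) = inj₂ (filter other? (tabulate f) ,
          ℕₚ.≤-pred (ℕₚ.≤-trans (filter-notAll other? (tabulate f) (lose (∈-tabulate⁺ {f = f} e₀) ne₀))
            (subst (_≤ suc q) (sym (length-tabulate f)) le)) , cov)
    where
    other? : ∀ u → Dec (u ≢ x × u ≢ x′)
    other? u = ¬? (u ≟ x) ×-dec ¬? (u ≟ x′)
    cov : ∀ e → f e ≡ x ⊎ f e ≡ x′ ⊎ f e ∈ filter other? (tabulate f)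
    cov e with f e ≟ x | f e ≟ x′
    ... | yes p | _ = inj₁ p
    ... | no _ | yes p = inj₂ (inj₁ p)
    ... | no p | no p′ = inj₂ (inj₂ (∈-filter⁺ other? (∈-tabulate⁺ e) (p , p′)))

  -- A tuple violating the similarity of `x` and `x′` can be played in `M` and yields one violating
  -- that of `y` and `y′`. Thus similarity passes to the side on which Spoiler plays.
  sim-game-E : ∀ {ps} → G E q ps → ∀ {x y x′ y′} → (x , y) ∈ ps → (x′ , y′) ∈ ps → Sim N y y′ → Sim M x x′
  sim-game-E {ps} g {x} {y} {x′} {y′} xy xy′ s = Simᶠ⇒Sim {M = M} go
    where
    go : Simᶠ M x x′
    go i f with others (arity≤ i) x x′ f
    ... | inj₁ fixed = relᶠ-cong M i fixed
    ... | inj₂ (us , len , cov) with playˡ (G E) proj₂ us {0} (G-mono E (ℕₚ.≤-trans (ℕₚ.≤-reflexive (ℕₚ.+-identityʳ _)) len) g)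
    ...   | qs , refl , ps′ , qs⊆ , ps⊆ , at = transfer (ps⊆ xy) (ps⊆ xy′) s i f λ e → answer (cov e)
      where
      open SimTransfer M N (λ u v → (u , v) ∈ ps′) (eq→ at) (eq← at) (agree at)
      answer : ∀ {u} → u ≡ x ⊎ u ≡ x′ ⊎ u ∈ map proj₁ qs → ∃ λ v → (u , v) ∈ ps′
      answer (inj₁ refl) = y , ps⊆ xy
      answer (inj₂ (inj₁ refl)) = y′ , ps⊆ xy′
      answer (inj₂ (inj₂ p)) with ∈-map⁻ proj₁ p
      ... | (_ , v) , p′ , refl = v , qs⊆ p′

  sim-game-A : ∀ {ps} → G A q ps → ∀ {x y x′ y′} → (x , y) ∈ ps → (x′ , y′) ∈ ps → Sim M x x′ → Sim N y y′
  sim-game-A {ps} g {x} {y} {x′} {y′} xy xy′ s = Simᶠ⇒Sim {M = N} go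
    where
    go : Simᶠ N y y′
    go i f with others (arity≤ i) y y′ f
    ... | inj₁ fixed = relᶠ-cong N i fixed
    ... | inj₂ (us , len , cov) with playʳ (G A) proj₂ us {0} (G-mono A (ℕₚ.≤-trans (ℕₚ.≤-reflexive (ℕₚ.+-identityʳ _)) len) g)
    ...   | qs , refl , ps′ , qs⊆ , ps⊆ , at = transfer (ps⊆ xy) (ps⊆ xy′) s i f λ e → answer (cov e)
      where
      open SimTransfer N M (λ u v → (v , u) ∈ ps′) (eq← at) (eq→ at) (λ i f g p → sym (agree at i g f p))
      answer : ∀ {u} → u ≡ y ⊎ u ≡ y′ ⊎ u ∈ map proj₂ qs → ∃ λ v → (v , u) ∈ ps′
      answer (inj₁ refl) = x , ps⊆ xy
      answer (inj₂ (inj₁ refl)) = x′ , ps⊆ xy′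
      answer (inj₂ (inj₂ p)) with ∈-map⁻ proj₂ p
      ... | (v , _) , p′ , refl = v , qs⊆ p′

-- Comparing the sizes of classes in `M` and `N`

∈-take⁻ : ∀ {X : Set} k {xs : List X} {x} → x ∈ take k xs → x ∈ xs
∈-take⁻ (suc k) {_ ∷ _} (here e) = here e
∈-take⁻ (suc k) {_ ∷ _} (there p) = there (∈-take⁻ k p)

short-≡ : ∀ {n} {xs : List (Fin n)} → length xs ≤ 1 → ∀ {x y} → x ∈ xs → y ∈ xs → x ≡ y
short-≡ {xs = _ ∷ []} _ (here refl) (here refl) = refl
short-≡ {xs = _ ∷ _ ∷ _} (s≤s ()) _ _

module Counting {L : Vocab} {n m : ℕ} (M : Structure L n) (N : Structure L m) (q : ℕ) (arity≤ : ∀ i → arity L i ≤ suc q)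
  (_≈_ : Fin n → Fin n → Set) (≈? : ∀ x y → Dec (x ≈ y))
  (≈-refl : ∀ {x} → x ≈ x) (≈-sym : ∀ {x y} → x ≈ y → y ≈ x) (≈-trans : ∀ {x y z} → x ≈ y → y ≈ z → x ≈ z)
  (μ : Fin m → Fin n)
  (agrees : ∀ i f g → (∀ e → f e ≈ μ (g e)) → (∀ {e e′} → f e ≡ f e′ → g e ≡ g e′) → (∀ {e e′} → g e ≡ g e′ → f e ≡ f e′) →
            relᶠ M i f ≡ relᶠ N i g)
  (B : ℕ)
  (lower : ∀ xs → Unique xs → length xs ≤ B →
           ∃ λ qs → map proj₁ qs ≡ xs × Unique (map proj₂ qs) × (∀ {x y} → (x , y) ∈ qs → x ≈ μ y))
  (upper : ∀ ys → Unique ys → length ys ≤ B →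
           ∃ λ qs → map proj₂ qs ≡ ys × Unique (map proj₁ qs) × (∀ {x y} → (x , y) ∈ qs → x ≈ μ y))
  where

  cls : Fin n → List (Fin n)
  cls x = filter (≈? x) (allFin n)

  cls̄ : Fin n → List (Fin m)
  cls̄ x = filter (λ y → ≈? x (μ y)) (allFin m)

  cls-unique : ∀ x → Unique (cls x)
  cls-unique x = filter-allFin (≈? x)

  cls̄-unique : ∀ x → Unique (cls̄ x)
  cls̄-unique x = filter-allFin (λ y → ≈? x (μ y))

  ∈-cls⁺ : ∀ {x x′} → x ≈ x′ → x′ ∈ cls x
  ∈-cls⁺ {x} {x′} = ∈-filter⁺ (≈? x) (∈-allFin x′)

  ∈-cls⁻ : ∀ {x x′} → x′ ∈ cls x → x ≈ x′
  ∈-cls⁻ {x} p = proj₂ (∈-filter⁻ (≈? x) {xs = allFin n} p)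

  ∈-cls̄⁺ : ∀ {x y} → x ≈ μ y → y ∈ cls̄ x
  ∈-cls̄⁺ {x} {y} = ∈-filter⁺ (λ y → ≈? x (μ y)) (∈-allFin y)

  ∈-cls̄⁻ : ∀ {x y} → y ∈ cls̄ x → x ≈ μ y
  ∈-cls̄⁻ {x} p = proj₂ (∈-filter⁻ (λ y → ≈? x (μ y)) {xs = allFin m} p)

  cls̄-lower : ∀ x xs → Unique xs → xs ⊆ cls x → length xs ≤ B → length xs ≤ length (cls̄ x)
  cls̄-lower x xs u sub le with lower xs u le
  ... | qs , refl , u′ , ok = ℕₚ.≤-trans (ℕₚ.≤-reflexive (trans (length-map proj₁ qs) (sym (length-map proj₂ qs))))
        (unique-⊆⇒length≤ u′ λ y∈ → let ((x′ , y) , p , e) = ∈-map⁻ proj₂ y∈ in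
          ∈-cls̄⁺ (subst (λ z → x ≈ μ z) (sym e) (≈-trans (∈-cls⁻ (sub (∈-map⁺ proj₁ p))) (ok p))))

  Balanced : Fin n → Set
  Balanced x = length (cls̄ x) ≡ length (cls x)

  -- The extra unit allows Spoiler to play one element more in `N` than the class has in `M`, which
  -- shows that the class is not larger in `N`.
  fits⇒balanced : ∀ x → suc (length (cls x)) ≤ B → Balanced x
  fits⇒balanced x le with length (cls̄ x) ℕₚ.≤? length (cls x)
  ... | yes ≤′ = ℕₚ.≤-antisym ≤′ (cls̄-lower x (cls x) (cls-unique x) id (ℕₚ.<⇒≤ le))
  ... | no ≰ = contradiction (lengths (upper ys (Uniqueₚ.take⁺ _ (cls̄-unique x)) (ℕₚ.≤-trans (ℕₚ.≤-reflexive len) le)))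
                 (ℕₚ.<-irrefl refl)
    where
    ys = take (suc (length (cls x))) (cls̄ x)
    len : length ys ≡ suc (length (cls x))
    len = trans (length-take _ (cls̄ x)) (ℕₚ.m≤n⇒m⊓n≡m (ℕₚ.≰⇒> ≰))
    lengths : (∃ λ qs → map proj₂ qs ≡ ys × Unique (map proj₁ qs) × (∀ {x y} → (x , y) ∈ qs → x ≈ μ y)) →
              suc (length (cls x)) ≤ length (cls x)
    lengths (qs , eq , u , ok) = ℕₚ.≤-trans
      (ℕₚ.≤-reflexive (trans (sym len) (trans (cong length (sym eq)) (trans (length-map proj₂ qs) (sym (length-map proj₁ qs))))))
      (unique-⊆⇒length≤ u λ x∈ → let ((x′ , y) , p , e) = ∈-map⁻ proj₁ x∈ in
        subst (_∈ cls x) (sym e) (∈-cls⁺ (≈-trans (∈-cls̄⁻ {x} (∈-take⁻ (suc (length (cls x))) (subst (y ∈_) eq (∈-map⁺ proj₂ p)))) (≈-sym (ok p)))))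

  module Forth = Extension (λ x y → x ≈ μ y)
  module Back = Extension (λ y x → x ≈ μ y)

  forth-fresh : ∀ {h x} → Balanced x → Forth.Fresh h x
  forth-fresh {x = x} bal = Forth.fresh-balanced (λ x y → ≈? x (μ y)) (cls̄ x) (cls x) (cls̄-unique x) ∈-cls̄⁻
    (∈-cls⁺ ≈-refl) (λ p p′ → ∈-cls⁺ (≈-trans p (≈-sym p′))) (ℕₚ.≤-reflexive (sym bal))

  back-fresh : ∀ {h y} → Balanced (μ y) → Back.Fresh h y
  back-fresh {y = y} bal = Back.fresh-balanced (λ y x → ≈? x (μ y)) (cls (μ y)) (cls̄ (μ y)) (cls-unique (μ y)) (≈-sym ∘ ∈-cls⁻)
    (∈-cls̄⁺ ≈-refl) (λ p p′ → ∈-cls̄⁺ (≈-trans (≈-sym p) p′)) (ℕₚ.≤-reflexive bal)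

  -- Balance gives injections of `M` into `N` and of `N` into `M`. By finiteness the first is onto,
  -- and `agrees` makes it an isomorphism.
  balanced⇒iso : (∀ x → Balanced x) → Iso N M
  balanced⇒iso bal
    with Forth.extend (n + m) (allFin n) [] ([] , λ ()) (λ {x} _ → forth-fresh {x = x} (bal x)) (ℕₚ.≤-trans (ℕₚ.≤-reflexive (length-tabulate id)) (ℕₚ.m≤m+n n m))
       | Back.extend (n + m) (allFin m) [] ([] , λ ()) (λ {y} _ → back-fresh {y = y} (bal (μ y))) (ℕₚ.≤-trans (ℕₚ.≤-reflexive (length-tabulate id)) (ℕₚ.m≤n+m m n))
  ... | ps , _ , (dist , ok) , cov , _ | ps′ , _ , (dist′ , ok′) , cov′ , _ = record
    { bij = mk↔ₛ′ inv F (λ x → F-inj (proj₂ (surj (F x)))) (λ y → proj₂ (surj y))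
    ; preserve = λ i t → trans (rel-map-lookup M i inv t)
        (trans (agrees i (inv ∘ Vec.lookup t) (Vec.lookup t)
                 (λ e → subst (λ z → inv (Vec.lookup t e) ≈ μ z) (proj₂ (surj (Vec.lookup t e))) (ok (F∈ _)))
                 (λ {e} {e′} eq → trans (sym (proj₂ (surj (Vec.lookup t e)))) (trans (cong F eq) (proj₂ (surj (Vec.lookup t e′)))))
                 (cong inv))
               (sym (rel-lookup N i t)))
    }
    where
    F : Fin n → Fin m
    F x = proj₁ (cov (∈-allFin x))
    F∈ : ∀ x → (x , F x) ∈ ps
    F∈ x = proj₂ (cov (∈-allFin x))
    F-inj : ∀ {x x′} → F x ≡ F x′ → x ≡ x′
    F-inj {x} {x′} = proj₂ (Forth.Distinct-functional dist (F∈ x) (F∈ x′))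
    F′ : Fin m → Fin n
    F′ y = proj₁ (cov′ (∈-allFin y))
    F′-inj : ∀ {y y′} → F′ y ≡ F′ y′ → y ≡ y′
    F′-inj {y} {y′} = proj₂ (Back.Distinct-functional dist′ (proj₂ (cov′ (∈-allFin y))) (proj₂ (cov′ (∈-allFin y′))))
    m≤n : m ≤ n
    m≤n = injective⇒≤ F′-inj
    surj : ∀ y → ∃ λ x → F x ≡ y
    surj y with any? (λ x → F x ≟ y)
    ... | yes p = p
    ... | no none = contradiction (unique-length≤n {xs = y ∷ map F (allFin n)}
            (Allₚ.map⁺ (All.tabulate λ {x} _ e → none (x , sym e)) ∷ Uniqueₚ.map⁺ F-inj (Uniqueₚ.allFin⁺ n)))
            (ℕₚ.<⇒≱ (s≤s (ℕₚ.≤-trans m≤n (ℕₚ.≤-reflexive (sym (trans (length-map F (allFin n)) (length-tabulate id)))))))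
    inv : Fin m → Fin n
    inv y = proj₁ (surj y)

  -- The one class that is too large to be counted

  module Exceptional (z₀ : Fin n)
    (others-balanced : ∀ x → ¬ z₀ ≈ x → Balanced x)
    (large : 3 + q ≤ length (cls z₀)) (3+q≤B : 3 + q ≤ B)
    (homogeneous : ∀ {x} → z₀ ≈ x → Sim M z₀ x)
    (singletons : ∀ {x} → Sim M z₀ x → ¬ z₀ ≈ x → ∀ {x′} → x ≈ x′ → x ≡ x′)
    (p : ℕ) (p≡ : p ≡ classSize M z₀)
    (largest : ∀ x → ¬ Sim M z₀ x → classSize M x < p)
    (gameE : Game.H M N E (p + suc q) []) (gameA : Game.H M N A (p + suc q) [])
    where
    open Game M N
    open SimGame M N q arity≤

    simClass : List (Fin n)
    simClass = filter (sim? M z₀) (allFin n)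

    private
      cls̄-large : 3 + q ≤ length (cls̄ z₀)
      cls̄-large = ℕₚ.≤-trans (ℕₚ.≤-reflexive (sym len))
        (cls̄-lower z₀ (take (3 + q) (cls z₀)) (Uniqueₚ.take⁺ _ (cls-unique z₀)) (∈-take⁻ (3 + q)) (ℕₚ.≤-trans (ℕₚ.≤-reflexive len) 3+q≤B))
        where
        len : length (take (3 + q) (cls z₀)) ≡ 3 + q
        len = trans (length-take (3 + q) (cls z₀)) (ℕₚ.m≤n⇒m⊓n≡m large)

      -- A class with at least `3 + q` elements on the other side accommodates the `2 + suc q` pairs
      -- of `sim-transfer` without being balanced.
      forth-fresh′ : ∀ x → Forth.Fresh (3 + q) x
      forth-fresh′ x with ≈? z₀ x
      ... | yes z≈x = Forth.fresh-large (cls̄ z₀) (cls̄-unique z₀) (λ y∈ → ≈-trans (≈-sym z≈x) (∈-cls̄⁻ y∈)) cls̄-large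
      ... | no z≉x = forth-fresh (others-balanced x z≉x)

      back-fresh′ : ∀ y → Back.Fresh (3 + q) y
      back-fresh′ y with ≈? z₀ (μ y)
      ... | yes z≈ = Back.fresh-large (cls z₀) (cls-unique z₀) (λ x∈ → ≈-trans (≈-sym (∈-cls⁻ x∈)) z≈) large
      ... | no z≉ = back-fresh (others-balanced (μ y) z≉)

      simM⇐N : ∀ {x y x′ y′} → x ≈ μ y → x′ ≈ μ y′ → x ≢ x′ → y ≢ y′ → Sim N y y′ → Sim M x x′
      simM⇐N = sim-transfer M N (suc q) arity≤ (λ x y → x ≈ μ y) agrees forth-fresh′

      simN⇐M : ∀ {x y x′ y′} → x ≈ μ y → x′ ≈ μ y′ → x ≢ x′ → y ≢ y′ → Sim M x x′ → Sim N y y′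
      simN⇐M xy xy′ x≢ y≢ = sim-transfer N M (suc q) arity≤ (λ y x → x ≈ μ y)
        (λ i g f h to from → sym (agrees i f g h from to)) back-fresh′ xy xy′ y≢ x≢

      abstract
        picked : ∃ λ y → z₀ ≈ μ y
        picked = let (y , y∈ , _) = pick-fresh (cls̄ z₀) [] (cls̄-unique z₀) (ℕₚ.≤-trans (s≤s z≤n) cls̄-large) in y , ∈-cls̄⁻ y∈
      y₀ : Fin m
      y₀ = proj₁ picked
      z₀y₀ : z₀ ≈ μ y₀
      z₀y₀ = proj₂ picked

      cls̄-sim : ∀ {y} → y ∈ cls̄ z₀ → Sim N y₀ y
      cls̄-sim {y} y∈ with y₀ ≟ y
      ... | yes refl = Sim-refl {M = N}
      ... | no y₀≢y with pick-fresh (cls z₀) (z₀ ∷ []) (cls-unique z₀) (ℕₚ.≤-trans (s≤s (s≤s z≤n)) large)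
      ...   | z₁ , z₁∈ , z₁∉ = simN⇐M z₀y₀ (≈-trans (≈-sym (∈-cls⁻ z₁∈)) (∈-cls̄⁻ y∈)) (λ e → z₁∉ (here (sym e))) y₀≢y
                (homogeneous (∈-cls⁻ z₁∈))

      extra? = λ x → sim? M z₀ x ×-dec ¬? (≈? z₀ x)
      extras : List (Fin n)
      extras = filter extra? (allFin n)

      abstract
        extras-played : ∃ λ ps → Forth.Good ps × (∀ {x} → x ∈ extras → ∃ λ y → (x , y) ∈ ps) ×
                        (∀ {x y} → (x , y) ∈ ps → Sim M z₀ x × ¬ z₀ ≈ x)
        extras-played =
          let (ps , _ , good , cov , from) = Forth.extend (length extras) extras [] ([] , λ ())
                (λ {x} x∈ → forth-fresh (others-balanced x (proj₂ (proj₂ (∈-filter⁻ extra? {xs = allFin n} x∈))))) ℕₚ.≤-refl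
          in ps , good , cov , λ xy∈ → [ (λ ()) , (λ x∈ → proj₂ (∈-filter⁻ extra? {xs = allFin n} x∈)) ]′ (from xy∈)
      pe : List (Fin n × Fin m)
      pe = proj₁ extras-played
      pe-good : Forth.Good pe
      pe-good = proj₁ (proj₂ extras-played)
      pe-cov : ∀ {x} → x ∈ extras → ∃ λ y → (x , y) ∈ pe
      pe-cov = proj₁ (proj₂ (proj₂ extras-played))
      pe-from : ∀ {x y} → (x , y) ∈ pe → Sim M z₀ x × ¬ z₀ ≈ x
      pe-from = proj₂ (proj₂ (proj₂ extras-played))

      -- Counterpart in `N` of the `∼`-class of `z₀`. The members of that class outside the
      -- exceptional type lie in balanced classes and can be matched, so its length differs from `p`
      -- just as the two sizes of the exceptional class differ.
      simClass̄ : List (Fin m)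
      simClass̄ = map proj₂ pe ++ cls̄ z₀

      simClass̄-unique : Unique simClass̄
      simClass̄-unique = Uniqueₚ.++⁺ (AllPairsₚ.map⁺ (AllPairs.map proj₂ (proj₁ pe-good))) (cls̄-unique z₀) λ where
        (y∈ , y∈′) → let ((x , y) , xy∈ , e) = ∈-map⁻ proj₂ y∈ in
          proj₂ (pe-from xy∈) (≈-trans (∈-cls̄⁻ y∈′) (≈-sym (subst (λ z → x ≈ μ z) (sym e) (proj₂ pe-good xy∈))))

      simClass̄-sim : ∀ {y} → y ∈ simClass̄ → Sim N y₀ y
      simClass̄-sim {y} y∈ with ∈-++⁻ (map proj₂ pe) y∈
      ... | inj₂ y∈′ = cls̄-sim y∈′
      ... | inj₁ y∈′ with ∈-map⁻ proj₂ y∈′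
      ...   | (x , _) , xy∈ , refl = simN⇐M z₀y₀ x≈ (λ { refl → proj₂ (pe-from xy∈) ≈-refl })
              (λ { refl → proj₂ (pe-from xy∈) (≈-trans z₀y₀ (≈-sym x≈)) }) (proj₁ (pe-from xy∈))
        where
        x≈ : x ≈ μ y
        x≈ = proj₂ pe-good xy∈

      length-pe : length pe ≡ length extras
      length-pe = ℕₚ.≤-antisym
        (ℕₚ.≤-trans (ℕₚ.≤-reflexive (sym (length-map proj₁ pe)))
          (unique-⊆⇒length≤ (AllPairsₚ.map⁺ (AllPairs.map proj₁ (proj₁ pe-good))) λ x∈ →
            let ((x , y) , xy∈ , e) = ∈-map⁻ proj₁ x∈ in
            subst (_∈ extras) (sym e) (∈-filter⁺ extra? (∈-allFin x) (pe-from xy∈))))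
        (ℕₚ.≤-trans (unique-⊆⇒length≤ (filter-allFin extra?) λ x∈ → ∈-map⁺ proj₁ (proj₂ (pe-cov x∈)))
          (ℕₚ.≤-reflexive (length-map proj₁ pe)))

      length-simClass : p ≡ length extras + length (cls z₀)
      length-simClass = trans p≡ (ℕₚ.≤-antisym
        (ℕₚ.≤-trans (unique-⊆⇒length≤ (filter-allFin (sim? M z₀)) sub) (ℕₚ.≤-reflexive (length-++ extras)))
        (ℕₚ.≤-trans (ℕₚ.≤-reflexive (sym (length-++ extras)))
          (unique-⊆⇒length≤ (Uniqueₚ.++⁺ (filter-allFin extra?) (cls-unique z₀)
             (λ (x∈ , x∈′) → proj₂ (proj₂ (∈-filter⁻ extra? {xs = allFin n} x∈)) (∈-cls⁻ x∈′))) sup)))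
        where
        sub : simClass ⊆ extras ++ cls z₀
        sub {x} x∈ with ≈? z₀ x
        ... | yes e = ∈-++⁺ʳ extras (∈-cls⁺ e)
        ... | no ≉ = ∈-++⁺ˡ (∈-filter⁺ extra? (∈-allFin x) (proj₂ (∈-filter⁻ (sim? M z₀) {xs = allFin n} x∈) , ≉))
        sup : extras ++ cls z₀ ⊆ simClass
        sup {x} x∈ with ∈-++⁻ extras x∈
        ... | inj₁ p = ∈-filter⁺ (sim? M z₀) (∈-allFin x) (proj₁ (proj₂ (∈-filter⁻ extra? {xs = allFin n} p)))
        ... | inj₂ p = ∈-filter⁺ (sim? M z₀) (∈-allFin x) (homogeneous (∈-cls⁻ p))

      length-simClass̄ : length simClass̄ ≡ length extras + length (cls̄ z₀)
      length-simClass̄ = trans (length-++ (map proj₂ pe)) (cong (_+ length (cls̄ z₀)) (trans (length-map proj₂ pe) length-pe))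

      classSize-lower : ∀ {x₀} xs → Unique xs → (∀ {x} → x ∈ xs → Sim M x₀ x) → length xs ≤ classSize M x₀
      classSize-lower {x₀} xs u ok = unique-⊆⇒length≤ u λ {x} x∈ → ∈-filter⁺ (sim? M x₀) (∈-allFin x) (ok x∈)

      classSize≤p : ∀ x → classSize M x ≤ p
      classSize≤p x with sim? M z₀ x
      ... | no ≁ = ℕₚ.<⇒≤ (largest x ≁)
      ... | yes ∼ = ℕₚ.≤-trans (classSize-lower {z₀} (filter (sim? M x) (allFin n)) (filter-allFin (sim? M x)) λ x′∈ →
              Sim-trans {M = M} ∼ (proj₂ (∈-filter⁻ (sim? M x) {xs = allFin n} x′∈))) (ℕₚ.≤-reflexive (sym p≡))

    private
      -- After `p + 1` similar elements have been played in `N`, `q` rounds are left for the change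
      -- to `M`, where `sim-game-E` makes the answers similar. No `∼`-class of `M` is that large.
      star-bound : ∀ b₀ bs → Unique (b₀ ∷ bs) → (∀ {b} → b ∈ b₀ ∷ bs → Sim N b₀ b) → length bs ≢ p
      star-bound b₀ bs u star len = bound (playʳ (H A) proj₂ (b₀ ∷ bs) {q} (subst (λ z → H A z []) (trans (ℕₚ.+-suc p q) (cong (λ z → suc (z + q)) (sym len))) gameA))
        where
        bound : ¬ (∃ λ qs → map proj₂ qs ≡ b₀ ∷ bs × Played (H A q) [] qs)
        bound ([] , () , _)
        bound ((x₀ , y₀) ∷ qs , eq , ps′ , qs⊆ , _ , h) = ℕₚ.<-irrefl refl (ℕₚ.≤-trans (ℕₚ.≤-reflexive len′)
              (ℕₚ.≤-trans (classSize-lower {x₀} (x₀ ∷ map proj₁ qs) unique sims) (classSize≤p x₀)))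
          where
          g : G E q ps′
          g = H⇒G-swap A q h
          y₀≡b₀ : y₀ ≡ b₀
          y₀≡b₀ = ∷-injectiveˡ eq
          len′ : suc p ≡ suc (length (map proj₁ qs))
          len′ = cong suc (trans (sym len) (trans (cong length (sym (∷-injectiveʳ eq))) (trans (length-map proj₂ qs) (sym (length-map proj₁ qs)))))
          unique : Unique (x₀ ∷ map proj₁ qs)
          unique = Atomic-uniqueˡ ((x₀ , y₀) ∷ qs) (G⇒Atomic E q g) qs⊆ (subst Unique (sym eq) u)
          sims : ∀ {x} → x ∈ x₀ ∷ map proj₁ qs → Sim M x₀ x
          sims x∈ with ∈-map⁻ proj₁ {xs = (x₀ , y₀) ∷ qs} x∈
          ... | (x , y) , xy∈ , refl = sim-game-E g (qs⊆ (here refl)) (qs⊆ xy∈)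
                  (subst (λ z → Sim N z y) (sym y₀≡b₀) (star (subst (y ∈_) eq (∈-map⁺ proj₂ xy∈))))

    not-larger : length (cls̄ z₀) ≤ length (cls z₀)
    not-larger = ℕₚ.≮⇒≥ λ lt → too-many (take (suc p) simClass̄) (Uniqueₚ.take⁺ (suc p) simClass̄-unique)
        (simClass̄-sim ∘ ∈-take⁻ (suc p))
        (trans (length-take (suc p) simClass̄) (ℕₚ.m≤n⇒m⊓n≡m
          (ℕₚ.≤-trans (ℕₚ.≤-reflexive (trans (cong suc length-simClass) (sym (ℕₚ.+-suc (length extras) _))))
            (ℕₚ.≤-trans (ℕₚ.+-monoʳ-≤ (length extras) lt) (ℕₚ.≤-reflexive (sym length-simClass̄))))))
      where
      too-many : ∀ ys → Unique ys → (∀ {y} → y ∈ ys → Sim N y₀ y) → length ys ≢ suc p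
      too-many (b₀ ∷ bs) u ok len = star-bound b₀ bs u
        (λ b∈ → Sim-trans {M = N} (Sim-sym {M = N} (ok (here refl))) (ok b∈)) (ℕₚ.suc-injective len)

    private
     module Smaller (lt : length (cls̄ z₀) < length (cls z₀)) (qs : List (Fin n × Fin m)) (eq : map proj₁ qs ≡ simClass)
       (ps′ : List (Fin n × Fin m)) (qs⊆ : qs ⊆ ps′) (h : H E (suc q) ps′) where
      g : G A q ps′
      g = G-mono A (ℕₚ.n≤1+n q) (H⇒G-swap E (suc q) h)
      abstract
        z₀-answer : ∃ λ b → (z₀ , b) ∈ qs
        z₀-answer with ∈-map⁻ proj₁ (subst (z₀ ∈_) (sym eq) (∈-filter⁺ (sim? M z₀) (∈-allFin z₀) (Sim-refl {M = M})))
        ... | (_ , b) , p , refl = b , p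
      b₀ = proj₁ z₀-answer
      ys = map proj₂ qs
      ys-unique : Unique ys
      ys-unique = Atomic-uniqueʳ qs (G⇒Atomic A q g) qs⊆ (subst Unique (sym eq) (filter-allFin (sim? M z₀)))
      length-ys : length ys ≡ p
      length-ys = trans (length-map proj₂ qs) (trans (sym (length-map proj₁ qs)) (trans (cong length eq) (sym p≡)))
      ys-sim : ∀ {y} → y ∈ ys → Sim N b₀ y
      ys-sim y∈ with ∈-map⁻ proj₂ y∈
      ... | (x , _) , xy∈ , refl = sim-game-A g (qs⊆ (proj₂ z₀-answer)) (qs⊆ xy∈)
              (proj₂ (∈-filter⁻ (sim? M z₀) {xs = allFin n} (subst (x ∈_) eq (∈-map⁺ proj₁ xy∈))))
      -- Here all `p` answers would lie in `simClass̄`, which is shorter than `p` by `lt`. Indeed,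
      -- an answer `b` outside the exceptional class has `μ b` in `extras`; the class of `μ b` is a
      -- singleton on both sides, so `b` is the partner recorded in `pe`.
      case₁ : ¬ Sim N y₀ b₀
      case₁ s = ℕₚ.<⇒≱ (ℕₚ.≤-trans (ℕₚ.≤-reflexive (trans (cong suc length-simClass̄) (sym (ℕₚ.+-suc (length extras) _))))
            (ℕₚ.≤-trans (ℕₚ.+-monoʳ-≤ (length extras) lt) (ℕₚ.≤-reflexive (trans (sym length-simClass) (sym length-ys)))))
          (unique-⊆⇒length≤ ys-unique sub)
        where
        sub : ys ⊆ simClass̄
        sub {b} b∈ with ≈? z₀ (μ b)
        ... | yes e = ∈-++⁺ʳ (map proj₂ pe) (∈-cls̄⁺ e)
        ... | no ≉ = ∈-++⁺ˡ (subst (_∈ map proj₂ pe) (sym b≡) (∈-map⁺ proj₂ (proj₂ answer)))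
          where
          sim : Sim M z₀ (μ b)
          sim = simM⇐N z₀y₀ ≈-refl (λ e → ≉ (subst (z₀ ≈_) e ≈-refl)) (λ { refl → ≉ z₀y₀ })
                  (Sim-trans {M = N} s (ys-sim b∈))
          abstract
           answer : ∃ λ y → (μ b , y) ∈ pe
           answer = pe-cov (∈-filter⁺ extra? (∈-allFin (μ b)) (sim , ≉))
          b≡ : b ≡ proj₁ answer
          b≡ = short-≡ {xs = cls̄ (μ b)} (ℕₚ.≤-trans (ℕₚ.≤-reflexive (others-balanced (μ b) ≉))
                 (unique-⊆⇒length≤ {ys = μ b ∷ []} (cls-unique (μ b)) λ x∈ → here (sym (singletons sim ≉ (∈-cls⁻ x∈)))))
                 (∈-cls̄⁺ ≈-refl) (∈-cls̄⁺ (proj₂ pe-good (proj₂ answer)))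
      -- Now no answer lies in the exceptional class, so all of them can be matched back into
      -- balanced classes of `M`. This gives `p` similar elements outside the `∼`-class of `z₀`; it
      -- is here that `largest` has to be strict.
      case₂ : ¬ ¬ Sim N y₀ b₀
      case₂ ns = ℕₚ.<⇒≱ (largest x₀ x₀≁) (ℕₚ.≤-trans (ℕₚ.≤-reflexive (sym length-ys))
          (ℕₚ.≤-trans (unique-⊆⇒length≤ ys-unique (λ y∈ → ∈-map⁺ proj₁ (proj₂ (cov y∈))))
            (ℕₚ.≤-trans (ℕₚ.≤-reflexive (trans (length-map proj₁ ps) (sym (length-map proj₂ ps))))
              (classSize-lower (map proj₂ ps) (AllPairsₚ.map⁺ (AllPairs.map proj₂ (proj₁ good))) sims))))
        where
        unexceptional : ∀ {y} → y ∈ ys → ¬ z₀ ≈ μ y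
        unexceptional y∈ e = ns (Sim-trans {M = N} (cls̄-sim (∈-cls̄⁺ e)) (Sim-sym {M = N} (ys-sim y∈)))
        abstract
          extension : ∃ λ ps → Back.Good ps × (∀ {y} → y ∈ ys → ∃ λ x → (y , x) ∈ ps) × (∀ {y x} → (y , x) ∈ ps → y ∈ ys)
          extension =
            let (ps , _ , good , cov , from) = Back.extend (length ys) ys [] ([] , λ ())
                  (λ {y} y∈ → back-fresh (others-balanced (μ y) (unexceptional y∈))) ℕₚ.≤-refl
            in ps , good , cov , λ yx∈ → [ (λ ()) , id ]′ (from yx∈)
        ps : List (Fin m × Fin n)
        ps = proj₁ extension
        good : Back.Good ps
        good = proj₁ (proj₂ extension)
        cov : ∀ {y} → y ∈ ys → ∃ λ x → (y , x) ∈ ps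
        cov = proj₁ (proj₂ (proj₂ extension))
        b₀∈ : b₀ ∈ ys
        b₀∈ = ∈-map⁺ proj₂ (proj₂ z₀-answer)
        x₀ = proj₁ (cov b₀∈)
        x₀∈ : (b₀ , x₀) ∈ ps
        x₀∈ = proj₂ (cov b₀∈)
        x₀≁ : ¬ Sim M z₀ x₀
        x₀≁ s = ns (simN⇐M z₀y₀ (proj₂ good x₀∈) (λ e → unexceptional b₀∈ (subst (_≈ μ b₀) (sym e) (proj₂ good x₀∈)))
                  (λ e → unexceptional b₀∈ (subst (λ y → z₀ ≈ μ y) e z₀y₀)) s)
        sims : ∀ {x} → x ∈ map proj₂ ps → Sim M x₀ x
        sims x∈ with ∈-map⁻ proj₂ x∈
        ... | (y , x) , yx∈ , refl with b₀ ≟ y | proj₂ (proj₂ (proj₂ extension)) yx∈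
        ...   | yes eq | _ = subst (Sim M x₀) (proj₁ (Back.Distinct-functional (proj₁ good) x₀∈ yx∈) eq) (Sim-refl {M = M})
        ...   | no ne | y∈ = simM⇐N (proj₂ good x₀∈) (proj₂ good yx∈)
                  (ne ∘ proj₂ (Back.Distinct-functional (proj₁ good) x₀∈ yx∈)) ne (ys-sim y∈)


    not-smaller : length (cls z₀) ≤ length (cls̄ z₀)
    not-smaller = ℕₚ.≮⇒≥ λ lt →
      let (qs , eq , ps′ , qs⊆ , _ , h) = playˡ (H E) proj₂ simClass {suc q} (subst (λ z → H E (z + suc q) []) p≡ gameE)
          open Smaller lt qs eq ps′ qs⊆ h
      in case₂ case₁

    all-balanced : ∀ x → Balanced x
    all-balanced x with ≈? z₀ x
    ... | no ≉ = others-balanced x ≉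
    ... | yes e = trans (ℕₚ.≤-antisym
            (unique-⊆⇒length≤ (cls̄-unique x) (λ y∈ → ∈-cls̄⁺ (≈-trans e (∈-cls̄⁻ y∈))))
            (unique-⊆⇒length≤ (cls̄-unique z₀) (λ y∈ → ∈-cls̄⁺ (≈-trans (≈-sym e) (∈-cls̄⁻ y∈)))))
          (trans (ℕₚ.≤-antisym not-larger not-smaller) (ℕₚ.≤-antisym
            (unique-⊆⇒length≤ (cls-unique z₀) (λ y∈ → ∈-cls⁺ (≈-trans (≈-sym e) (∈-cls⁻ y∈))))
            (unique-⊆⇒length≤ (cls-unique x) (λ y∈ → ∈-cls⁺ (≈-trans e (∈-cls⁻ y∈))))))

-- Construction of the tower

length≤1+filter : ∀ {X : Set} {_R_ : X → X → Set} {P : X → Set} (P? : ∀ x → Dec (P x)) {xs} → AllPairs _R_ xs →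
                  (∀ {x y} → ¬ P x → ¬ P y → ¬ (x R y)) → length xs ≤ suc (length (filter P? xs))
length≤1+filter P? [] h = z≤n
length≤1+filter P? {x ∷ xs} (rs ∷ prs) h with P? x
... | yes _ = s≤s (length≤1+filter P? prs h)
... | no ¬px = s≤s (ℕₚ.≤-reflexive (cong length (sym (filter-all P? (All.map (λ {y} r → decidable-stable (P? y) λ ¬py → h ¬px ¬py r) rs)))))

lists : ∀ {n} → ℕ → List (List (Fin n))
lists zero = [] ∷ []
lists {n} (suc l) = [] ∷ concatMap (λ x → map (x ∷_) (lists l)) (allFin n)

∈-lists : ∀ {n} {l} (xs : List (Fin n)) → length xs ≤ l → xs ∈ lists l
∈-lists {l = zero} [] _ = here refl
∈-lists {l = suc l} [] _ = here refl
∈-lists {l = suc l} (x ∷ xs) (s≤s le) = there (∈-concatMap⁺ _ (lose (∈-allFin x) (∈-map⁺ _ (∈-lists xs le))))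

relabel : ∀ {n} → Fin n → Fin n → Fin (suc n) → Fin (suc n)
relabel x x′ zero = zero
relabel x x′ (suc u) with u ≟ x
... | yes _ = suc x′
... | no _ = suc u

relabel-≡ : ∀ {n} (x x′ : Fin n) → relabel x x′ (suc x) ≡ suc x′
relabel-≡ x x′ with x ≟ x
... | yes _ = refl
... | no ne = contradiction refl ne

relabel-≢ : ∀ {n} {x x′ u : Fin n} → u ≢ x → relabel x x′ (suc u) ≡ suc u
relabel-≢ {x = x} {u = u} ne with u ≟ x
... | yes e = contradiction e ne
... | no _ = refl

transpose-ins : ∀ {n} {x x′ c : Fin n} → c ≢ x → c ≢ x′ → ∀ d → (∀ {u} → d ≡ suc u → u ≢ x → x′ ≢ u) →
                transpose x x′ (ins c id d) ≡ ins c id (relabel x x′ d)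
transpose-ins c≢x c≢x′ zero _ = transpose-other c≢x c≢x′
transpose-ins {x = x} {x′} {c} c≢x c≢x′ (suc u) unused = go (u ≟ x)
  where
  go : Dec (u ≡ x) → transpose x x′ u ≡ ins c id (relabel x x′ (suc u))
  go (yes refl) = trans (transpose-left x x′) (cong (ins c id) (sym (relabel-≡ x x′)))
  go (no u≢x) = trans (transpose-other u≢x (≢-sym (unused refl u≢x))) (cong (ins c id) (sym (relabel-≢ u≢x)))

module Construction {L : Vocab} {n : ℕ} (M : Structure L n) (q : ℕ) (arity≤ : ∀ i → arity L i ≤ suc q) where
  open Types M

  -- Naming only elements of V₀ keeps the ∼-classes not swallowed by K almost disjoint from K.
  record Sparse : Set where
    field
      V₀     : List (Fin n)
      sparse : ∀ a {xs} → Unique xs → xs ⊆ V₀ → (∀ {x} → x ∈ xs → Sim M a x) → length xs ≤ 2 + q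
      full   : ∀ v → v ∈ V₀ ⊎ ∃ λ xs → Unique xs × xs ⊆ V₀ × (∀ {x} → x ∈ xs → Sim M v x) × 2 + q ≤ length xs

  sparseSet : Sparse
  sparseSet = record { V₀ = proj₁ built ; sparse = proj₁ (proj₂ (proj₂ built)) ; full = full }
    where
    SparseFor : List (Fin n) → Set
    SparseFor V = ∀ a {xs} → Unique xs → xs ⊆ V → (∀ {x} → x ∈ xs → Sim M a x) → length xs ≤ 2 + q
    within : Fin n → List (Fin n) → List (Fin n)
    within v V = filter (sim? M v) V
    build : ∀ vs → ∃ λ V → Unique V × SparseFor V × (∀ {v} → v ∈ vs → v ∈ V ⊎ 2 + q ≤ length (within v V))
    build [] = [] , [] , (λ { _ {[]} _ _ _ → z≤n ; _ {x ∷ _} _ sub _ → contradiction (sub (here refl)) λ () }) , λ ()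
    build (v ∷ vs) with build vs
    ... | V , u , sp , fl with v ∈? V | 2 + q ℕₚ.≤? length (within v V)
    ...   | yes v∈ | _ = V , u , sp , λ { (here refl) → inj₁ v∈ ; (there p) → fl p }
    ...   | no _ | yes le = V , u , sp , λ { (here refl) → inj₂ le ; (there p) → fl p }
    ...   | no v∉ | no nle = v ∷ V , All.tabulate (λ { x∈ refl → v∉ x∈ }) ∷ u , sp′ ,
            λ { (here refl) → inj₁ (here refl) ; (there p) → [ inj₁ ∘ there , (λ le → inj₂ (ℕₚ.≤-trans le (grow _))) ]′ (fl p) }
      where
      grow : ∀ w → length (within w V) ≤ length (within w (v ∷ V))
      grow w = unique-⊆⇒length≤ (Uniqueₚ.filter⁺ (sim? M w) u) λ x∈ →
        let (x∈V , sim) = ∈-filter⁻ (sim? M w) {xs = V} x∈ in ∈-filter⁺ (sim? M w) (there x∈V) sim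
      sp′ : SparseFor (v ∷ V)
      sp′ a {xs} ux sub ok with v ∈? xs
      ... | no v∉xs = sp a ux (λ x∈ → case sub x∈ of λ { (here refl) → contradiction x∈ v∉xs ; (there p) → p }) ok
      ... | yes v∈xs = ℕₚ.≤-trans (length≤1+filter ≢v? ux λ nx ny x≢y → x≢y (trans (decidable-stable (_ ≟ _) nx) (sym (decidable-stable (_ ≟ _) ny))))
              (ℕₚ.≤-trans (s≤s (unique-⊆⇒length≤ (Uniqueₚ.filter⁺ ≢v? ux) sub′)) (ℕₚ.≰⇒> nle))
        where
        ≢v? = λ x → ¬? (x ≟ v)
        sub′ : filter ≢v? xs ⊆ within v V
        sub′ x∈ with ∈-filter⁻ ≢v? {xs = xs} x∈
        ... | x∈xs , x≢v = ∈-filter⁺ (sim? M v) (case sub x∈xs of λ { (here e) → contradiction e x≢v ; (there p) → p })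
                (Sim-trans {M = M} (Sim-sym {M = M} (ok v∈xs)) (ok x∈xs))
    built = build (allFin n)
    full : ∀ v → v ∈ proj₁ built ⊎ ∃ λ xs → Unique xs × xs ⊆ proj₁ built × (∀ {x} → x ∈ xs → Sim M v x) × 2 + q ≤ length xs
    full v with proj₂ (proj₂ (proj₂ built)) (∈-allFin v)
    ... | inj₁ p = inj₁ p
    ... | inj₂ le = inj₂ (within v (proj₁ built) , Uniqueₚ.filter⁺ (sim? M v) (proj₁ (proj₂ built)) ,
            (λ x∈ → proj₁ (∈-filter⁻ (sim? M v) x∈)) , (λ x∈ → proj₂ (∈-filter⁻ (sim? M v) {xs = proj₁ built} x∈)) , le)

  module _ (sparseV : Sparse) where
    open Sparse sparseV

    -- A separating tuple containing x can be moved, by a transposition of similar elements, to one avoiding x.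
    replace : ∀ {a b x rest} → a ≢ x → b ≢ x → x ∉ V₀ → ¬ TE (x ∷ rest) a b →
              ¬ TE rest a b ⊎ ∃ λ x′ → x′ ∈ V₀ × Sim M x x′ × x′ ≢ a × x′ ≢ b × ¬ TE (x′ ∷ rest) a b
    replace {a} {b} {x} {rest} a≢x b≢x x∉V₀ ¬te with te? rest a b
    ... | no ¬r = inj₁ ¬r
    ... | yes r with full x
    ...   | inj₁ x∈ = contradiction x∈ x∉V₀
    ...   | inj₂ (xs , u , xs⊆ , sims , many) with Any.any? (λ x′ → ¬? (x′ ≟ a) ×-dec ¬? (x′ ≟ b) ×-dec ¬? (te? (x′ ∷ rest) a b)) xs
    ...     | yes p = let (x′ , x′∈ , ≢a , ≢b , ¬te′) = find p in inj₂ (x′ , xs⊆ x′∈ , sims x′∈ , ≢a , ≢b , ¬te′)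
    ...     | no none = contradiction te ¬te
      where
      te : TE (x ∷ rest) a b
      te i p over with any? (λ e → p e ≟ suc x) | any? (λ e → p e ≟ zero)
      ... | no ¬x | _ = r i p λ e → drop (p e) (over e) (λ eq → ¬x (e , eq))
        where
        drop : ∀ c → Over (x ∷ rest) c → c ≢ suc x → Over rest c
        drop zero _ _ = tt
        drop (suc u) (here refl) ne = contradiction refl ne
        drop (suc u) (there u∈) _ = u∈
      ... | yes _ | no ¬hole = relᶠ-cong M i λ e → same (p e) (λ eq → ¬hole (e , eq))
        where
        same : ∀ c → c ≢ zero → ins a id c ≡ ins b id c
        same zero ne = contradiction refl ne
        same (suc u) _ = refl
      ... | yes (eₓ , isx) | yes (e₀ , hole) = begin
        relᶠ M i (ins a id ∘ p)                    ≡⟨ Sim⇒Simᶠ {M = M} (sims x′∈) i (ins a id ∘ p) ⟨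
        relᶠ M i (transpose x x′ ∘ ins a id ∘ p)   ≡⟨ relᶠ-cong M i (λ e → transpose-ins a≢x (≢-sym x′≢a) (p e) (x′-unused {e})) ⟩
        relᶠ M i (ins a id ∘ relabel x x′ ∘ p)             ≡⟨ te′ i (relabel x x′ ∘ p) (λ e → move-over (p e) (over e)) ⟩
        relᶠ M i (ins b id ∘ relabel x x′ ∘ p)             ≡⟨ relᶠ-cong M i (λ e → transpose-ins b≢x (≢-sym x′≢b) (p e) (x′-unused {e})) ⟨
        relᶠ M i (transpose x x′ ∘ ins b id ∘ p)   ≡⟨ Sim⇒Simᶠ {M = M} (sims x′∈) i (ins b id ∘ p) ⟩
        relᶠ M i (ins b id ∘ p)                    ∎
        where
        open ≡-Reasoning
        nonhole? = λ (c : Fin (suc n)) → ¬? (c ≟ zero)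
        nonx? = λ (c : Fin (suc n)) → ¬? (c ≟ suc x)
        entries = tabulate p
        cs = filter nonx? (filter nonhole? entries)
        used = map (ins a id) cs
        -- The hole and `x` take two of at most `q + 1` positions, leaving at most `q - 1` others.
        -- Together with `a` and `b` there are at most `q + 1` elements to avoid, whence the number
        -- `2 + q` in `Sparse`.
        used-short : 2 + length used ≤ suc q
        used-short = ℕₚ.≤-trans (ℕₚ.≤-reflexive (cong (λ z → 2 + z) (length-map (ins a id) cs)))
          (ℕₚ.≤-trans (s≤s (filter-notAll nonx? (filter nonhole? entries)
              (lose (∈-filter⁺ nonhole? (subst (_∈ entries) isx (∈-tabulate⁺ {f = p} eₓ)) λ ()) (λ ne → ne refl))))
            (ℕₚ.≤-trans (filter-notAll nonhole? entries (lose (subst (_∈ entries) hole (∈-tabulate⁺ {f = p} e₀)) (λ ne → ne refl)))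
              (subst (_≤ suc q) (sym (length-tabulate p)) (arity≤ i))))
        abstract
          picked : ∃ λ y → y ∈ xs × y ∉ a ∷ b ∷ used
          picked = pick-fresh xs (a ∷ b ∷ used) u (ℕₚ.≤-trans (s≤s used-short) many)
        x′ : Fin n
        x′ = proj₁ picked
        x′∈ : x′ ∈ xs
        x′∈ = proj₁ (proj₂ picked)
        x′≢a : x′ ≢ a
        x′≢a e = proj₂ (proj₂ picked) (here e)
        x′≢b : x′ ≢ b
        x′≢b e = proj₂ (proj₂ picked) (there (here e))
        x′-unused : ∀ {e u} → p e ≡ suc u → u ≢ x → x′ ≢ u
        x′-unused {e} {u} eq u≢x refl = proj₂ (proj₂ picked) (there (there (∈-map⁺ (ins a id)
          (∈-filter⁺ nonx? (∈-filter⁺ nonhole? (subst (_∈ entries) eq (∈-tabulate⁺ {f = p} e)) λ ()) (u≢x ∘ suc-injective)))))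
        te′ : TE (x′ ∷ rest) a b
        te′ = decidable-stable (te? (x′ ∷ rest) a b) λ ¬te′ → none (lose x′∈ (x′≢a , x′≢b , ¬te′))
        move-over : ∀ c → Over (x ∷ rest) c → Over (x′ ∷ rest) (relabel x x′ c)
        move-over zero _ = tt
        move-over (suc u) o with u ≟ x
        ... | yes _ = here refl
        move-over (suc u) (here e) | no ne = contradiction e ne
        move-over (suc u) (there o) | no ne = there o

    -- A separating set is moved into `V₀` element by element, using `replace` where necessary;
    -- `done` holds the part already moved. The recorded similarity later shows that the new
    -- elements realise large types, as the old ones did.
    prune : ∀ {a b} K (todo done : List (Fin n)) → a ∉ todo → b ∉ todo → a ∉ done → b ∉ done →
      (∀ {s} → s ∈ done → s ∈ V₀ × s ∉ K) → ¬ TE (todo ++ done ++ K) a b →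
      ∃ λ S → length S ≤ length todo + length done × a ∉ S × b ∉ S × (∀ {s} → s ∈ S → s ∈ V₀ × s ∉ K) ×
        (∀ {s} → s ∈ S → s ∈ done ⊎ ∃ λ s₀ → s₀ ∈ todo × Sim M s₀ s) × ¬ TE (S ++ K) a b
    prune K [] done a∉ b∉ a∉′ b∉′ ok ¬te = done , ℕₚ.≤-refl , a∉′ , b∉′ , ok , inj₁ , ¬te
    prune {a} {b} K (x ∷ todo) done a∉ b∉ a∉′ b∉′ ok ¬te = cases
      where
      Result = ∃ λ S → length S ≤ length (x ∷ todo) + length done × a ∉ S × b ∉ S × (∀ {s} → s ∈ S → s ∈ V₀ × s ∉ K) ×
        (∀ {s} → s ∈ S → s ∈ done ⊎ ∃ λ s₀ → s₀ ∈ x ∷ todo × Sim M s₀ s) × ¬ TE (S ++ K) a b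
      drop : ¬ TE (todo ++ done ++ K) a b → Result
      drop ¬te′ with prune K todo done (a∉ ∘ there) (b∉ ∘ there) a∉′ b∉′ ok ¬te′
      ... | S , len , aS , bS , okS , from , ¬teS = S , ℕₚ.m≤n⇒m≤1+n len , aS , bS , okS ,
            (λ s∈ → [ inj₁ , (λ (s₀ , s₀∈ , sim) → inj₂ (s₀ , there s₀∈ , sim)) ]′ (from s∈)) , ¬teS
      shuffle : ∀ {y} → y ∷ todo ++ done ++ K ⊆ todo ++ (y ∷ done) ++ K
      shuffle (here e) = ∈-++⁺ʳ todo (here e)
      shuffle (there p) with ∈-++⁻ todo p
      ... | inj₁ q = ∈-++⁺ˡ q
      ... | inj₂ q = ∈-++⁺ʳ todo (there q)
      keep : ∀ y → y ∈ V₀ → y ≢ a → y ≢ b → Sim M x y → ¬ TE (y ∷ todo ++ done ++ K) a b → Result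
      keep y y∈ y≢a y≢b sim ¬te′ with y ∈? K
      ... | yes y∈K = drop λ te → ¬te′ (TE-mono (λ { (here refl) → ∈-++⁺ʳ todo (∈-++⁺ʳ done y∈K) ; (there p) → p }) te)
      ... | no y∉K with prune K todo (y ∷ done) (a∉ ∘ there) (b∉ ∘ there)
                          (λ { (here e) → y≢a (sym e) ; (there p) → a∉′ p }) (λ { (here e) → y≢b (sym e) ; (there p) → b∉′ p })
                          (λ { (here refl) → y∈ , y∉K ; (there p) → ok p }) (λ te → ¬te′ (TE-mono shuffle te))
      ...   | S , len , aS , bS , okS , from , ¬teS = S , ℕₚ.≤-trans len (ℕₚ.≤-reflexive (ℕₚ.+-suc _ _)) , aS , bS , okS ,
              (λ s∈ → [ (λ { (here refl) → inj₂ (x , here refl , sim) ; (there p) → inj₁ p }) ,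
                        (λ (s₀ , s₀∈ , sim′) → inj₂ (s₀ , there s₀∈ , sim′)) ]′ (from s∈)) , ¬teS
      cases : Result
      cases with x ∈? V₀
      ... | yes x∈ = keep x x∈ (λ e → a∉ (here (sym e))) (λ e → b∉ (here (sym e))) (Sim-refl {M = M}) ¬te
      ... | no x∉ with replace (λ e → a∉ (here e)) (λ e → b∉ (here e)) x∉ ¬te
      ...   | inj₁ ¬te′ = drop ¬te′
      ...   | inj₂ (x′ , x′∈ , sim , ≢a , ≢b , ¬te′) = keep x′ x′∈ ≢a ≢b sim ¬te′

-- Equality of types compares a tuple through `a` with the one in which `a` is replaced by `b`,
-- whereas similarity exchanges the two. This is the replacement; it agrees with the exchange on
-- tuples omitting `b`.
redirect : ∀ {n} → Fin n → Fin n → Fin n → Fin n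
redirect a b c with c ≟ a
... | yes _ = b
... | no _ = c

redirect-≡ : ∀ {n} (a b : Fin n) → redirect a b a ≡ b
redirect-≡ a b with a ≟ a
... | yes _ = refl
... | no ne = contradiction refl ne

redirect-≢ : ∀ {n} {a b c : Fin n} → c ≢ a → redirect a b c ≡ c
redirect-≢ {a = a} {c = c} ne with c ≟ a
... | yes e = contradiction e ne
... | no _ = refl

transpose-redirect : ∀ {n} {a b u : Fin n} → u ≢ b → redirect a b u ≡ transpose a b u
transpose-redirect {a = a} {b} {u} u≢b with transposeView a b u
... | left refl e = trans (redirect-≡ a b) (sym e)
... | right refl _ = contradiction refl u≢b
... | other u≢a _ e = trans (redirect-≢ u≢a) (sym e)

transpose-redirectʳ : ∀ {n} {a b u : Fin n} → u ≢ a → redirect b a u ≡ transpose a b u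
transpose-redirectʳ {a = a} {b} {u} u≢a with transposeView a b u
... | left refl _ = contradiction refl u≢a
... | right refl e = trans (redirect-≡ b a) (sym e)
... | other _ u≢b e = trans (redirect-≢ u≢b) (sym e)

transpose-redirect³ : ∀ {n} {a b c u : Fin n} → c ≢ a → c ≢ b → u ≢ c → redirect c a (redirect a b (redirect b c u)) ≡ transpose a b u
transpose-redirect³ {a = a} {b} {c} {u} c≢a c≢b u≢c with u ≟ b | transposeView a b u
... | yes refl | _ = trans (cong (redirect c a) (redirect-≢ c≢a)) (trans (redirect-≡ c a) (sym (transpose-right a u)))
... | no u≢b | left refl e = trans (cong (redirect c a) (redirect-≡ a b)) (trans (redirect-≢ (≢-sym c≢b)) (sym e))
... | no u≢b | right refl _ = contradiction refl u≢b
... | no _ | other u≢a _ e = trans (cong (redirect c a) (redirect-≢ u≢a)) (trans (redirect-≢ u≢c) (sym e))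

filter-split-length : ∀ {X : Set} {P : X → Set} (P? : ∀ x → Dec (P x)) xs →
                      length (filter (¬? ∘ P?) xs) + length (filter P? xs) ≡ length xs
filter-split-length P? [] = refl
filter-split-length P? (x ∷ xs) with P? x
... | yes _ = trans (ℕₚ.+-suc _ _) (cong suc (filter-split-length P? xs))
... | no _ = cong suc (filter-split-length P? xs)

module Build {L : Vocab} {n : ℕ} (M : Structure L n) (q : ℕ) (arity≤ : ∀ i → arity L i ≤ suc q)
  (sparseV : Construction.Sparse M q arity≤) where
  open Types M
  open Construction M q arity≤ hiding (prune)
  open Sparse sparseV
  prune = Construction.prune M q arity≤ sparseV

  Separated : List (Fin n) → List (Fin n) → Set
  Separated K T = AllPairs (λ x y → ¬ TE K x y) T

  Separated⇒Unique : ∀ {K T} → Separated K T → Unique T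
  Separated⇒Unique = AllPairs.map λ { ¬te refl → ¬te TE-refl }

  separated : ∀ {K xs x y} → Separated K xs → x ∈ xs → y ∈ xs → TE K x y → x ≡ y
  separated (d ∷ ds) (here refl) (here refl) _ = refl
  separated (d ∷ ds) (here refl) (there p) te = contradiction te (All.lookup d p)
  separated (d ∷ ds) (there p) (here refl) te = contradiction (TE-sym te) (All.lookup d p)
  separated (d ∷ ds) (there p) (there p′) te = separated ds p p′ te

  -- Rp holds the one unnamed realisation of each rare type, T realises pairwise different types outside K.
  record Inv (K W Rp T : List (Fin n)) : Set where
    field
      W-bound   : length W + q ≤ q * (2 * length Rp + length T)
      W⊆K       : W ⊆ K
      Rp⊆K      : Rp ⊆ K
      Rp∉W      : ∀ {r} → r ∈ Rp → r ∉ W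
      Rp-unique : Unique Rp
      T-sep     : Separated K T
      T∉K       : ∀ {x} → x ∈ T → x ∉ K
      T-full    : ∀ {z} → z ∉ K → 1 ≤ length T
      classes   : ∀ a → (∀ {a′} → Sim M a a′ → a′ ∈ K → a′ ∈ V₀) ⊎
                  (∃ λ C → length C ≤ suc q × length C ≤ suc q * length Rp × (∀ {a′} → Sim M a a′ → a′ ∈ V₀ ⊎ a′ ∈ C))

  -- Only numbers of types are compared; `T′` need not extend `T`. The budget for `S` is one less
  -- than that for `D` in `swaps`, as one outside entry of the tuple becomes the hole.
  Maximal : ℕ → List (Fin n) → List (Fin n) → Set
  Maximal j K T = ∀ S T′ → length S + j ≤ q → (∀ {s} → s ∈ S → s ∈ V₀ × s ∉ K) → Separated (S ++ K) T′ →
                  (∀ {x} → x ∈ T′ → x ∉ S ++ K) → length T′ ≤ length T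

  record Saturated (j : ℕ) (K₁ Rp : List (Fin n)) : Set where
    field
      {K W T} : List (Fin n)
      inv     : Inv K W Rp T
      tower   : Tower q W j K₁
      K₁⊆K    : K₁ ⊆ K
      named   : ∀ {u} → u ∈ K → u ∈ K₁ ⊎ u ∈ W
      maximal : Maximal j K T

  -- Each enlargement names at most `q` elements and lengthens `T` by at least one, which is what
  -- `W-bound` allows. Separated lists have at most `n` elements, so the fuel suffices.
  saturate : ∀ {j K₁ Rp} fuel {K W T} → Inv K W Rp T → Tower q W j K₁ → K₁ ⊆ K → (∀ {u} → u ∈ K → u ∈ K₁ ⊎ u ∈ W) →
             n ≤ length T + fuel → Saturated j K₁ Rp
  saturate {j} {K₁} {Rp} fuel {K} {W} {T} inv tower K₁⊆K named le
    with Any.any? (λ S → Any.any? (λ T′ → (length S + j ℕₚ.≤? q) ×-dec (All.all? (λ s → (s ∈? V₀) ×-dec ¬? (s ∈? K)) S) ×-dec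
           (AllPairs.allPairs? (λ x y → ¬? (te? (S ++ K) x y)) T′) ×-dec All.all? (λ x → ¬? (x ∈? (S ++ K))) T′ ×-dec
           (length T ℕₚ.<? length T′)) (lists n)) (lists q)
  ... | no none = record { inv = inv ; tower = tower ; K₁⊆K = K₁⊆K ; named = named ; maximal = λ S T′ lS okS sep out →
          ℕₚ.≮⇒≥ λ lt → none (lose (∈-lists S (ℕₚ.≤-trans (ℕₚ.m≤m+n _ j) lS))
            (lose (∈-lists T′ (unique-length≤n (Separated⇒Unique sep))) (lS , All.tabulate okS , sep , All.tabulate out , lt))) }
  ... | yes p with find p
  ...   | S , _ , p′ with find p′
  ...     | T′ , _ , lS , okS , sep , out , lt with fuel
  ...       | zero = contradiction (unique-length≤n (Separated⇒Unique sep))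
                       (ℕₚ.<⇒≱ (ℕₚ.≤-<-trans (ℕₚ.≤-trans le (ℕₚ.≤-reflexive (ℕₚ.+-identityʳ _))) lt))
  ...       | suc fuel = saturate fuel inv′ (Tower-mono q (∈-++⁺ʳ S) tower) (∈-++⁺ʳ S ∘ K₁⊆K) named′
                           (ℕₚ.≤-trans le (ℕₚ.≤-trans (ℕₚ.≤-reflexive (ℕₚ.+-suc _ fuel)) (ℕₚ.+-monoˡ-≤ fuel lt)))
    where
    open Inv inv
    named′ : ∀ {u} → u ∈ S ++ K → u ∈ K₁ ⊎ u ∈ S ++ W
    named′ u∈ = [ inj₂ ∘ ∈-++⁺ˡ , (λ u∈K → [ inj₁ , inj₂ ∘ ∈-++⁺ʳ S ]′ (named u∈K)) ]′ (∈-++⁻ S u∈)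
    inv′ : Inv (S ++ K) (S ++ W) Rp T′
    inv′ = record
      { W-bound = begin
          length (S ++ W) + q              ≡⟨ cong (_+ q) (length-++ S) ⟩
          length S + length W + q          ≡⟨ ℕₚ.+-assoc (length S) (length W) q ⟩
          length S + (length W + q)        ≤⟨ ℕₚ.+-mono-≤ (ℕₚ.≤-trans (ℕₚ.m≤m+n _ j) lS) W-bound ⟩
          q + q * (2 * length Rp + length T)  ≡⟨ ℕₚ.*-suc q _ ⟨
          q * suc (2 * length Rp + length T)  ≡⟨ cong (q *_) (ℕₚ.+-suc (2 * length Rp) (length T)) ⟨
          q * (2 * length Rp + suc (length T))  ≤⟨ ℕₚ.*-monoʳ-≤ q (ℕₚ.+-monoʳ-≤ (2 * length Rp) lt) ⟩
          q * (2 * length Rp + length T′)  ∎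
      ; W⊆K = λ u∈ → [ ∈-++⁺ˡ , ∈-++⁺ʳ S ∘ W⊆K ]′ (∈-++⁻ S u∈)
      ; Rp⊆K = ∈-++⁺ʳ S ∘ Rp⊆K
      ; Rp∉W = λ r∈ r∈W → [ (λ r∈S → proj₂ (All.lookup okS r∈S) (Rp⊆K r∈)) , Rp∉W r∈ ]′ (∈-++⁻ S r∈W)
      ; Rp-unique = Rp-unique
      ; T-sep = sep
      ; T∉K = All.lookup out
      ; T-full = λ _ → ℕₚ.≤-trans (s≤s z≤n) lt
      ; classes = classes′
      }
      where
      open ℕₚ.≤-Reasoning
      classes′ : ∀ a → (∀ {a′} → Sim M a a′ → a′ ∈ S ++ K → a′ ∈ V₀) ⊎
        (∃ λ C → length C ≤ suc q × length C ≤ suc q * length Rp × (∀ {a′} → Sim M a a′ → a′ ∈ V₀ ⊎ a′ ∈ C))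
      classes′ a with classes a
      ... | inj₁ f = inj₁ λ sim a∈ → [ (λ a∈S → proj₁ (All.lookup okS a∈S)) , f sim ]′ (∈-++⁻ S a∈)
      ... | inj₂ c = inj₂ c

  module NextLayer {j K₁ Rp} (j<q : suc j ≤ q) (sat : Saturated j K₁ Rp) where
    open Saturated sat
    open Inv inv

    abstract
      cls : Fin n → List (Fin n)
      cls u = filter (λ v → ¬? (v ∈? K) ×-dec te? K u v) (allFin n)

      cls-unique : ∀ u → Unique (cls u)
      cls-unique u = filter-allFin (λ v → ¬? (v ∈? K) ×-dec te? K u v)

      ∈-cls⁺ : ∀ {u v} → v ∉ K → TE K u v → v ∈ cls u
      ∈-cls⁺ {u} {v} v∉ te = ∈-filter⁺ (λ v → ¬? (v ∈? K) ×-dec te? K u v) (∈-allFin v) (v∉ , te)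

      ∈-cls⁻ : ∀ {u v} → v ∈ cls u → v ∉ K × TE K u v
      ∈-cls⁻ {u} v∈ = proj₂ (∈-filter⁻ (λ v → ¬? (v ∈? K) ×-dec te? K u v) {xs = allFin n} v∈)

    -- The threshold guarantees a realisation outside any list of `q + 1` elements, as
    -- `relᶠ-transpose` demands. A rare type then has at most `q` realisations to be named besides
    -- its representative.
    Large : Fin n → Set
    Large u = suc q < length (cls u)

    large? : ∀ u → Dec (Large u)
    large? u = suc q ℕₚ.<? length (cls u)

    Large-resp : ∀ {u v} → TE K u v → Large u → Large v
    Large-resp {u} te lg = ℕₚ.≤-trans lg (unique-⊆⇒length≤ (cls-unique u) λ w∈ →
      let (w∉ , te′) = ∈-cls⁻ w∈ in ∈-cls⁺ w∉ (TE-trans (TE-sym te) te′))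

    small? : ∀ v → Dec (v ∉ K × ¬ Large v)
    small? v = ¬? (v ∈? K) ×-dec ¬? (large? v)

    abstract
      K′ : List (Fin n)
      K′ = K ++ filter small? (allFin n)

      K⊆K′ : K ⊆ K′
      K⊆K′ = ∈-++⁺ˡ

      small∈K′ : ∀ {u} → u ∉ K → ¬ Large u → u ∈ K′
      small∈K′ {u} u∉ ¬lg = ∈-++⁺ʳ K (∈-filter⁺ small? (∈-allFin u) (u∉ , ¬lg))

      K′⇒small : ∀ {u} → u ∈ K′ → u ∉ K → ¬ Large u
      K′⇒small u∈ u∉ = [ (λ p → contradiction p u∉) , (λ p → proj₂ (proj₂ (∈-filter⁻ small? {xs = allFin n} p))) ]′ (∈-++⁻ K u∈)

    ∉K′⁻ : ∀ {u} → u ∉ K′ → u ∉ K × Large u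
    ∉K′⁻ {u} u∉ = u∉ ∘ K⊆K′ , decidable-stable (large? u) λ ¬lg → u∉ (small∈K′ (u∉ ∘ K⊆K′) ¬lg)

    ∉K′⁺ : ∀ {u} → u ∉ K → Large u → u ∉ K′
    ∉K′⁺ u∉ lg u∈ = K′⇒small u∈ u∉ lg

    -- Otherwise `u` could be added to `T`, against maximality for empty `S`.
    representative : ∀ {u} → u ∉ K → ∃ λ r → r ∈ T × TE K r u
    representative {u} u∉ with Any.any? (λ r → te? K r u) T
    ... | yes p = find p
    ... | no none = contradiction
          (maximal [] (u ∷ T) (ℕₚ.<⇒≤ j<q) (λ ()) (All.tabulate (λ r∈ te → none (lose r∈ (TE-sym te))) ∷ T-sep)
            (λ { (here refl) → u∉ ; (there p) → T∉K p }))
          (ℕₚ.<⇒≱ ℕₚ.≤-refl)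

    -- Otherwise a, b and elements outside S of the other classes would form a longer separated list.
    no-split : ∀ {a b} S → a ∉ K → b ∉ K → TE K a b → (∀ {s} → s ∈ S → s ∉ K × Large s) → length S + j ≤ q →
               a ∉ S → b ∉ S → TE (S ++ K) a b
    no-split {a} {b} S₀ a∉ b∉ te okS₀ lS₀ a∉S₀ b∉S₀ = decidable-stable (te? (S₀ ++ K) a b) λ ¬te →
      contra (prune K S₀ [] a∉S₀ b∉S₀ (λ ()) (λ ()) (λ ()) ¬te)
      where
      contra : ¬ (∃ λ S → length S ≤ length S₀ + 0 × a ∉ S × b ∉ S × (∀ {s} → s ∈ S → s ∈ V₀ × s ∉ K) ×
        (∀ {s} → s ∈ S → s ∈ [] ⊎ ∃ λ s₀ → s₀ ∈ S₀ × Sim M s₀ s) × ¬ TE (S ++ K) a b)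
      contra (S , lS , a∉S , b∉S , okS , from , ¬te) = ℕₚ.<⇒≱ longer (maximal S T″ lS+j okS sep out)
        where
        lS≤ : length S ≤ length S₀
        lS≤ = ℕₚ.≤-trans lS (ℕₚ.≤-reflexive (ℕₚ.+-identityʳ _))
        lS+j : length S + j ≤ q
        lS+j = ℕₚ.≤-trans (ℕₚ.+-monoˡ-≤ j lS≤) lS₀
        largeS : ∀ {s} → s ∈ S → Large s
        largeS s∈ with from s∈
        ... | inj₂ (s₀ , s₀∈ , sim) = Large-resp (Sim⇒TE (proj₁ (okS₀ s₀∈)) (proj₂ (okS s∈)) sim) (proj₂ (okS₀ s₀∈))
        avoid : ∀ r → ∃ λ r′ → r ∉ K → TE K r r′ × r′ ∉ K × r′ ∉ S
        avoid r with r ∈? S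
        ... | no r∉S = r , λ r∉ → TE-refl , r∉ , r∉S
        ... | yes r∈S with pick-fresh (cls r) S (cls-unique r)
                (ℕₚ.≤-<-trans (ℕₚ.≤-trans (ℕₚ.m≤m+n _ j) lS+j) (ℕₚ.<-trans (ℕₚ.n<1+n q) (largeS r∈S)))
        ...   | r′ , r′∈ , r′∉S = r′ , λ _ → proj₂ (∈-cls⁻ r′∈) , proj₁ (∈-cls⁻ r′∈) , r′∉S
        ≢a? = λ r → ¬? (te? K a r)
        T₁ = filter ≢a? T
        T₁⊆ : ∀ {r} → r ∈ T₁ → r ∉ K × ¬ TE K a r
        T₁⊆ r∈ with ∈-filter⁻ ≢a? {xs = T} r∈
        ... | r∈T , ¬te = T∉K r∈T , ¬te
        T″ = a ∷ b ∷ map (proj₁ ∘ avoid) T₁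
        out : ∀ {x} → x ∈ T″ → x ∉ S ++ K
        out (here refl) p = [ a∉S , a∉ ]′ (∈-++⁻ S p)
        out (there (here refl)) p = [ b∉S , b∉ ]′ (∈-++⁻ S p)
        out (there (there x∈)) p with ∈-map⁻ (proj₁ ∘ avoid) x∈
        ... | r , r∈ , refl with proj₂ (avoid r) (proj₁ (T₁⊆ r∈))
        ...   | _ , ∉K , ∉S = [ ∉S , ∉K ]′ (∈-++⁻ S p)
        apart : ∀ {c} → TE K a c → ∀ {r} → r ∈ T₁ → ¬ TE (S ++ K) c (proj₁ (avoid r))
        apart ac {r} r∈ te′ = proj₂ (T₁⊆ r∈) (TE-trans ac (TE-trans (TE-mono (∈-++⁺ʳ S) te′) (TE-sym (proj₁ (proj₂ (avoid r) (proj₁ (T₁⊆ r∈)))))))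
        sepT₁ : ∀ {xs} → (∀ {r} → r ∈ xs → r ∉ K) → Separated K xs → Separated (S ++ K) (map (proj₁ ∘ avoid) xs)
        sepT₁ ∉K [] = []
        sepT₁ ∉K (d ∷ ds) = Allₚ.map⁺ (All.tabulate λ {r} r∈ te′ → All.lookup d r∈
            (TE-trans (proj₁ (proj₂ (avoid _) (∉K (here refl)))) (TE-trans (TE-mono (∈-++⁺ʳ S) te′) (TE-sym (proj₁ (proj₂ (avoid r) (∉K (there r∈))))))))
          ∷ sepT₁ (∉K ∘ there) ds
        sep : Separated (S ++ K) T″
        sep = (¬te ∷ Allₚ.map⁺ (All.tabulate (apart TE-refl))) ∷ Allₚ.map⁺ (All.tabulate (apart te)) ∷
              sepT₁ (proj₁ ∘ T₁⊆) (AllPairsₚ.filter⁺ ≢a? T-sep)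
        longer : length T < length T″
        longer = s≤s (ℕₚ.≤-trans
          (length≤1+filter ≢a? T-sep (λ {x} {y} nx ny ¬te → ¬te (TE-trans (TE-sym (decidable-stable (te? K a x) nx)) (decidable-stable (te? K a y) ny))))
          (s≤s (ℕₚ.≤-reflexive (sym (length-map (proj₁ ∘ avoid) T₁)))))

    module _ (i : Sym L) where

      record Covered (f : Fin (arity L i) → Fin n) (D : List (Fin n)) : Set where
        constructor covered
        field
          short   : length D + j ≤ suc q
          outside : ∀ {d} → d ∈ D → d ∉ K′
          covers  : ∀ e → f e ∈ K₁ ⊎ f e ∈ D

      redirect-covered : ∀ {a b f D} → a ∉ K′ → b ∉ K′ → Covered f D → Covered (redirect a b ∘ f) (map (redirect a b) D)
      redirect-covered {a} {b} {f} {D} a∉ b∉ (covered len D∉ cov) =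
        covered (ℕₚ.≤-trans (ℕₚ.≤-reflexive (cong (_+ j) (length-map (redirect a b) D))) len) D∉′ cov′
        where
        D∉′ : ∀ {d} → d ∈ map (redirect a b) D → d ∉ K′
        D∉′ d∈ with ∈-map⁻ (redirect a b) d∈
        ... | d , d∈D , refl with d ≟ a
        ...   | yes _ = b∉
        ...   | no _ = D∉ d∈D
        cov′ : ∀ e → redirect a b (f e) ∈ K₁ ⊎ redirect a b (f e) ∈ map (redirect a b) D
        cov′ e with cov e
        ... | inj₂ p = inj₂ (∈-map⁺ (redirect a b) p)
        ... | inj₁ p = inj₁ (subst (_∈ K₁) (sym (redirect-≢ (λ e → a∉ (K⊆K′ (K₁⊆K (subst (_∈ K₁) e p)))))) p)

      -- Once `a` is the hole, at most `q - j` further outside entries remain. They realise large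
      -- types, so `no-split` keeps `a` and `b` of equal type over them.
      relᶠ-redirect : ∀ {a b f D} → a ∉ K′ → b ∉ K′ → TE K a b → Covered f D → (∀ e → f e ≢ b) →
                      relᶠ M i (redirect a b ∘ f) ≡ relᶠ M i f
      relᶠ-redirect {a} {b} {f} {D} a∉ b∉ te (covered len D∉ cov) f≢b with any? (λ e → f e ≟ a)
      ... | no none = relᶠ-cong M i λ e → redirect-≢ (λ eq → none (e , eq))
      ... | yes (e₀ , fe₀≡a) = trans (relᶠ-cong M i (λ e → sym (atb e)))
              (trans (sym (no-split S (proj₁ (∉K′⁻ a∉)) (proj₁ (∉K′⁻ b∉)) te okS lS (λ p → proj₁ (S⁻ p) refl) (λ p → proj₁ (proj₂ (S⁻ p)) refl) i pattern′ over))
                (relᶠ-cong M i ata))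
        where
        rest? = λ d → ¬? (d ≟ a) ×-dec ¬? (d ≟ b)
        S = filter rest? D
        S⁻ : ∀ {d} → d ∈ S → d ≢ a × d ≢ b × d ∈ D
        S⁻ p with ∈-filter⁻ rest? {xs = D} p
        ... | d∈ , ≢a , ≢b = ≢a , ≢b , d∈
        okS : ∀ {s} → s ∈ S → s ∉ K × Large s
        okS p = ∉K′⁻ (D∉ (proj₂ (proj₂ (S⁻ p))))
        a∈D : a ∈ D
        a∈D with cov e₀
        ... | inj₁ p = contradiction (K⊆K′ (K₁⊆K (subst (_∈ K₁) fe₀≡a p))) a∉
        ... | inj₂ p = subst (_∈ D) fe₀≡a p
        lS : length S + j ≤ q
        lS = ℕₚ.≤-pred (ℕₚ.≤-trans (ℕₚ.+-monoˡ-≤ j (filter-notAll rest? D (lose a∈D (λ ne → proj₁ ne refl)))) len)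
        pattern′ : Fin (arity L i) → Fin (suc n)
        pattern′ e with f e ≟ a
        ... | yes _ = zero
        ... | no _ = suc (f e)
        over : ∀ e → Over (S ++ K) (pattern′ e)
        over e with f e ≟ a
        ... | yes _ = tt
        ... | no ne with cov e
        ...   | inj₁ p = ∈-++⁺ʳ S (K₁⊆K p)
        ...   | inj₂ p = ∈-++⁺ˡ (∈-filter⁺ rest? p (ne , f≢b e))
        ata : ∀ e → ins a id (pattern′ e) ≡ f e
        ata e with f e ≟ a
        ... | yes eq = sym eq
        ... | no _ = refl
        atb : ∀ e → ins b id (pattern′ e) ≡ redirect a b (f e)
        atb e with f e ≟ a
        ... | yes eq = refl
        ... | no ne = refl

      -- If at most one of `a` and `b` occurs, the exchange is a replacement. If both occur, their
      -- large type has a third realisation `c` outside `D`, and the exchange is made of three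
      -- replacements with `c` as temporary place.
      relᶠ-transpose : ∀ {a b f D} → a ∉ K′ → b ∉ K′ → TE K a b → Covered f D → relᶠ M i (transpose a b ∘ f) ≡ relᶠ M i f
      relᶠ-transpose {a} {b} {f} {D} a∉ b∉ te cv@(covered len D∉ cov) with any? (λ e → f e ≟ b) | any? (λ e → f e ≟ a)
      ... | no ¬b | _ = trans (relᶠ-cong M i λ e → sym (transpose-redirect (λ eq → ¬b (e , eq))))
                          (relᶠ-redirect a∉ b∉ te cv (λ e eq → ¬b (e , eq)))
      ... | yes _ | no ¬a = trans (relᶠ-cong M i λ e → sym (transpose-redirectʳ (λ eq → ¬a (e , eq))))
                          (relᶠ-redirect b∉ a∉ (TE-sym te) cv (λ e eq → ¬a (e , eq)))
      ... | yes (e₁ , isb) | yes (e₀ , isa) = viaThird (pick-fresh (cls a) D (cls-unique a)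
                (ℕₚ.≤-<-trans (ℕₚ.≤-trans (ℕₚ.m≤m+n _ j) len) (proj₂ (∉K′⁻ a∉))))
        where
        inD : ∀ {u} → u ∉ K′ → ∀ e → f e ≡ u → u ∈ D
        inD u∉ e eq = [ (λ p → contradiction (K⊆K′ (K₁⊆K (subst (_∈ K₁) eq p))) u∉) , subst (_∈ D) eq ]′ (cov e)
        viaThird : (∃ λ c → c ∈ cls a × c ∉ D) → relᶠ M i (transpose a b ∘ f) ≡ relᶠ M i f
        viaThird (c , c∈ , c∉D) = begin
          relᶠ M i (transpose a b ∘ f)
            ≡⟨ relᶠ-cong M i (λ e → transpose-redirect³ c≢a c≢b (f≢c e)) ⟨
          relᶠ M i (redirect c a ∘ redirect a b ∘ redirect b c ∘ f)
            ≡⟨ relᶠ-redirect {c} {a} {redirect a b ∘ redirect b c ∘ f} c∉ a∉ (TE-sym ac) cv₂ (λ e → f₂≢a (f e)) ⟩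
          relᶠ M i (redirect a b ∘ redirect b c ∘ f)
            ≡⟨ relᶠ-redirect {a} {b} {redirect b c ∘ f} a∉ b∉ te cv₁ (λ e → f₁≢b (f e)) ⟩
          relᶠ M i (redirect b c ∘ f)
            ≡⟨ relᶠ-redirect {b} {c} {f} b∉ c∉ (TE-trans (TE-sym te) ac) cv f≢c ⟩
          relᶠ M i f ∎
          where
          open ≡-Reasoning
          ac : TE K a c
          ac = proj₂ (∈-cls⁻ c∈)
          c∉ : c ∉ K′
          c∉ = ∉K′⁺ (proj₁ (∈-cls⁻ c∈)) (Large-resp ac (proj₂ (∉K′⁻ a∉)))
          c≢a : c ≢ a
          c≢a refl = c∉D (inD a∉ e₀ isa)
          c≢b : c ≢ b
          c≢b refl = c∉D (inD b∉ e₁ isb)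
          f≢c : ∀ e → f e ≢ c
          f≢c e eq = c∉D (inD c∉ e eq)
          cv₁ : Covered (redirect b c ∘ f) _
          cv₁ = redirect-covered {b} {c} {f} {D} b∉ c∉ cv
          cv₂ : Covered (redirect a b ∘ redirect b c ∘ f) _
          cv₂ = redirect-covered {a} {b} {redirect b c ∘ f} a∉ b∉ cv₁
          f₁≢b : ∀ u → redirect b c u ≢ b
          f₁≢b u with u ≟ b
          ... | yes _ = c≢b
          ... | no ne = ne
          f₂≢a : ∀ u → redirect a b (redirect b c u) ≢ a
          f₂≢a u eq with redirect b c u ≟ a
          ... | yes isa′ = f₁≢b u (trans isa′ (sym eq))
          ... | no ne = ne eq

    T-small T-large Y-named W′ Rp′ : List (Fin n)
    T-small = filter (¬? ∘ large?) T
    T-large = filter large? T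
    Y-named = concatMap (λ r → filter (λ u → ¬? (u ≟ r)) (cls r)) T-small
    W′ = Y-named ++ W
    Rp′ = T-small ++ Rp

    T-small⁻ : ∀ {r} → r ∈ T-small → r ∈ T × ¬ Large r
    T-small⁻ = ∈-filter⁻ (¬? ∘ large?) {xs = T}

    T-large⁻ : ∀ {r} → r ∈ T-large → r ∈ T × Large r
    T-large⁻ = ∈-filter⁻ large? {xs = T}

    ∈-Y-named⁺ : ∀ {r u} → r ∈ T-small → u ∉ K → TE K r u → u ≢ r → u ∈ Y-named
    ∈-Y-named⁺ {r} r∈ u∉ te ne = ∈-concatMap⁺ (λ r → filter (λ u → ¬? (u ≟ r)) (cls r))
      (lose r∈ (∈-filter⁺ (λ u → ¬? (u ≟ r)) (∈-cls⁺ u∉ te) ne))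

    ∈-Y-named⁻ : ∀ {u} → u ∈ Y-named → ∃ λ r → r ∈ T-small × u ∉ K × TE K r u × u ≢ r
    ∈-Y-named⁻ u∈ with find (∈-concatMap⁻ (λ r → filter (λ u → ¬? (u ≟ r)) (cls r)) {xs = T-small} u∈)
    ... | r , r∈ , u∈r with ∈-filter⁻ (λ u → ¬? (u ≟ r)) {xs = cls r} u∈r
    ...   | u∈cls , ne = r , r∈ , proj₁ (∈-cls⁻ u∈cls) , proj₂ (∈-cls⁻ u∈cls) , ne

    Y-named-length : ∀ {xs} → (∀ {r} → r ∈ xs → r ∉ K × ¬ Large r) →
                     length (concatMap (λ r → filter (λ u → ¬? (u ≟ r)) (cls r)) xs) ≤ q * length xs
    Y-named-length {[]} _ = z≤n
    Y-named-length {r ∷ xs} ok = ℕₚ.≤-trans (ℕₚ.≤-reflexive (length-++ (filter (λ u → ¬? (u ≟ r)) (cls r))))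
      (ℕₚ.≤-trans (ℕₚ.+-mono-≤
          (ℕₚ.≤-pred (ℕₚ.≤-trans (filter-notAll (λ u → ¬? (u ≟ r)) (cls r) (lose (∈-cls⁺ (proj₁ (ok (here refl))) TE-refl) (λ ne → ne refl)))
            (ℕₚ.≮⇒≥ (proj₂ (ok (here refl))))))
          (Y-named-length (ok ∘ there)))
        (ℕₚ.≤-reflexive (sym (ℕₚ.*-suc q (length xs)))))

    ∈Y⇒representative : ∀ {u} → u ∉ K → ¬ Large u → ∃ λ r → r ∈ T-small × TE K r u
    ∈Y⇒representative u∉ sm with representative u∉
    ... | r , r∈ , te = r , ∈-filter⁺ (¬? ∘ large?) r∈ (sm ∘ Large-resp te) , te

    next-layer : Layer q W′ j K₁ K K′
    next-layer = record
      { K⊆K⁺ = K₁⊆K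
      ; K⁺⊆K′ = K⊆K′
      ; named = λ u∈ → [ inj₁ , inj₂ ∘ ∈-++⁺ʳ Y-named ]′ (named u∈)
      ; single = single
      ; swaps = λ a∉ b∉ te i f D len D∉ cov → relᶠ-transpose i {f = f} {D} a∉ b∉ te (covered len D∉ cov)
      }
      where
      single : ∀ {r u} → r ∈ K′ → r ∉ K → r ∉ W′ → u ∉ K → u ∉ W′ → TE K u r → u ≡ r
      single {r} {u} r∈ r∉K r∉W u∉K u∉W te
        with ∈Y⇒representative r∉K (K′⇒small r∈ r∉K)
      ... | r₀ , r₀∈ , te₀ = trans (at u∉K u∉W (TE-trans te₀ (TE-sym te))) (sym (at r∉K r∉W te₀))
        where
        at : ∀ {v} → v ∉ K → v ∉ W′ → TE K r₀ v → v ≡ r₀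
        at {v} v∉K v∉W te = decidable-stable (v ≟ r₀) λ ne → v∉W (∈-++⁺ˡ (∈-Y-named⁺ r₀∈ v∉K te ne))

    next-inv : Inv K′ W′ Rp′ T-large
    next-inv = record
      { W-bound = W-bound′
      ; W⊆K = λ u∈ → [ Y-named⊆ , K⊆K′ ∘ W⊆K ]′ (∈-++⁻ Y-named u∈)
      ; Rp⊆K = λ r∈ → [ (λ p → small∈K′ (T∉K (proj₁ (T-small⁻ p))) (proj₂ (T-small⁻ p))) , K⊆K′ ∘ Rp⊆K ]′ (∈-++⁻ T-small r∈)
      ; Rp∉W = λ r∈ r∈W → [ new∉W (∈-++⁻ Y-named r∈W) , old∉W (∈-++⁻ Y-named r∈W) ]′ (∈-++⁻ T-small r∈)
      ; Rp-unique = Uniqueₚ.++⁺ (Uniqueₚ.filter⁺ (¬? ∘ large?) (Separated⇒Unique T-sep)) Rp-unique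
          (λ (p , p′) → T∉K (proj₁ (T-small⁻ p)) (Rp⊆K p′))
      ; T-sep = AllPairs.map (λ ¬te te → ¬te (TE-mono K⊆K′ te)) (AllPairsₚ.filter⁺ large? T-sep)
      ; T∉K = λ x∈ → ∉K′⁺ (T∉K (proj₁ (T-large⁻ x∈))) (proj₂ (T-large⁻ x∈))
      ; T-full = λ z∉ → nonempty (∉K′⁻ z∉)
      ; classes = classes′
      }
      where
      Y-named⊆ : ∀ {u} → u ∈ Y-named → u ∈ K′
      Y-named⊆ u∈ with ∈-Y-named⁻ u∈
      ... | r , r∈ , u∉ , te , _ = small∈K′ u∉ (proj₂ (T-small⁻ r∈) ∘ Large-resp (TE-sym te))
      new∉W : ∀ {r} → r ∈ Y-named ⊎ r ∈ W → r ∈ T-small → ⊥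
      new∉W (inj₂ p) r∈ = T∉K (proj₁ (T-small⁻ r∈)) (W⊆K p)
      new∉W (inj₁ p) r∈ with ∈-Y-named⁻ p
      ... | r₀ , r₀∈ , _ , te , ne = ne (sym (separated T-sep (proj₁ (T-small⁻ r₀∈)) (proj₁ (T-small⁻ r∈)) te))
      old∉W : ∀ {r} → r ∈ Y-named ⊎ r ∈ W → r ∈ Rp → ⊥
      old∉W (inj₂ p) r∈ = Rp∉W r∈ p
      old∉W (inj₁ p) r∈ = proj₁ (proj₂ (proj₂ (∈-Y-named⁻ p))) (Rp⊆K r∈)
      nonempty : ∀ {z} → z ∉ K × Large z → 1 ≤ length T-large
      nonempty (z∉ , lg) with representative z∉
      ... | r , r∈ , te with T-large | ∈-filter⁺ large? r∈ (Large-resp (TE-sym te) lg)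
      ...   | _ ∷ _ | _ = s≤s z≤n
      -- A type that becomes rare counts twice in `2 * length Rp′` instead of once in `length T`;
      -- the gain of `q` pays for the at most `q` elements it adds to `W`.
      W-bound′ : length W′ + q ≤ q * (2 * length Rp′ + length T-large)
      W-bound′ = begin
        length W′ + q                     ≡⟨ cong (_+ q) (length-++ Y-named) ⟩
        length Y-named + length W + q     ≡⟨ ℕₚ.+-assoc (length Y-named) (length W) q ⟩
        length Y-named + (length W + q)   ≤⟨ ℕₚ.+-mono-≤ (Y-named-length (λ p → T∉K (proj₁ (T-small⁻ p)) , proj₂ (T-small⁻ p))) W-bound ⟩
        q * s + q * (2 * y + length T)    ≡⟨ cong (λ z → q * s + q * (2 * y + z)) (sym (filter-split-length large? T)) ⟩
        q * s + q * (2 * y + (s + l))     ≡⟨ solve 4 (λ q s y l → q :* s :+ q :* (con 2 :* y :+ (s :+ l)) := q :* (con 2 :* (s :+ y) :+ l)) refl q s y l ⟩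
        q * (2 * (s + y) + l)             ≡⟨ cong (λ z → q * (2 * z + l)) (sym (length-++ T-small)) ⟩
        q * (2 * length Rp′ + l)          ∎
        where
        open ℕₚ.≤-Reasoning
        open +-*-Solver
        s = length T-small
        l = length T-large
        y = length Rp
      Rp≤Rp′ : length Rp ≤ length Rp′
      Rp≤Rp′ = ℕₚ.≤-trans (ℕₚ.m≤n+m _ (length T-small)) (ℕₚ.≤-reflexive (sym (length-++ T-small)))
      -- The members of a `∼`-class outside `K` share one type over `K`. If that type is rare, the
      -- class is swallowed, and apart from `V₀` it is covered by the at most `q + 1` realisations.
      classes′ : ∀ a → (∀ {a′} → Sim M a a′ → a′ ∈ K′ → a′ ∈ V₀) ⊎
        (∃ λ C → length C ≤ suc q × length C ≤ suc q * length Rp′ × (∀ {a′} → Sim M a a′ → a′ ∈ V₀ ⊎ a′ ∈ C))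
      classes′ a with classes a
      ... | inj₂ (C , l , l′ , cov) = inj₂ (C , l , ℕₚ.≤-trans l′ (ℕₚ.*-monoʳ-≤ (suc q) Rp≤Rp′) , cov)
      ... | inj₁ old with any? (λ v → sim? M a v ×-dec small? v)
      ...   | no none = inj₁ new
        where
        new : ∀ {a′} → Sim M a a′ → a′ ∈ K′ → a′ ∈ V₀
        new {a′} sim a∈ with a′ ∈? K
        ... | yes a∈K = old sim a∈K
        ... | no a∉K = contradiction (a′ , sim , a∉K , K′⇒small a∈ a∉K) none
      ...   | yes (y₀ , sim₀ , y₀∉ , y₀-small) = inj₂ (cls y₀ , ℕₚ.≮⇒≥ y₀-small ,
                    ℕₚ.≤-trans (ℕₚ.≮⇒≥ y₀-small) (ℕₚ.≤-trans (ℕₚ.≤-reflexive (sym (ℕₚ.*-identityʳ (suc q)))) (ℕₚ.*-monoʳ-≤ (suc q) one)) , cov)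
        where
        one : 1 ≤ length Rp′
        one with T-small | ∈Y⇒representative y₀∉ y₀-small
        ... | _ ∷ _ | _ = s≤s z≤n
        cov : ∀ {a′} → Sim M a a′ → a′ ∈ V₀ ⊎ a′ ∈ cls y₀
        cov {a′} sim with a′ ∈? K
        ... | yes a′∈ = inj₁ (old sim a′∈)
        ... | no a′∉ = inj₂ (∈-cls⁺ a′∉ (Sim⇒TE y₀∉ a′∉ (Sim-trans {M = M} (Sim-sym {M = M} sim₀) sim)))

  record Built (j : ℕ) : Set where
    field
      {K W Rp T} : List (Fin n)
      inv        : Inv K W Rp T
      tower      : Tower q W j K

  build : Fin n → ∀ j → j ≤ q → Built j
  build v₀ zero _ = record
    { K = [] ; W = [] ; Rp = [] ; T = v₀ ∷ [] ; tower = base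
    ; inv = record
      -- One type and no named element leave a surplus of `q`, the origin of the summand `q` in
      -- `W-bound`.
      { W-bound = ℕₚ.≤-reflexive (sym (ℕₚ.*-identityʳ q))
      ; W⊆K = λ () ; Rp⊆K = λ () ; Rp∉W = λ () ; Rp-unique = []
      ; T-sep = [] ∷ [] ; T∉K = λ { {x} (here refl) () } ; T-full = λ _ → ℕₚ.≤-refl
      ; classes = λ _ → inj₁ λ _ () } }
  build v₀ (suc j) j<q = record { inv = next-inv ; tower = layer (Tower-mono q (∈-++⁺ʳ Y-named) tower) next-layer }
    where
    open Built (build v₀ j (ℕₚ.<⇒≤ j<q)) renaming (tower to tower₁ ; inv to inv₁)
    sat = saturate n inv₁ tower₁ id inj₁ (ℕₚ.m≤n+m n _)
    open Saturated sat using (tower)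
    open NextLayer j<q sat

-- The classes left after naming, and the play that compares them

H-mono : ∀ {L n m} (M : Structure L n) (N : Structure L m) → let open Game M N in
         ∀ d {r s ps} → r ≤ s → H d s ps → H d r ps
H-mono M N d {zero} {s} _ h = G⇒Atomic d s (H⇒G d s h)
  where open Game M N
H-mono M N E (s≤s le) (g , h) = G-mono A (s≤s le) g , λ x → let (y , h′) = h x in y , H-mono M N E le h′
  where open Game M N
H-mono M N A (s≤s le) (g , h) = G-mono E (s≤s le) g , λ y → let (x , h′) = h y in x , H-mono M N A le h′
  where open Game M N

module Classes {L : Vocab} {n : ℕ} (M : Structure L n) (q : ℕ)
  (arity≤ : ∀ i → arity L i ≤ suc q) (arity≥ : ∀ i → 1 ≤ arity L i)
  (W K : List (Fin n)) (tower : Types.Tower M q W q K) where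
  open Types M

  Known : Fin n → Set
  Known x = x ∈ K ⊎ x ∈ W

  abstract
    -- Types contain no equalities, so `TE` alone does not separate a known element from others; the
    -- second component does.
    _≈_ : Fin n → Fin n → Set
    x ≈ x′ = TE K x x′ × (Known x ⊎ Known x′ → x ≡ x′)

    ≈⁺ : ∀ {x x′} → TE K x x′ → (Known x ⊎ Known x′ → x ≡ x′) → x ≈ x′
    ≈⁺ = _,_

    ≈⁻ : ∀ {x x′} → x ≈ x′ → TE K x x′ × (Known x ⊎ Known x′ → x ≡ x′)
    ≈⁻ = id

    ≈? : ∀ x x′ → Dec (x ≈ x′)
    ≈? x x′ = te? K x x′ ×-dec ((known? x ⊎-dec known? x′) →-dec (x ≟ x′))
      where
      known? : ∀ x → Dec (Known x)
      known? x = (x ∈? K) ⊎-dec (x ∈? W)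

    ≈-refl : ∀ {x} → x ≈ x
    ≈-refl = TE-refl , λ _ → refl

    ≈-sym : ∀ {x y} → x ≈ y → y ≈ x
    ≈-sym (t , k) = TE-sym t , λ p → sym (k ([ inj₂ , inj₁ ]′ p))

    ≈-trans : ∀ {x y z} → x ≈ y → y ≈ z → x ≈ z
    ≈-trans (t , k) (t′ , k′) = TE-trans t t′ , λ where
      (inj₁ p) → case k (inj₁ p) of λ { refl → k′ (inj₁ p) }
      (inj₂ p) → case k′ (inj₂ p) of λ { refl → k (inj₂ p) }

  cls : Fin n → List (Fin n)
  cls x = filter (≈? x) (allFin n)

  -- `M` is played against itself with Duplicator copying, so that `β` is the identity. A tuple and
  -- its image under the transposition then match entry by entry, and `matched-agree` applies.
  ≈⇒Sim : ∀ {x x′} → x ≈ x′ → Sim M x x′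
  ≈⇒Sim {x} {x′} x≈x′ = Simᶠ⇒Sim {M = M} λ i f →
    matched-agree i (transpose x x′ ∘ f) f (λ e → matched (f e)) (transpose-injective x x′) (cong (transpose x x′))
    where
    diagonal : ∀ {x y} → (x , y) ∈ map (λ w → w , w) W → x ≡ y
    diagonal p with ∈-map⁻ (λ w → w , w) p
    ... | _ , _ , refl = refl
    open Side M M q arity≤ arity≥ W (map (λ w → w , w) W) (q * q + q + 1) ℕₚ.≤-refl
      (λ {w} w∈ → w , ∈-map⁺ (λ w → w , w) w∈) (λ d → G-diagonal M d _ _ diagonal)
    open Matching tower using (matched-agree; Match)
    related : ∀ {u v} → v ≈ u → Match u v
    related v≈u = (λ i p o → sym (proj₁ (≈⁻ v≈u) i p o)) , λ k →
      (λ { refl → proj₂ (≈⁻ v≈u) (inj₂ k) }) , (λ { refl → sym (proj₂ (≈⁻ v≈u) (inj₁ k)) })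
    matched : ∀ u → Match (transpose x x′ u) u
    matched u with transposeView x x′ u
    ... | left refl e = subst (λ z → Match z u) (sym e) (related x≈x′)
    ... | right refl e = subst (λ z → Match z u) (sym e) (related (≈-sym x≈x′))
    ... | other _ _ e = subst (λ z → Match z u) (sym e) (related ≈-refl)

  module Against {m : ℕ} (N : Structure L m) (R : ℕ) (bound : q * q + q + 1 ≤ R)
    (pos₀ : List (Fin n × Fin m)) (W-played : ∀ {w} → w ∈ W → ∃ λ y → (w , y) ∈ pos₀)
    (game : ∀ d → Game.G M N d (suc R) pos₀) where
    open Game M N
    open Side M N q arity≤ arity≥ W pos₀ R bound W-played game
    open Matching tower using (matched-agree; Match; played-match)

    -- The number of elements that can be played while keeping `q + q * q` rounds, which certify
    -- `Match` for every pair on the board.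
    B : ℕ
    B = suc R ∸ (q + q * q)

    abstract
      answer : ∀ y → ∃ λ x → Match x y
      answer y = let (x , g) = proj₂ (game A) y in
        x , played-match A there (G-mono A (ℕₚ.≤-trans (ℕₚ.≤-trans (ℕₚ.≤-reflexive (ℕₚ.+-comm q (q * q))) (ℕₚ.m≤m+n _ 1)) bound) g) (here refl)

    μ : Fin m → Fin n
    μ y = proj₁ (answer y)

    Match⇒≈ : ∀ {x y} → Match x y → x ≈ μ y
    Match⇒≈ {x} {y} (t , k) = ≈⁺ (XE⇒TE t (proj₁ (proj₂ (answer y)))) λ where
      (inj₁ p) → sym (proj₂ (proj₂ (proj₂ (answer y)) p) (proj₁ (k p) refl))
      (inj₂ p) → proj₂ (k p) (proj₁ (proj₂ (proj₂ (answer y)) p) refl)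

    ≈⇒Match : ∀ {x y} → x ≈ μ y → Match x y
    ≈⇒Match {x} {y} x≈ = (λ i p o → trans (proj₁ (≈⁻ x≈) i p o) (proj₁ (proj₂ (answer y)) i p o)) , λ {r} k →
      (λ { refl → proj₁ (proj₂ (proj₂ (answer y)) k) (sym (proj₂ (≈⁻ x≈) (inj₁ k))) }) ,
      (λ e → let μ≡r = proj₂ (proj₂ (proj₂ (answer y)) k) e in
        trans (proj₂ (≈⁻ x≈) (inj₂ (subst Known (sym μ≡r) k))) μ≡r)

    rounds : ∀ {l} → l ≤ B → l + (q + q * q) ≤ suc R
    rounds le = ℕₚ.≤-trans (ℕₚ.+-monoˡ-≤ (q + q * q) le) (ℕₚ.≤-reflexive (ℕₚ.m∸n+n≡m
      (ℕₚ.m≤n⇒m≤1+n (ℕₚ.≤-trans (ℕₚ.≤-trans (ℕₚ.≤-reflexive (ℕₚ.+-comm q (q * q))) (ℕₚ.m≤m+n _ 1)) bound))))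

    lower : ∀ xs → Unique xs → length xs ≤ B →
            ∃ λ qs → map proj₁ qs ≡ xs × Unique (map proj₂ qs) × (∀ {x y} → (x , y) ∈ qs → x ≈ μ y)
    lower xs u le with playˡ (G E) proj₂ xs (G-mono E (rounds le) (game E))
    ... | qs , refl , ps , qs⊆ , ext , g = qs , refl , Atomic-uniqueʳ qs (G⇒Atomic E (q + q * q) g) qs⊆ u ,
          λ p → Match⇒≈ (played-match E ext g (qs⊆ p))

    upper : ∀ ys → Unique ys → length ys ≤ B →
            ∃ λ qs → map proj₂ qs ≡ ys × Unique (map proj₁ qs) × (∀ {x y} → (x , y) ∈ qs → x ≈ μ y)
    upper ys u le with playʳ (G A) proj₂ ys (G-mono A (rounds le) (game A))
    ... | qs , refl , ps , qs⊆ , ext , g = qs , refl , Atomic-uniqueˡ qs (G⇒Atomic A (q + q * q) g) qs⊆ u ,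
          λ p → Match⇒≈ (played-match A ext g (qs⊆ p))

    agrees : ∀ i f g → (∀ e → f e ≈ μ (g e)) → (∀ {e e′} → f e ≡ f e′ → g e ≡ g e′) → (∀ {e e′} → g e ≡ g e′ → f e ≡ f e′) →
             relᶠ M i f ≡ relᶠ N i g
    agrees i f g h = matched-agree i f g (≈⇒Match ∘ h)

    open Counting M N q arity≤ _≈_ ≈? ≈-refl ≈-sym ≈-trans μ agrees B lower upper public
      using (Balanced; fits⇒balanced; balanced⇒iso; module Exceptional)

  module Play {m : ℕ} (N : Structure L m) (t : ℕ) (game : ∀ d → Game.H M N d t [])
    (enough : length W + (q * q + q + 2) ≤ t) where
    open Game M N

    R : ℕ
    R = t ∸ length W ∸ 1

    t≡ : t ≡ length W + suc R
    t≡ = sym (trans (cong (length W +_) (ℕₚ.m+[n∸m]≡n (ℕₚ.≤-trans (ℕₚ.≤-trans (s≤s z≤n) (ℕₚ.m≤n+m 2 (q * q + q)))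
                 (ℕₚ.≤-trans (ℕₚ.≤-reflexive (sym (ℕₚ.m+n∸m≡n (length W) _))) (ℕₚ.∸-monoˡ-≤ (length W) enough)))))
               (ℕₚ.m+[n∸m]≡n {length W} (ℕₚ.≤-trans (ℕₚ.m≤m+n (length W) _) enough)))

    fits : ∀ {l} → length W + l ≤ t → l ≤ suc R
    fits {l} le = ℕₚ.+-cancelˡ-≤ (length W) l (suc R) (ℕₚ.≤-trans le (ℕₚ.≤-reflexive t≡))

    abstract
      played : ∃ λ ps → (∀ {w} → w ∈ W → ∃ λ y → (w , y) ∈ ps) × H E (suc R) ps
      played with playˡ (H E) proj₂ W (subst (λ z → H E z []) t≡ (game E))
      ... | qs , eq , ps , qs⊆ , _ , h = ps , (λ w∈ → let ((w , y) , p , e) = ∈-map⁻ proj₁ (subst (_ ∈_) (sym eq) w∈) in y , qs⊆ (subst (λ z → (z , y) ∈ qs) (sym e) p)) , h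

    games : ∀ d → G d (suc R) (proj₁ played)
    games E = H⇒G E (suc R) (proj₂ (proj₂ played))
    games A = H⇒G-swap E (suc R) (proj₂ (proj₂ played))

    open Against N R
      (ℕₚ.≤-pred (ℕₚ.≤-trans (ℕₚ.≤-reflexive (sym (ℕₚ.+-suc (q * q + q) 1))) (fits enough)))
      (proj₁ played) (proj₁ (proj₂ played)) games public

    fits-B : ∀ {l} → length W + (l + (q + q * q)) ≤ t → l ≤ B
    fits-B {l} le = ℕₚ.≤-trans (ℕₚ.≤-reflexive (sym (ℕₚ.m+n∸n≡m l (q + q * q)))) (ℕₚ.∸-monoˡ-≤ (q + q * q) (fits le))

m*n≤o⇒m≤o/n : ∀ m n o .{{_ : NonZero n}} → m * n ≤ o → m ≤ o / n
m*n≤o⇒m≤o/n m n o le = ℕₚ.≤-trans (ℕₚ.≤-reflexive (sym (m*n/n≡m m n))) (/-monoˡ-≤ n le)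

-- Arithmetic of the bound, with `suc r` equal to 2k

module Arithmetic (q : ℕ) where

  r : ℕ
  r = 2 * suc q ∸ 1

  module _ {y c n w : ℕ} (W-bound : w + q ≤ q * (2 * y + c)) (few : suc r * (y + c) < n) where

    private
      v = y + c
    open ℕₚ.≤-Reasoning
    open +-*-Solver

    -- This is w + s > (1 - 1/2k)n + 1, cleared of fractions.
    Exceeds : ℕ → Set
    Exceeds s = r * n + suc r < suc r * (w + s)

    scaled : ∀ {x} → x ≤ 2 * q * v → suc r * x ≤ 2 * q * n
    scaled {x} le = begin
      suc r * x            ≤⟨ ℕₚ.*-monoʳ-≤ (suc r) le ⟩
      suc r * (2 * q * v)  ≡⟨ solve 3 (λ a b v → a :* (b :* v) := b :* (a :* v)) refl (suc r) (2 * q) v ⟩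
      2 * q * (suc r * v)  ≤⟨ ℕₚ.*-monoʳ-≤ (2 * q) (ℕₚ.<⇒≤ few) ⟩
      2 * q * n            ∎

    w≤2qv : w ≤ 2 * q * v
    w≤2qv = begin
      w                ≤⟨ ℕₚ.m≤m+n w q ⟩
      w + q            ≤⟨ W-bound ⟩
      q * (2 * y + c)  ≤⟨ ℕₚ.m≤m+n _ (q * c) ⟩
      q * (2 * y + c) + q * c  ≡⟨ solve 3 (λ q y c → q :* (con 2 :* y :+ c) :+ q :* c := con 2 :* q :* (y :+ c)) refl q y c ⟩
      2 * q * v        ∎

    w-fits : suc r * w ≤ r * n
    w-fits = begin
      suc r * w  ≤⟨ scaled w≤2qv ⟩
      2 * q * n  ≤⟨ ℕₚ.*-monoˡ-≤ n (begin
        2 * q           ≤⟨ ℕₚ.m≤m+n (2 * q) 1 ⟩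
        2 * q + 1       ≡⟨ solve 1 (λ q → con 2 :* q :+ con 1 := q :+ (con 1 :+ (q :+ con 0))) refl q ⟩
        r               ∎) ⟩
      r * n      ∎

    -- The sum of the two inequalities counts `w` twice. One copy fits into `n` together with `s`
    -- and `s′`, the other is at most `2 * q * n` after scaling, and `2 * q + suc r` is exactly
    -- `r + r`.
    not-both : ∀ {s s′} → w + s + s′ ≤ n → Exceeds s → ¬ Exceeds s′
    not-both {s} {s′} le ex ex′ = ℕₚ.<-irrefl refl (begin-strict
      r * n + r * n                                    ≤⟨ ℕₚ.+-mono-≤ (ℕₚ.m≤m+n (r * n) (suc r)) (ℕₚ.m≤m+n (r * n) (suc r)) ⟩
      (r * n + suc r) + (r * n + suc r)                <⟨ ℕₚ.+-mono-< ex ex′ ⟩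
      suc r * (w + s) + suc r * (w + s′)               ≡⟨ solve 4 (λ a w s t → a :* (w :+ s) :+ a :* (w :+ t) := a :* w :+ a :* (w :+ s :+ t)) refl (suc r) w s s′ ⟩
      suc r * w + suc r * (w + s + s′)                 ≤⟨ ℕₚ.+-mono-≤ (scaled w≤2qv) (ℕₚ.*-monoʳ-≤ (suc r) le) ⟩
      2 * q * n + suc r * n                            ≡⟨ solve 2 (λ q n → let ρ = q :+ (con 1 :+ (q :+ con 0)) in con 2 :* q :* n :+ (con 1 :+ ρ) :* n := ρ :* n :+ ρ :* n) refl q n ⟩
      r * n + r * n                                    ∎)

    module _ (1≤c : 1 ≤ c) where

      w+2q≤2qv : w + 2 * q ≤ 2 * q * v
      w+2q≤2qv = begin
        w + 2 * q        ≡⟨ solve 2 (λ w q → w :+ con 2 :* q := w :+ q :+ q :* con 1) refl w q ⟩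
        w + q + q * 1    ≤⟨ ℕₚ.+-mono-≤ W-bound (ℕₚ.*-monoʳ-≤ q 1≤c) ⟩
        q * (2 * y + c) + q * c  ≡⟨ solve 3 (λ q y c → q :* (con 2 :* y :+ c) :+ q :* c := con 2 :* q :* (y :+ c)) refl q y c ⟩
        2 * q * v        ∎

      -- By `few`, `w + s` is at least `r * v + 2`. Of this `w` takes at most `2 * q * v` minus
      -- `2 * q`, owing to the summand `q` in `W-bound` and to `1≤c`.
      exceeds⇒large : ∀ {s} → Exceeds s → 2 * q + v + 2 ≤ s
      exceeds⇒large {s} ex = ℕₚ.+-cancelˡ-≤ w _ _ (begin
        w + (2 * q + v + 2)  ≡⟨ solve 3 (λ w q v → w :+ (con 2 :* q :+ v :+ con 2) := (w :+ con 2 :* q) :+ (v :+ con 2)) refl w q v ⟩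
        (w + 2 * q) + (v + 2)  ≤⟨ ℕₚ.+-monoˡ-≤ (v + 2) w+2q≤2qv ⟩
        2 * q * v + (v + 2)  ≡⟨ solve 2 (λ q v → con 2 :* q :* v :+ (v :+ con 2) := (q :+ (con 1 :+ (q :+ con 0))) :* v :+ con 2) refl q v ⟩
        r * v + 2            ≤⟨ ℕₚ.*-cancelˡ-≤ (suc r) (begin
          suc r * (r * v + 2)                ≡⟨ solve 2 (λ ρ v → (con 1 :+ ρ) :* (ρ :* v :+ con 2) := con 1 :+ (ρ :* (con 1 :+ (con 1 :+ ρ) :* v) :+ (con 1 :+ ρ))) refl r v ⟩
          suc (r * suc (suc r * v) + suc r)  ≤⟨ s≤s (ℕₚ.+-monoˡ-≤ (suc r) (ℕₚ.*-monoʳ-≤ r few)) ⟩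
          suc (r * n + suc r)                ≤⟨ ex ⟩
          suc r * (w + s)                    ∎) ⟩
        w + s                ∎)

      -- Rules out a rival `∼`-class with elements outside `K`: `s′` is the size of their type, and
      -- `2 + q` bounds the share of the class in `V₀`.
      not-comparable : ∀ {s s′} → w + s′ + s ≤ n → Exceeds s → ¬ (s ≤ (2 + q) + s′)
      not-comparable {s} {s′} le ex s≤ = ℕₚ.<-irrefl refl (begin-strict
        r * n + r * n + (suc r + suc r)          ≡⟨ solve 2 (λ a b → a :+ a :+ (b :+ b) := (a :+ b) :+ (a :+ b)) refl (r * n) (suc r) ⟩
        (r * n + suc r) + (r * n + suc r)        <⟨ ℕₚ.+-mono-< ex ex ⟩
        suc r * (w + s) + suc r * (w + s)        ≡⟨ solve 3 (λ a w s → a :* (w :+ s) :+ a :* (w :+ s) := a :* (w :+ (w :+ s) :+ s)) refl (suc r) w s ⟩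
        suc r * (w + (w + s) + s)                ≤⟨ ℕₚ.*-monoʳ-≤ (suc r) (ℕₚ.+-monoʳ-≤ (w + (w + s)) s≤) ⟩
        suc r * (w + (w + s) + ((2 + q) + s′))   ≡⟨ solve 5 (λ a w s t q → a :* (w :+ (w :+ s) :+ ((con 2 :+ q) :+ t)) := a :* (w :+ q) :+ (a :* (w :+ t :+ s) :+ (a :+ a))) refl (suc r) w s s′ q ⟩
        suc r * (w + q) + (suc r * (w + s′ + s) + (suc r + suc r))  ≤⟨ ℕₚ.+-mono-≤ (scaled (ℕₚ.≤-trans (ℕₚ.+-monoʳ-≤ w (ℕₚ.m≤m+n q (q + 0))) w+2q≤2qv)) (ℕₚ.+-monoˡ-≤ (suc r + suc r) (ℕₚ.*-monoʳ-≤ (suc r) le)) ⟩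
        2 * q * n + (suc r * n + (suc r + suc r))  ≡⟨ solve 2 (λ q n → let ρ = q :+ (con 1 :+ (q :+ con 0)) ; σ = con 1 :+ ρ in con 2 :* q :* n :+ (σ :* n :+ (σ :+ σ)) := ρ :* n :+ ρ :* n :+ (σ :+ σ)) refl q n ⟩
        r * n + r * n + (suc r + suc r)          ∎)

      -- Rules out a rival `∼`-class swallowed by a rare type. Without rare types `l` vanishes;
      -- otherwise `v` is at least 2, and `exceeds⇒large` puts `s` above `(2 + q) + suc q`.
      not-dominated : ∀ {s l} → Exceeds s → l ≤ suc q → l ≤ suc q * y → ¬ (s ≤ (2 + q) + l)
      not-dominated {s} {l} ex l≤ l≤y s≤ = contra y refl
        where
        v+q≤l : v + q ≤ l
        v+q≤l = ℕₚ.+-cancelˡ-≤ (2 + q) _ _ (begin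
          (2 + q) + (v + q)  ≡⟨ solve 2 (λ q v → (con 2 :+ q) :+ (v :+ q) := con 2 :* q :+ v :+ con 2) refl q v ⟩
          2 * q + v + 2      ≤⟨ exceeds⇒large ex ⟩
          s                  ≤⟨ s≤ ⟩
          (2 + q) + l        ∎)
        1≤v : 1 ≤ v
        1≤v = ℕₚ.≤-trans 1≤c (ℕₚ.m≤n+m c y)
        contra : ∀ y′ → y ≡ y′ → ⊥
        contra zero y≡0 = ℕₚ.<⇒≱ (ℕₚ.≤-trans 1≤v (ℕₚ.≤-trans (ℕₚ.m≤m+n v q) v+q≤l))
          (ℕₚ.≤-trans l≤y (ℕₚ.≤-reflexive (trans (cong (suc q *_) y≡0) (ℕₚ.*-zeroʳ (suc q)))))
        contra (suc y′) y≡ = ℕₚ.<⇒≱ (begin-strict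
            suc q          <⟨ ℕₚ.+-monoˡ-≤ q (ℕₚ.+-mono-≤ (ℕₚ.≤-trans (s≤s z≤n) (ℕₚ.≤-reflexive (sym y≡))) 1≤c) ⟩
            v + q          ∎) (ℕₚ.≤-trans v+q≤l l≤)

      b-fits : w + q + 1 ≤ (r * n) / suc r
      b-fits = m*n≤o⇒m≤o/n (w + q + 1) (suc r) (r * n) (begin
        (w + q + 1) * suc r   ≤⟨ ℕₚ.*-monoˡ-≤ (suc r) (begin
          w + q + 1             ≤⟨ ℕₚ.+-mono-≤ (ℕₚ.≤-trans (ℕₚ.+-monoʳ-≤ w (ℕₚ.m≤m+n q (q + 0))) w+2q≤2qv) (ℕₚ.≤-trans 1≤c (ℕₚ.m≤n+m c y)) ⟩
          2 * q * v + v         ≡⟨ solve 2 (λ q v → con 2 :* q :* v :+ v := (q :+ (con 1 :+ (q :+ con 0))) :* v) refl q v ⟩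
          r * v                 ∎) ⟩
        r * v * suc r         ≡⟨ solve 2 (λ ρ v → ρ :* v :* (con 1 :+ ρ) := ρ :* ((con 1 :+ ρ) :* v)) refl r v ⟩
        r * (suc r * v)       ≤⟨ ℕₚ.*-monoʳ-≤ r (ℕₚ.<⇒≤ few) ⟩
        r * n                 ∎)

  fits⇒≤ : ∀ {x n} → suc r * x ≤ r * n + suc r → x ≤ suc ((r * n) / suc r)
  fits⇒≤ {zero} _ = z≤n
  fits⇒≤ {suc x} {n} le = s≤s (m*n≤o⇒m≤o/n x (suc r) (r * n) (ℕₚ.≤-trans (ℕₚ.≤-reflexive (ℕₚ.*-comm x (suc r)))
    (ℕₚ.+-cancelʳ-≤ (suc r) _ _ (ℕₚ.≤-trans (ℕₚ.≤-reflexive (trans (ℕₚ.+-comm _ (suc r)) (sym (ℕₚ.*-suc (suc r) x)))) le))))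

-- Conclusion: surviving the game forces isomorphism

≤-max-map : ∀ {X : Set} (f : X → ℕ) {x} {xs : List X} → x ∈ xs → f x ≤ foldr _⊔_ 0 (map f xs)
≤-max-map f (here refl) = ℕₚ.m≤m⊔n _ _
≤-max-map f {xs = x ∷ _} (there p) = ℕₚ.≤-trans (≤-max-map f p) (ℕₚ.m≤n⊔m (f x) _)

module Finish {L : Vocab} {n : ℕ} (M : Structure L n) (q : ℕ)
  (arity≤ : ∀ i → arity L i ≤ suc q) (arity≥ : ∀ i → 1 ≤ arity L i)
  (sparseV : Construction.Sparse M q arity≤) (built : Build.Built M q arity≤ sparseV q)
  (t : ℕ) (t≥ : (Arithmetic.r q * n) / suc (Arithmetic.r q) + (q * q + q + 2) ≤ t) (t≥σ : σ M + suc q ≤ t)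
  {m : ℕ} (N : Structure L m) (game : ∀ d → Game.H M N d t []) where

  open Types M
  open Arithmetic q
  open Construction M q arity≤ using (module Sparse)
  open Sparse sparseV
  open Build M q arity≤ sparseV
  open Built built
  open Inv inv

  y = length Rp
  c = length T
  b = (r * n) / suc r

  -- Naming takes `w` rounds, testing a class of size `s` takes `suc s`, and certifying the matches
  -- takes `q + q * q`. With `suc b` for `w + s` this makes up the summand `q * q + q + 2`.
  enough-rounds : ∀ {w s} → w + s ≤ suc b → w + (suc s + (q + q * q)) ≤ t
  enough-rounds {w} {s} le = begin
    w + (suc s + (q + q * q))    ≡⟨ solve 3 (λ w s q → w :+ (con 1 :+ s :+ (q :+ q :* q)) := (w :+ s) :+ (con 1 :+ q :+ q :* q)) refl w s q ⟩
    (w + s) + (1 + q + q * q)    ≤⟨ ℕₚ.+-monoˡ-≤ _ le ⟩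
    suc b + (1 + q + q * q)      ≡⟨ solve 2 (λ b q → con 1 :+ b :+ (con 1 :+ q :+ q :* q) := b :+ (q :* q :+ q :+ con 2)) refl b q ⟩
    b + (q * q + q + 2)          ≤⟨ t≥ ⟩
    t                            ∎
    where
    open ℕₚ.≤-Reasoning
    open +-*-Solver

  module Many (many : n ≤ suc r * (y + c)) where

    unnamed? : ∀ x → Dec (x ∉ Rp × x ∉ T)
    unnamed? x = ¬? (x ∈? Rp) ×-dec ¬? (x ∈? T)

    abstract
      W₁ : List (Fin n)
      W₁ = filter unnamed? (allFin n)

      ∈-W₁⁺ : ∀ {x} → x ∉ Rp → x ∉ T → x ∈ W₁
      ∈-W₁⁺ ∉R ∉T = ∈-filter⁺ unnamed? (∈-allFin _) (∉R , ∉T)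

      W₁-length : length W₁ + (y + c) ≤ n
      W₁-length = ℕₚ.≤-trans (ℕₚ.≤-reflexive (sym (trans (length-++ W₁) (cong (length W₁ +_) (length-++ Rp)))))
        (unique-length≤n (Uniqueₚ.++⁺ (filter-allFin unnamed?)
          (Uniqueₚ.++⁺ Rp-unique (Separated⇒Unique T-sep) (λ (p , p′) → T∉K p′ (Rp⊆K p)))
          (λ (p , p′) → let (∉R , ∉T) = proj₂ (∈-filter⁻ unnamed? {xs = allFin n} p) in [ ∉R , ∉T ]′ (∈-++⁻ Rp p′))))

    open Classes M q arity≤ arity≥ W₁ K
      (Tower-mono q (λ w∈ → ∈-W₁⁺ (λ r∈ → Rp∉W r∈ w∈) (λ t∈ → T∉K t∈ (W⊆K w∈))) tower)

    W₁≤b : length W₁ + 1 ≤ suc b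
    W₁≤b = fits⇒≤ (begin
      suc r * (length W₁ + 1)      ≡⟨ trans (ℕₚ.*-distribˡ-+ (suc r) (length W₁) 1) (cong (suc r * length W₁ +_) (ℕₚ.*-identityʳ (suc r))) ⟩
      suc r * length W₁ + suc r    ≤⟨ ℕₚ.+-monoˡ-≤ (suc r) (ℕₚ.+-cancelˡ-≤ n _ _ (begin
        n + suc r * length W₁                    ≤⟨ ℕₚ.+-monoˡ-≤ _ many ⟩
        suc r * (y + c) + suc r * length W₁      ≡⟨ ℕₚ.+-comm (suc r * (y + c)) _ ⟩
        suc r * length W₁ + suc r * (y + c)      ≡⟨ ℕₚ.*-distribˡ-+ (suc r) (length W₁) (y + c) ⟨
        suc r * (length W₁ + (y + c))            ≤⟨ ℕₚ.*-monoʳ-≤ (suc r) W₁-length ⟩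
        n + r * n                                ∎)) ⟩
      r * n + suc r                ∎)
      where open ℕₚ.≤-Reasoning

    enough : length W₁ + (q * q + q + 2) ≤ t
    enough = ℕₚ.≤-trans (ℕₚ.≤-reflexive (cong (length W₁ +_)
      (solve 1 (λ q → q :* q :+ q :+ con 2 := con 2 :+ (q :+ q :* q)) refl q))) (enough-rounds W₁≤b)
      where open +-*-Solver

    -- The elements left unnamed are recognised in `K` or belong to `T`, which has just one element
    -- of each type.
    ≈⇒≡ : ∀ {x x′} → x ≈ x′ → x ≡ x′
    ≈⇒≡ {x} {x′} x≈ with x ∈? W₁ | x′ ∈? W₁ | x ∈? K | x′ ∈? K
    ... | yes p | _ | _ | _ = proj₂ (≈⁻ x≈) (inj₁ (inj₂ p))
    ... | no _ | yes p | _ | _ = proj₂ (≈⁻ x≈) (inj₂ (inj₂ p))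
    ... | no _ | no _ | yes p | _ = proj₂ (≈⁻ x≈) (inj₁ (inj₁ p))
    ... | no _ | no _ | no _ | yes p = proj₂ (≈⁻ x≈) (inj₂ (inj₁ p))
    ... | no ∉W | no ∉W′ | no ∉K | no ∉K′ = separated T-sep (inT ∉W ∉K) (inT ∉W′ ∉K′) (proj₁ (≈⁻ x≈))
      where
      inT : ∀ {u} → u ∉ W₁ → u ∉ K → u ∈ T
      inT {u} ∉W ∉K = decidable-stable (u ∈? T) λ ∉T → ∉W (∈-W₁⁺ (∉K ∘ Rp⊆K) ∉T)

    open Play N t game enough

    iso : Iso N M
    iso = balanced⇒iso λ x → fits⇒balanced x (ℕₚ.≤-trans
      (s≤s (unique-⊆⇒length≤ {ys = x ∷ []} (filter-allFin (≈? x)) λ p → here (sym (≈⇒≡ (proj₂ (∈-filter⁻ (≈? x) {xs = allFin n} p))))))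
      (fits-B (enough-rounds W₁≤b)))

  module Few (few : suc r * (y + c) < n) where

    abstract
      -- Repetitions are removed so that in `sizes≤` the length can be added to the sizes of
      -- disjoint classes.
      W₂ : List (Fin n)
      W₂ = deduplicate _≟_ W

      W₂-unique : Unique W₂
      W₂-unique = UniqueDecₚ.deduplicate-! _≟_ W

      W⊆W₂ : W ⊆ W₂
      W⊆W₂ = ∈-deduplicate⁺ _≟_

      W₂⊆W : W₂ ⊆ W
      W₂⊆W = ∈-deduplicate⁻ _≟_ W

    w = length W₂

    W₂-bound : w + q ≤ q * (2 * y + c)
    W₂-bound = ℕₚ.≤-trans (ℕₚ.+-monoˡ-≤ q (unique-⊆⇒length≤ W₂-unique W₂⊆W)) W-bound

    open Classes M q arity≤ arity≥ W₂ K (Tower-mono q W⊆W₂ tower)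

    Known⇒∈K : ∀ {x} → Known x → x ∈ K
    Known⇒∈K = [ id , W⊆K ∘ W₂⊆W ]′

    ∈-cls⁻ : ∀ {x x′} → x′ ∈ cls x → x ≈ x′
    ∈-cls⁻ {x} p = proj₂ (∈-filter⁻ (≈? x) {xs = allFin n} p)

    size : Fin n → ℕ
    size x = length (cls x)

    Exceeds′ : ℕ → Set
    Exceeds′ s = r * n + suc r < suc r * (w + s)

    fits-one : suc r * (w + 1) ≤ r * n + suc r
    fits-one = ℕₚ.≤-trans (ℕₚ.≤-reflexive (trans (ℕₚ.*-distribˡ-+ (suc r) w 1) (cong (suc r * w +_) (ℕₚ.*-identityʳ (suc r)))))
      (ℕₚ.+-monoˡ-≤ (suc r) (w-fits {y} {c} W₂-bound few))

    known-small : ∀ {x} → x ∈ K → size x ≤ 1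
    known-small {x} x∈ = unique-⊆⇒length≤ {ys = x ∷ []} (filter-allFin (≈? x)) λ p →
      here (sym (proj₂ (≈⁻ (∈-cls⁻ p)) (inj₁ (inj₁ x∈))))

    exceeds⇒∉K : ∀ {x} → Exceeds′ (size x) → x ∉ K
    exceeds⇒∉K ex x∈ = ℕₚ.<⇒≱ ex (ℕₚ.≤-trans (ℕₚ.*-monoʳ-≤ (suc r) (ℕₚ.+-monoʳ-≤ w (known-small x∈))) fits-one)

    cls∉K : ∀ {x u} → x ∉ K → u ∈ cls x → u ∉ K
    cls∉K x∉ p u∈ = x∉ (subst (_∈ K) (sym (proj₂ (≈⁻ (∈-cls⁻ p)) (inj₂ (inj₁ u∈)))) u∈)

    sizes≤ : ∀ {x x′} → x ∉ K → x′ ∉ K → ¬ x ≈ x′ → w + size x + size x′ ≤ n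
    sizes≤ {x} {x′} x∉ x′∉ x≉ = ℕₚ.≤-trans
      (ℕₚ.≤-reflexive (sym (trans (length-++ (W₂ ++ cls x)) (cong (_+ size x′) (length-++ W₂)))))
      (unique-length≤n (Uniqueₚ.++⁺ (Uniqueₚ.++⁺ W₂-unique (filter-allFin (≈? x)) (λ (p , p′) → cls∉K x∉ p′ (W⊆K (W₂⊆W p))))
        (filter-allFin (≈? x′)) (λ (p , p′) → [ (λ p → cls∉K x′∉ p′ (W⊆K (W₂⊆W p))) , (λ p → x≉ (≈-trans (∈-cls⁻ p) (≈-sym (∈-cls⁻ p′)))) ]′ (∈-++⁻ W₂ p))))

    enough : length W₂ + (q * q + q + 2) ≤ t
    enough = ℕₚ.≤-trans (ℕₚ.≤-reflexive (cong (length W₂ +_)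
      (solve 1 (λ q → q :* q :+ q :+ con 2 := con 2 :+ (q :+ q :* q)) refl q))) (enough-rounds (fits⇒≤ fits-one))
      where open +-*-Solver

    open Play N t game enough

    fitting⇒balanced : ∀ x → ¬ Exceeds′ (size x) → Balanced x
    fitting⇒balanced x fit = fits⇒balanced x (fits-B (enough-rounds (fits⇒≤ (ℕₚ.≮⇒≥ fit))))

    module _ {z₀ : Fin n} (ex : Exceeds′ (size z₀)) where

      z₀∉K : z₀ ∉ K
      z₀∉K = exceeds⇒∉K ex

      1≤c : 1 ≤ c
      1≤c = T-full z₀∉K

      p = classSize M z₀

      size≤p : size z₀ ≤ p
      size≤p = unique-⊆⇒length≤ (filter-allFin (≈? z₀)) λ x∈ → ∈-filter⁺ (sim? M z₀) (∈-allFin _) (≈⇒Sim (∈-cls⁻ x∈))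

      Sim⇒≈ : ∀ {x x′} → x ∉ K → x′ ∉ K → Sim M x x′ → x ≈ x′
      Sim⇒≈ x∉ x′∉ sim = ≈⁺ (Sim⇒TE x∉ x′∉ sim) λ k → contradiction k [ x∉ ∘ Known⇒∈K , x′∉ ∘ Known⇒∈K ]′

      -- At most `2 + q` members of a `∼`-class are in `V₀`. By `classes`, the others lie in a small
      -- set `C`, or are absent, or lie in a single type outside `K`; in each case the type of `z₀`
      -- alone is already larger.
      largest : ∀ x → ¬ Sim M z₀ x → classSize M x < p
      largest x ≁ = ℕₚ.≰⇒> λ p≤ → absurd (ℕₚ.≤-trans size≤p p≤)
        where
        similar = filter (sim? M x) (allFin n)
        inV₀ = filter (_∈? V₀) similar
        similar⁻ : ∀ {x′} → x′ ∈ similar → Sim M x x′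
        similar⁻ p = proj₂ (∈-filter⁻ (sim? M x) {xs = allFin n} p)
        inV₀-short : length inV₀ ≤ 2 + q
        inV₀-short = sparse x (Uniqueₚ.filter⁺ (_∈? V₀) (filter-allFin (sim? M x)))
          (λ p → proj₂ (∈-filter⁻ (_∈? V₀) {xs = similar} p)) (λ p → similar⁻ (proj₁ (∈-filter⁻ (_∈? V₀) p)))
        covered-by : ∀ C → (∀ {x′} → Sim M x x′ → x′ ∈ V₀ ⊎ x′ ∈ C) → classSize M x ≤ (2 + q) + length C
        covered-by C cov = ℕₚ.≤-trans
          (unique-⊆⇒length≤ {ys = inV₀ ++ C} (filter-allFin (sim? M x)) λ p →
            [ (λ v → ∈-++⁺ˡ (∈-filter⁺ (_∈? V₀) p v)) , ∈-++⁺ʳ inV₀ ]′ (cov (similar⁻ p)))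
          (ℕₚ.≤-trans (ℕₚ.≤-reflexive (length-++ inV₀)) (ℕₚ.+-monoˡ-≤ (length C) inV₀-short))
        absurd : ¬ (size z₀ ≤ classSize M x)
        absurd le with classes x
        ... | inj₂ (C , l , l′ , cov) = not-dominated {y} {c} W₂-bound few 1≤c ex l l′ (ℕₚ.≤-trans le (covered-by C cov))
        ... | inj₁ cov with any? (λ x′ → sim? M x x′ ×-dec ¬? (x′ ∈? K))
        ...   | no none = not-dominated {y} {c} W₂-bound few 1≤c {l = 0} ex z≤n z≤n (ℕₚ.≤-trans le (covered-by [] λ {x′} sim →
                  inj₁ (cov sim (decidable-stable (x′ ∈? K) λ ∉K → none (x′ , sim , ∉K)))))
        ...   | yes (x′ , sim , x′∉) = not-comparable {y} {c} W₂-bound few 1≤c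
                  (sizes≤ x′∉ z₀∉K (λ e → ≁ (Sim-sym {M = M} (Sim-trans {M = M} sim (≈⇒Sim e))))) ex
                  (ℕₚ.≤-trans le (covered-by (cls x′) cov′))
          where
          cov′ : ∀ {u} → Sim M x u → u ∈ V₀ ⊎ u ∈ cls x′
          cov′ {u} s with u ∈? K
          ... | yes u∈ = inj₁ (cov s u∈)
          ... | no u∉ = inj₂ (∈-filter⁺ (≈? x′) (∈-allFin u) (Sim⇒≈ x′∉ u∉ (Sim-trans {M = M} (Sim-sym {M = M} sim) s)))

      others : ∀ x → ¬ z₀ ≈ x → Balanced x
      others x ≉ = fitting⇒balanced x λ ex′ →
        not-both {y} {c} W₂-bound few (sizes≤ z₀∉K (exceeds⇒∉K ex′) ≉) ex ex′

      iso-exceptional : Iso N M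
      iso-exceptional = balanced⇒iso (Exceptional.all-balanced z₀ others
        (ℕₚ.≤-trans (ℕₚ.≤-trans (ℕₚ.≤-reflexive (ℕₚ.+-comm 3 q)) (ℕₚ.≤-trans (ℕₚ.+-mono-≤ (ℕₚ.m≤m+n q (q + 0)) (ℕₚ.+-monoˡ-≤ 2 (ℕₚ.≤-trans 1≤c (ℕₚ.m≤n+m c y))))
          (ℕₚ.≤-reflexive (sym (ℕₚ.+-assoc (2 * q) (y + c) 2))))) (exceeds⇒large {y} {c} W₂-bound few 1≤c ex))
        (fits-B (enough-rounds (ℕₚ.≤-trans (ℕₚ.≤-reflexive (solve 2 (λ w q → w :+ (con 2 :+ q) := con 1 :+ (w :+ q :+ con 1)) refl w q)) (s≤s (b-fits {y} {c} W₂-bound few 1≤c)))))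
        ≈⇒Sim
        (λ {x} sim ≉ x≈ → proj₂ (≈⁻ x≈) (inj₁ (inj₁ (decidable-stable (x ∈? K) λ x∉ → ≉ (Sim⇒≈ z₀∉K x∉ sim)))))
        p refl largest
        (H-mono M N E p≤t (game E)) (H-mono M N A p≤t (game A)))
        where
        open +-*-Solver
        p≤t : p + suc q ≤ t
        p≤t = ℕₚ.≤-trans (ℕₚ.+-monoˡ-≤ (suc q) (≤-max-map (classSize M) (∈-allFin z₀))) t≥σ

    iso : Iso N M
    iso with any? (λ z → suc (r * n + suc r) ℕₚ.≤? suc r * (w + size z))
    ... | yes (z₀ , ex) = iso-exceptional ex
    ... | no none = balanced⇒iso λ x → fitting⇒balanced x λ ex → none (x , ex)

  iso : Iso N M
  iso with n ℕₚ.≤? suc r * (y + c)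
  ... | yes many = Many.iso many
  ... | no few = Few.iso (ℕₚ.≰⇒> few)

H-game⇒Iso : ∀ {L n} (M : Structure L n) q → (∀ i → arity L i ≤ suc q) → (∀ i → 1 ≤ arity L i) → ∀ t →
  (Arithmetic.r q * n) / suc (Arithmetic.r q) + (q * q + q + 2) ≤ t → σ M + suc q ≤ t →
  ∀ {m} (N : Structure L m) → (∀ d → Game.H M N d t []) → Iso N M
H-game⇒Iso {n = suc n} M q arity≤ arity≥ t t≥ t≥σ N game =
  Finish.iso M q arity≤ arity≥ sparseV (Build.build M q arity≤ sparseV zero q ℕₚ.≤-refl) t t≥ t≥σ N game
  where sparseV = Construction.sparseSet M q arity≤
-- The empty structure offers no element to start the construction. The second bound guarantees one
-- round, and since a move in `N` would have no answer, `N` is empty too.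
H-game⇒Iso {n = zero} M q _ arity≥ zero _ () N game
H-game⇒Iso {n = zero} M q _ arity≥ (suc t) _ _ {m} N game = record
  { bij = mk↔ₛ′ empty (λ ()) (λ ()) (λ y → contradiction (empty y) λ ())
  ; preserve = λ i v → contradiction (empty (Vec.lookup v (fromℕ< (arity≥ i)))) λ () }
  where
  empty : Fin m → Fin zero
  empty y = proj₁ (proj₂ (game A) y)

defining-sentence : (L : Vocab) → All (1 ≤_) L → ∀ k → maxArity L ≡ k → 1 ≤ k → (n : ℕ) (M : Structure L n) →
  Σ (Formula L 0) λ Φ → Defines Φ M × alt Φ ≤ 1 ×
    ((2 * k * qr Φ ≤ (2 * k ∸ 1) * n + 2 * k * (k * k ∸ k + 2)) ⊎ qr Φ ≤ σ M + k)
defining-sentence L pos (suc q) max≡ _ n M = Φ , (H-sentence-self t′ , λ m N sat →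
    H-game⇒Iso M q (λ i → ℕₚ.≤-trans (arity≤maxArity L i) (ℕₚ.≤-reflexive max≡)) (arity≥1 {L} pos) (suc t′)
      (subst (bound₁ ≤_) t≡ (ℕₚ.m≤m⊔n bound₁ bound₂)) (subst (bound₂ ≤_) t≡ (ℕₚ.m≤n⊔m bound₁ bound₂)) N (H-sentence⇒H N pos t′ sat)) ,
  alt-sentence t′ , quantifier-rank (ℕₚ.⊔-sel bound₁ bound₂)
  where
  open Hintikka M
  open Arithmetic q
  bound₁ = (r * n) / suc r + (q * q + q + 2)
  bound₂ = σ M + suc q
  -- `H-sentence` accounts for one round more than its argument.
  t′ = (bound₁ ⊔ bound₂) ∸ 1
  Φ = H-sentence t′
  t≡ : bound₁ ⊔ bound₂ ≡ suc t′
  t≡ = sym (ℕₚ.m+[n∸m]≡n {1} (ℕₚ.≤-trans (ℕₚ.≤-trans (s≤s z≤n) (ℕₚ.m≤n+m (suc q) (σ M))) (ℕₚ.m≤n⊔m bound₁ bound₂)))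
  qr≤ : qr Φ ≤ bound₁ ⊔ bound₂
  qr≤ = subst (qr Φ ≤_) (sym t≡) (qr-sentence t′)
  quantifier-rank : bound₁ ⊔ bound₂ ≡ bound₁ ⊎ bound₁ ⊔ bound₂ ≡ bound₂ →
    (2 * suc q * qr Φ ≤ r * n + 2 * suc q * (suc q * suc q ∸ suc q + 2)) ⊎ qr Φ ≤ σ M + suc q
  quantifier-rank (inj₂ eq) = inj₂ (subst (qr Φ ≤_) eq qr≤)
  quantifier-rank (inj₁ eq) = inj₁ (begin
    suc r * qr Φ                                         ≤⟨ ℕₚ.*-monoʳ-≤ (suc r) (subst (qr Φ ≤_) eq qr≤) ⟩
    suc r * ((r * n) / suc r + (q * q + q + 2))          ≡⟨ ℕₚ.*-distribˡ-+ (suc r) ((r * n) / suc r) _ ⟩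
    suc r * ((r * n) / suc r) + suc r * (q * q + q + 2)  ≡⟨ cong₂ (λ a b → a + suc r * (b + 2)) (ℕₚ.*-comm (suc r) ((r * n) / suc r))
                                                              (trans (ℕₚ.+-comm (q * q) q) (trans (sym (ℕₚ.*-suc q q)) (sym (ℕₚ.m+n∸m≡n (suc q) (q * suc q))))) ⟩
    (r * n) / suc r * suc r + suc r * (suc q * suc q ∸ suc q + 2)  ≤⟨ ℕₚ.+-monoˡ-≤ _ (m/n*n≤m (r * n) (suc r)) ⟩
    r * n + suc r * (suc q * suc q ∸ suc q + 2)          ∎)
    where open ℕₚ.≤-Reasoning

theorem4p10 : (L : Vocab) → All (1 ≤_) L → 1 ≤ maxArity L →
    (n : ℕ) (M : Structure L n) →
    Σ (Formula L 0) λ Φ → Defines Φ M × alt Φ ≤ 1 ×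
    ((2 * maxArity L * qr Φ ≤ (2 * maxArity L ∸ 1) * n
    + 2 * maxArity L * (maxArity L * maxArity L ∸ maxArity L + 2))
    ⊎ qr Φ ≤ σ M + maxArity L)
theorem4p10 L pos = defining-sentence L pos (maxArity L) refl
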